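{- Let $\sigma>1$ be an integer, $\omega$ a primitive $\sigma$-th root of unity, $G$ a matrix of rank $r$ with column set $E$, and $\mathbb{A}$ of order $q$, in the setting described in the context. For a binary operation $\circ$ on subsets of $E$ and $k=0,\dots,\sigma-1$, let $\mathcal{M}^\circ(k,\sigma)$ be the set of pairs $(f,g)$ of functions $f,g:E\to\mathbb{A}$ such that $f-g$ is a flow of $G$ over $\mathbb{A}$ and $|\mathrm{supp}(f)\circ\mathrm{supp}(g)|\equiv k\pmod\sigma$. Then: (a) $\sum_{k=0}^{\sigma-1}\omega^k|\mathcal{M}^\cup(k,\sigma)| = (1-\omega)^r(\omega q)^{|E|-r}R\!\left(M(G);\frac{\omega q^2}{1-\omega},\frac{1-\omega}{\omega q}\right)$. (b) If $2+\omega(q-2)\ne0$, then $\sum_{k=0}^{\sigma-1}\omega^k|\mathcal{M}^\cap(k,\sigma)| = (\omega-1)^r(2+\omega(q-2))^{|E|-r}R\!\left(M(G);\frac{q(2+\omega(q-2))}{\omega-1},\frac{\omega-1}{2+\omega(q-2)}\right)$. (c) If $2\omega+q-2\ne0$, then $\sum_{k=0}^{\sigma-1}\omega^k|\mathcal{M}^\Delta(k,\sigma)| = (2-2\omega)^r(2\omega+q-2)^{|E|-r}R\!\left(M(G);\frac{q(2\omega+q-2)}{2-2\omega},\frac{2-2\omega}{2\omega+q-2}\right)$. (d) $\sum_{k=0}^{\sigma-1}\omega^k|\mathcal{M}^{|}(k,\sigma)| = (\omega-1)^rq^{|E|-r}R\!\left(M(G);\frac{q^2}{\omega-1},\frac{\omega-1}{q}\right)$.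 (e) If $1+\omega(q-1)\ne0$, then $\sum_{k=0}^{\sigma-1}\omega^k|\mathcal{M}^{\to}(k,\sigma)| = (\omega-1)^r(1+\omega(q-1))^{|E|-r}R\!\left(M(G);\frac{q(1+\omega(q-1))}{\omega-1},\frac{\omega-1}{1+\omega(q-1)}\right)$.
   Context: Set operations on subsets $A,B\subseteq E$: $\cup$ union, $\cap$ intersection, $\Delta$ symmetric difference, Sheffer stroke $A\,|\,B=E\setminus(A\cup B)$, implication $A\to B=(E\setminus A)\cup B$. Setting (the paper's hypothesis "$G$ is a totally-$\mathbb{P}$ matrix and $\mathbb{A}$ a $\mathbb{P}$-module of order $q$", read as the following cases): either (i) $G$ is the vertex–edge or cycle–edge matrix of a graph with edge set $E$, or a totally unimodular matrix, and $\mathbb{A}$ is an Abelian group of order $q$; or (ii) $G$ is a matrix over $\mathrm{GF}(p^s)$, $\mathbb{A}=\mathrm{GF}(p^s)^d$, $q=p^{sd}$. With $H$ a matrix orthogonally dual to $G$ (same columns, rows of $H$ orthogonal to rows of $G$, ranks summing to $|E|$; integer in case (i)), a flow of $G$ over $\mathbb{A}$ is $h:E\to\mathbb{A}$ with $Hh^T=0$ (equivalently an $\mathbb{A}$-combination of rows of $G$). $\mathrm{supp}(f)=\{e: f(e)\ne0\}$. $M(G)$ is the matroid on $E$ of linear dependence of the columns of $G$, rank function $\mathrm{rk}$, rank $r$; $R(M;\lambda,x)=\sum_{B\subseteq E}\lambda^{r-\mathrm{rk}(B)}x^{|B|-\mathrm{rk}(B)}$. -}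

module Defs where

open import Level using (Level; _⊔_; 0ℓ; Lift) renaming (suc to lsuc)
open import Data.Nat as ℕ using (ℕ; zero; suc; _∸_; _<_; _≤_; _^_)
open import Data.Nat.DivMod using (_%_)
open import Data.Nat.Primality using (Prime)
open import Data.Integer as ℤ using (ℤ; +_; -[1+_])
open import Data.Rational as ℚ using (ℚ)
import Data.Rational.Properties as ℚP
open import Data.Fin as Fin using (Fin; zero; suc; punchIn; toℕ)
open import Data.Fin.Subset as Sub using (Subset; _∪_; _∩_; ∁; ∣_∣; _∈_; _∉_; _⊆_; ⊤; inside; outside)
open import Data.Fin.Properties using (all?)
open import Data.Vec using (Vec; []; _∷_; zipWith; tabulate)
open import Data.Bool using (Bool; true; false; _xor_; not; if_then_else_; _∧_)
open import Data.List using (List; length)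
open import Data.List.Relation.Unary.All using (All)
open import Data.List.Relation.Unary.Any using (Any)
open import Data.List.Relation.Unary.AllPairs using (AllPairs)
import Data.List.Membership.Setoid as SetoidMembership
open import Data.Product using (Σ; ∃; ∃-syntax; _×_; _,_)
open import Data.Sum using (_⊎_)
open import Function.Definitions using (Injective)
open import Relation.Nullary using (¬_; Dec; does)
open import Relation.Binary.PropositionalEquality using (_≡_; _≢_)
open import Relation.Binary using (Setoid; Decidable)
open import Algebra.Bundles using (CommutativeRing; AbelianGroup)
import Data.Vec.Functional.Relation.Binary.Equality.Setoid as FunEq

sumFin : ∀ {a} {A : Set a} → A → (A → A → A) → ∀ {n} → (Fin n → A) → A
sumFin z _+_ {zero}  f = z
sumFin z _+_ {suc n} f = f zero + sumFin z _+_ (λ i → f (suc i))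

sumℕ : ∀ {a} {A : Set a} → A → (A → A → A) → ℕ → (ℕ → A) → A
sumℕ z _+_ zero    f = z
sumℕ z _+_ (suc n) f = sumℕ z _+_ n f + f n

sumSubsets : ∀ {a} {A : Set a} → A → (A → A → A) → ∀ {m} → (Subset m → A) → A
sumSubsets z _+_ {zero}  F = F []
sumSubsets z _+_ {suc m} F =
  sumSubsets z _+_ (λ B → F (outside ∷ B)) + sumSubsets z _+_ (λ B → F (inside ∷ B))

-- An n × m matrix (rows Fin n, columns = ground set E = Fin m)
Matrix : ∀ {a} → Set a → ℕ → ℕ → Set a
Matrix A n m = Fin n → Fin m → A

module RingOps {c ℓ} (R : CommutativeRing c ℓ) where
  open CommutativeRing R

  infixl 6 _−_
  _−_ : Carrier → Carrier → Carrier
  x − y = x + (- y)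

  pow : Carrier → ℕ → Carrier
  pow x zero    = 1#
  pow x (suc n) = x * pow x n

  ι : ℕ → Carrier
  ι zero    = 0#
  ι (suc n) = 1# + ι n

  Σᶠ : ∀ {n} → (Fin n → Carrier) → Carrier
  Σᶠ = sumFin 0# _+_

  Independent : ∀ {n m} → Matrix Carrier n m → Subset m → Set (c ⊔ ℓ)
  Independent {n} {m} G S =
    (coef : Fin m → Carrier) →
    (∀ e → e ∉ S → coef e ≈ 0#) →
    (∀ i → Σᶠ (λ e → coef e * G i e) ≈ 0#) →
    ∀ e → coef e ≈ 0#

  IsRankFunction : ∀ {n m} → Matrix Carrier n m → (Subset m → ℕ) → Set (c ⊔ ℓ)
  IsRankFunction {n} {m} G rk = ∀ (B : Subset m) →
    (∃[ I ] (I ⊆ B × Independent G I × ∣ I ∣ ≡ rk B)) ×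
    (∀ I → I ⊆ B → Independent G I → ∣ I ∣ ≤ rk B)

record Field c ℓ : Set (lsuc (c ⊔ ℓ)) where
  field
    commRing : CommutativeRing c ℓ
  open CommutativeRing commRing public using (Carrier; _≈_; setoid)
  open CommutativeRing commRing using (0#; 1#; _*_)
  field
    0≉1     : ¬ (0# ≈ 1#)
    inverse : ∀ x → ¬ (x ≈ 0#) → ∃[ y ] (x * y ≈ 1#)

module _ {c ℓ} (K : Field c ℓ) where
  open Field K using (commRing)
  open CommutativeRing commRing
  open RingOps commRing

  CharacteristicZero : Set ℓ
  CharacteristicZero = ∀ n → ¬ (ι (suc n) ≈ 0#)

  PrimitiveRoot : ℕ → Carrier → Set ℓ
  PrimitiveRoot σ ω = pow ω σ ≈ 1# × (∀ j → 0 < j → j < σ → ¬ (pow ω j ≈ 1#))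

record FiniteField c ℓ : Set (lsuc (c ⊔ ℓ)) where
  field
    field′ : Field c ℓ
  open Field field′ public
  open SetoidMembership setoid using () renaming (_∈_ to _∈ₗ_)
  field
    _≟_        : Decidable _≈_
    elements   : List Carrier
    enumerates : ∀ x → x ∈ₗ elements
    distinct   : AllPairs (λ x y → ¬ (x ≈ y)) elements
    p s        : ℕ
    p-prime    : Prime p
    order      : length elements ≡ p ^ s

altSign : ℕ → ℤ
altSign zero          = + 1
altSign (suc zero)    = ℤ.- (+ 1)
altSign (suc (suc k)) = altSign k

det : ∀ {k} → Matrix ℤ k k → ℤ
det {zero}  M = + 1
det {suc k} M = sumFin (+ 0) ℤ._+_
  (λ j → altSign (toℕ j) ℤ.* (M zero j ℤ.* det (λ a b → M (suc a) (punchIn j b))))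

TotallyUnimodular : ∀ {n m} → Matrix ℤ n m → Set
TotallyUnimodular {n} {m} G =
  ∀ k (ρ : Fin k → Fin n) (κ : Fin k → Fin m) →
  Injective _≡_ _≡_ ρ → Injective _≡_ _≡_ κ →
  let D = det (λ a b → G (ρ a) (κ b)) in
  D ≡ + 0 ⊎ D ≡ + 1 ⊎ D ≡ ℤ.- (+ 1)

incidence : ∀ {v m} → (tail head : Fin m → Fin v) → Matrix ℤ v m
incidence tail head x e =
  if does (x Fin.≟ tail e) ∧ not (does (x Fin.≟ head e)) then + 1 else
  (if does (x Fin.≟ head e) ∧ not (does (x Fin.≟ tail e)) then ℤ.- (+ 1) else + 0)

IsVertexEdgeMatrix : ∀ {n m} → Matrix ℤ n m → Set
IsVertexEdgeMatrix {n} {m} G =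
  ∃[ tail ] ∃[ head ] (∀ x e → G x e ≡ incidence {n} {m} tail head x e)

InKernel : ∀ {v m} → Matrix ℤ v m → (Fin m → ℤ) → Set
InKernel D c = ∀ x → sumFin (+ 0) ℤ._+_ (λ e → D x e ℤ.* c e) ≡ + 0

IsSignedCycle : ∀ {v m} → Matrix ℤ v m → (Fin m → ℤ) → Set
IsSignedCycle {v} {m} D c =
  (∀ e → c e ≡ + 0 ⊎ c e ≡ + 1 ⊎ c e ≡ ℤ.- (+ 1)) ×
  InKernel D c ×
  (∃[ e ] (c e ≢ + 0)) ×
  (∀ c′ → InKernel D c′ → (∀ e → c e ≡ + 0 → c′ e ≡ + 0) → (∃[ e ] (c′ e ≢ + 0)) →
     ∀ e → c′ e ≡ + 0 → c e ≡ + 0)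

-- cycle–edge matrix: the rows are the signed cycles of a directed graph,
-- each cycle occurring exactly once (with one of its two orientations)
IsCycleEdgeMatrix : ∀ {n m} → Matrix ℤ n m → Set
IsCycleEdgeMatrix {n} {m} G =
  ∃[ v ] ∃[ tail ] ∃[ head ]
    (let D = incidence {v} {m} tail head in
     (∀ i → IsSignedCycle D (G i)) ×
     (∀ c → IsSignedCycle D c → ∃[ i ] ((∀ e → G i e ≡ c e) ⊎ (∀ e → G i e ≡ ℤ.- c e))) ×
     (∀ i j → (∀ e → ℤ.∣ G i e ∣ ≡ ℤ.∣ G j e ∣) → i ≡ j))

TotallyPInteger : ∀ {n m} → Matrix ℤ n m → Set
TotallyPInteger G = IsVertexEdgeMatrix G ⊎ IsCycleEdgeMatrix G ⊎ TotallyUnimodular G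

module _ {a ℓ} (𝔸 : AbelianGroup a ℓ) where
  open AbelianGroup 𝔸
  open SetoidMembership setoid using () renaming (_∈_ to _∈ₗ_)

  HasOrder : ℕ → Set (a ⊔ ℓ)
  HasOrder q = ∃[ xs ] (length xs ≡ q × (∀ x → x ∈ₗ xs) × AllPairs (λ x y → ¬ (x ≈ y)) xs)

  natMul : ℕ → Carrier → Carrier
  natMul zero    x = ε
  natMul (suc n) x = x ∙ natMul n x

  intMul : ℤ → Carrier → Carrier
  intMul (+ n)      x = natMul n x
  intMul -[1+ n ]   x = (natMul (suc n) x) ⁻¹

data Setting (a ℓ : Level) (n m q : ℕ) : Set (lsuc (a ⊔ ℓ)) where
  caseI  : (G : Matrix ℤ n m) → TotallyPInteger G →
           (𝔸 : AbelianGroup a ℓ) → Decidable (AbelianGroup._≈_ 𝔸) → HasOrder 𝔸 q →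
           Setting a ℓ n m q
  -- case (ii): G over F = GF(p^s), 𝔸 = F^d, q = (p^s)^d
  caseII : (F : FiniteField a ℓ) (d : ℕ) →
           q ≡ (FiniteField.p F ^ FiniteField.s F) ^ d →
           (G : Matrix (FiniteField.Carrier F) n m) →
           Setting a ℓ n m q

record FlowData a ℓ (m : ℕ) : Set (lsuc (a ⊔ ℓ)) where
  field
    𝔸setoid : Setoid a ℓ
  open Setoid 𝔸setoid
  field
    0𝔸      : Carrier
    _−𝔸_    : Carrier → Carrier → Carrier
    isZero? : ∀ x → Dec (x ≈ 0𝔸)
    IsFlow  : (Fin m → Carrier) → Set (a ⊔ ℓ)

flowData : ∀ {a ℓ n m q} → Setting a ℓ n m q → FlowData a ℓ m
flowData {n = n} {m} (caseI G _ 𝔸 _≟_ _) = record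
  { 𝔸setoid = setoid ; 0𝔸 = ε ; _−𝔸_ = λ x y → x ∙ (y ⁻¹) ; isZero? = λ x → x ≟ ε
  ; IsFlow  = λ h → Σ (Fin n → Carrier) λ coef → (∀ e → h e ≈ sumFin ε _∙_ (λ i → intMul 𝔸 (G i e) (coef i)))
  }
  where open AbelianGroup 𝔸
flowData {n = n} {m} (caseII F d _ G) = record
  { 𝔸setoid = FunEq.≋-setoid setoid d
  ; 0𝔸 = λ _ → 0#
  ; _−𝔸_ = λ x y j → x j − y j
  ; isZero? = λ x → all? (λ j → x j ≟ 0#)
  ; IsFlow  = λ h → Σ (Fin n → Fin d → Carrier) λ coef → (∀ e j → h e j ≈ Σᶠ (λ i → G i e * coef i j))
  }
  where
  open FiniteField F
  open CommutativeRing commRing using (0#; _*_)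
  open RingOps commRing using (_−_; Σᶠ)

IsRank : ∀ {a ℓ n m q} → Setting a ℓ n m q → (Subset m → ℕ) → Set (a ⊔ ℓ)
IsRank {a} {ℓ} (caseI G _ _ _ _) rk =
  Lift (a ⊔ ℓ) (RingOps.IsRankFunction ℚP.+-*-commutativeRing (λ i e → G i e ℚ./ 1) rk)
IsRank (caseII F d _ G) rk = RingOps.IsRankFunction (Field.commRing (FiniteField.field′ F)) G rk

data SetOp : Set where
  union intersection symdiff sheffer implication : SetOp

applyOp : ∀ {m} → SetOp → Subset m → Subset m → Subset m
applyOp union        A B = A ∪ B
applyOp intersection A B = A ∩ B
applyOp symdiff      A B = zipWith _xor_ A B
applyOp sheffer      A B = ∁ (A ∪ B)
applyOp implication  A B = ∁ A ∪ B

_mod_ : ℕ → ℕ → ℕ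
n mod zero    = n
n mod (suc s) = n % suc s

module _ {a ℓ m} (FD : FlowData a ℓ m) where
  open FlowData FD
  open Setoid 𝔸setoid

  supp : (Fin m → Carrier) → Subset m
  supp f = tabulate (λ e → not (does (isZero? (f e))))

  Pair : Set a
  Pair = (Fin m → Carrier) × (Fin m → Carrier)

  _≈ₚ_ : Pair → Pair → Set ℓ
  (f , g) ≈ₚ (f′ , g′) = (∀ e → f e ≈ f′ e) × (∀ e → g e ≈ g′ e)

  InM : SetOp → ℕ → ℕ → Pair → Set (a ⊔ ℓ)
  InM ∘ σ k (f , g) = IsFlow (λ e → f e −𝔸 g e) × ∣ applyOp ∘ (supp f) (supp g) ∣ mod σ ≡ k

  HasCardinality : (Pair → Set (a ⊔ ℓ)) → ℕ → Set (a ⊔ ℓ)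
  HasCardinality P N = ∃[ xs ]
    (length xs ≡ N × All P xs × (∀ x → P x → Any (x ≈ₚ_) xs) × AllPairs (λ x y → ¬ (x ≈ₚ y)) xs)

CardM : ∀ {a ℓ n m q} → Setting a ℓ n m q → SetOp → ℕ → ℕ → ℕ → Set (a ⊔ ℓ)
CardM S ∘ σ k N = HasCardinality (flowData S) (InM (flowData S) ∘ σ k) N

module Identities {c ℓ} (K : Field c ℓ) (σ : ℕ) (ω : Field.Carrier K)
                  (m q : ℕ) (rk : Subset m → ℕ) (N : SetOp → ℕ → ℕ) where
  open Field K using (commRing)
  open CommutativeRing commRing
  open RingOps commRing

  r : ℕ
  r = rk ⊤

  qK : Carrier
  qK = ι q

  LHS : SetOp → Carrier
  LHS ∘ = sumℕ 0# _+_ σ (λ k → pow ω k * ι (N ∘ k))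

  Rpoly : Carrier → Carrier → Carrier
  Rpoly λ′ x = sumSubsets 0# _+_ (λ B → pow λ′ (r ∸ rk B) * pow x (∣ B ∣ ∸ rk B))

  -- λ′ and x below are the quotients  num/den  (λ′ * den ≈ num)
  PartA : Set (c ⊔ ℓ)
  PartA = ∀ λ′ x →
    λ′ * (1# − ω) ≈ ω * qK * qK →
    x * (ω * qK) ≈ 1# − ω →
    LHS union ≈ pow (1# − ω) r * pow (ω * qK) (m ∸ r) * Rpoly λ′ x

  PartB : Set (c ⊔ ℓ)
  PartB = let D = ι 2 + ω * (qK − ι 2) in
    ¬ (D ≈ 0#) → ∀ λ′ x →
    λ′ * (ω − 1#) ≈ qK * D →
    x * D ≈ ω − 1# →
    LHS intersection ≈ pow (ω − 1#) r * pow D (m ∸ r) * Rpoly λ′ x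

  PartC : Set (c ⊔ ℓ)
  PartC = let D = ι 2 * ω + qK − ι 2 in
    ¬ (D ≈ 0#) → ∀ λ′ x →
    λ′ * (ι 2 − ι 2 * ω) ≈ qK * D →
    x * D ≈ ι 2 − ι 2 * ω →
    LHS symdiff ≈ pow (ι 2 − ι 2 * ω) r * pow D (m ∸ r) * Rpoly λ′ x

  PartD : Set (c ⊔ ℓ)
  PartD = ∀ λ′ x →
    λ′ * (ω − 1#) ≈ qK * qK →
    x * qK ≈ ω − 1# →
    LHS sheffer ≈ pow (ω − 1#) r * pow qK (m ∸ r) * Rpoly λ′ x

  PartE : Set (c ⊔ ℓ)
  PartE = let D = 1# + ω * (qK − 1#) in
    ¬ (D ≈ 0#) → ∀ λ′ x →
    λ′ * (ω − 1#) ≈ qK * D →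
    x * D ≈ ω − 1# →
    LHS implication ≈ pow (ω − 1#) r * pow D (m ∸ r) * Rpoly λ′ x

module Submission where

-- Put h = f − g. Summing ω ^ |supp f ∘ supp g| over g first, each edge e contributes a factor that only
-- depends on whether h e = 0: say D + d if h e = 0, and D otherwise. Expanding the product of these factors
-- turns the left-hand side into Σ_B d^|B| D^(|E| − |B|) #{flows vanishing on B}, and this is the rank
-- polynomial as soon as the number of flows vanishing on B is q^(r − rk B).
--
-- For this count choose a maximal independent set I such that I ∩ B is maximal independent in B, together
-- with dual vectors: row combinations of G that are unit vectors on I. They show that the flows vanishing
-- on B correspond to arbitrary functions on I ∖ B. Over a field dual vectors come from Gaussian elimination.
-- For an integer matrix they must be integral: for a vertex–edge matrix one rounds a rational potential down,
-- for a cycle–edge matrix the dual vector of j is a circuit through j (whose entries are ±1, again by rounding),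
-- and for a totally unimodular matrix it consists of cofactors of a minor ±1.

open import Defs
open import Level using (Level; _⊔_; 0ℓ; lower)
open import Data.Nat as ℕ using (ℕ; zero; suc; _≤_; _^_; _∸_; _<_)
import Data.Nat.Properties as ℕP
open import Data.Fin using (Fin; zero; suc; punchIn; toℕ)
open import Data.Fin.Properties using (_≟_; all?; ¬∀⟶∃¬; suc-injective; injective⇒≤)
open import Data.Fin.Subset
  using (Subset; _∪_; _∩_; ⁅_⁆; ∣_∣; _∈_; _∉_; _⊆_; ⊤; inside; outside; ∁) renaming (⊥ to ∅)
open import Data.Fin.Subset.Properties
  using (_∈?_; ∉⊥; ∈⊤; x∈⁅x⁆; x∈⁅y⁆⇒x≡y; x∈p∪q⁻; p⊆p∪q; q⊆p∪q; x∈p∩q⁺; p∩q⊆p; p∩q⊆q; p⊆q⇒∣p∣≤∣q∣;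
    p⊂q⇒∣p∣<∣q∣; drop-not-there; x∈p⇒x∉∁p; x∉p⇒x∈∁p; ∩-identityʳ; ∣p∣≤n; ∣⊤∣≡n)
open import Data.Bool using (if_then_else_; true; false; not; Bool; _∨_; _∧_; _xor_)
open import Data.List as List
  using (List; []; _∷_; allFin; length; lookup; filter; map; cartesianProductWith;
    cartesianProduct; _++_)
open import Data.List.Membership.Propositional using () renaming (_∈_ to _∈ˡ_)
open import Data.List.Membership.Propositional.Properties using (∈-allFin; ∈-filter⁺; ∈-filter⁻; ∈-lookup)
open import Data.List.Relation.Unary.Any as Any using (here; there; index; Any)
open import Data.Product using (∃-syntax; _×_; _,_; proj₁; proj₂; Σ)
open import Data.Sum using (_⊎_; inj₁; inj₂)
open import Data.Integer as ℤ using (ℤ; +_; -[1+_])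
import Data.Integer.Properties as ℤP
import Data.Integer.DivMod as ℤD
open import Data.Rational as ℚ using (ℚ; 0ℚ; 1ℚ)
import Data.Rational.Properties as ℚP
open import Data.Rational.Unnormalised as ℚᵘ using (mkℚᵘ; *≡*)
import Data.Rational.Unnormalised.Properties as ℚᵘP
open import Data.Vec using (tabulate; []; _∷_; here; there)
open import Data.Vec.Properties using (lookup⇒[]=; []=⇒lookup; lookup∘tabulate; tabulate-cong)
open import Data.List.Relation.Unary.AllPairs using (AllPairs; []; _∷_)
open import Data.List.Relation.Unary.All as All using (All; []; _∷_)
open import Data.Integer.Tactic.RingSolver using (solve-∀)
open import Data.List.Relation.Unary.Any.Properties as AnyP using (lookup-index)
open import Data.List.Relation.Unary.Unique.Propositional.Properties using (allFin⁺; filter⁺)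
open import Data.Vec.Functional using () renaming (_∷_ to _∷ᶠ_)
open import Data.Unit using () renaming (⊤ to ⊤₀)
open import Data.List.Properties using (length-map; length-++)
import Data.List.Relation.Unary.All.Properties as AllP
import Data.List.Relation.Unary.AllPairs.Properties as AllPairsP
open import Data.List.Relation.Unary.Unique.Setoid.Properties
  using (map⁺; cartesianProductWith⁺; cartesianProduct⁺)
import Data.Vec.Functional.Relation.Binary.Equality.Setoid as FunEq
open import Data.Nat.DivMod using (_%_; _/_; m≡m%n+[m/n]*n; m%n<n)
open import Data.Product.Relation.Binary.Pointwise.NonDependent using (×-setoid)
open import Function using (id) renaming (_∘_ to _∘ᶠ_)
open import Function.Definitions using (Injective)
open import Relation.Nullary using (¬_; Dec; does; yes; no; contradiction)
open import Relation.Binary using (Decidable; Setoid)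
open import Relation.Binary.PropositionalEquality as ≡ using (_≡_; _≢_)
import Relation.Binary.Reasoning.Setoid as SetoidReasoning
open import Relation.Nullary.Decidable using (dec-true; ¬?; _×-dec_; _→-dec_)
open import Relation.Unary using () renaming (Decidable to Decidable₁)
open import Algebra.Bundles using (CommutativeMonoid; CommutativeRing; AbelianGroup)
import Algebra.Properties.CommutativeSemigroup as CommSemigroup
import Algebra.Properties.Ring as RingProps
open import Algebra.Morphism.Structures using (IsRingMonomorphism)
open import Algebra.Module.Bundles using (LeftModule)
open import Algebra.Structures using (IsAbelianGroup)
import Algebra.Properties.Group as GroupProps
import Algebra.Morphism.Construct.Identity as Identity
import Algebra.Properties.AbelianGroup as AbelianGroupProps
import Algebra.Properties.CommutativeMonoid.Mult as Mult
import Algebra.Solver.Ring.NaturalCoefficients.Default as NatSolver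

-- The count of flows is where an arbitrary integer matrix fails. For the 1 × 1 matrix with entry 2
-- and the group of order 2 the rational rank is 1, but the only flow is zero, so q^r = 2 is wrong.
-- Rank is measured over ℚ while flows take values in a group on which only ℤ acts; integral dual
-- vectors bridge the two, and producing them is the one place where the classes of matrices have to
-- be treated separately. Dual vectors also replace independence as the working notion. Independence
-- quantifies over all coefficient vectors and gives nothing to compute with. A dual system is a
-- finite certificate of it, and it determines every expansion: the coefficient of a column at j can
-- only be its product with the dual vector of j. Hence one test of an equation decides whether a
-- column is spanned, and coefficients that exist over ℚ are integral as soon as the dual vectors
-- are.

private variable
  a a′ r ℓ ℓ′ p p′ : Level
  n m k : ℕ

-- Finite sums in commutative monoids

module Sums (M : CommutativeMonoid a ℓ) where
  open CommutativeMonoid M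
  open SetoidReasoning setoid

  -- Opaque so that the unifier can infer the length and the summand.
  opaque
    ∑ : (Fin n → Carrier) → Carrier
    ∑ = sumFin ε _∙_

    ∑≡sumFin : (f : Fin n → Carrier) → ∑ f ≡ sumFin ε _∙_ f
    ∑≡sumFin f = ≡.refl

    ∑-cong : {f g : Fin n → Carrier} → (∀ i → f i ≈ g i) → ∑ f ≈ ∑ g
    ∑-cong {zero}  f≈g = refl
    ∑-cong {suc n} f≈g = ∙-cong (f≈g zero) (∑-cong (f≈g ∘ᶠ suc))

    ∑-ε : {f : Fin n → Carrier} → (∀ i → f i ≈ ε) → ∑ f ≈ ε
    ∑-ε {zero}  f≈ε = refl
    ∑-ε {suc n} f≈ε = trans (∙-cong (f≈ε zero) (∑-ε (f≈ε ∘ᶠ suc))) (identityˡ ε)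

    ∑-∙ : (f g : Fin n → Carrier) → ∑ (λ i → f i ∙ g i) ≈ ∑ f ∙ ∑ g
    ∑-∙ {zero}  f g = sym (identityˡ ε)
    ∑-∙ {suc n} f g = trans (∙-congˡ (∑-∙ (f ∘ᶠ suc) (g ∘ᶠ suc)))
      (CommSemigroup.interchange commutativeSemigroup _ _ _ _)

    ∑-swap : (f : Fin n → Fin m → Carrier) →
             ∑ (λ i → ∑ (f i)) ≈ ∑ (λ j → ∑ (λ i → f i j))
    ∑-swap {zero}  {m} f = sym (∑-ε {m} (λ _ → refl))
    ∑-swap {suc n} {m} f = trans (∙-congˡ (∑-swap (f ∘ᶠ suc)))
      (sym (∑-∙ {m} (f zero) (λ j → ∑ (λ i → f (suc i) j))))

    ∑-single : (k : Fin n) {f : Fin n → Carrier} → (∀ i → i ≢ k → f i ≈ ε) → ∑ f ≈ f k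
    ∑-single zero    f≈ε = trans (∙-congˡ (∑-ε (λ i → f≈ε (suc i) λ ()))) (identityʳ _)
    ∑-single (suc k) f≈ε = trans
      (∙-cong (f≈ε zero λ ()) (∑-single k (λ i i≢k → f≈ε (suc i) (i≢k ∘ᶠ suc-injective))))
      (identityˡ _)

module _ (M : CommutativeMonoid a ℓ) (N : CommutativeMonoid a′ ℓ′) where
  private
    module M = CommutativeMonoid M
    module N = CommutativeMonoid N

  opaque
    unfolding Sums.∑

    ∑-homo : (h : M.Carrier → N.Carrier) → h M.ε N.≈ N.ε →
             (∀ x y → h (x M.∙ y) N.≈ h x N.∙ h y) →
             (f : Fin n → M.Carrier) → h (Sums.∑ M f) N.≈ Sums.∑ N (h ∘ᶠ f)
    ∑-homo {zero}  h h-ε h-∙ f = h-ε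
    ∑-homo {suc n} h h-ε h-∙ f =
      N.trans (h-∙ _ _) (N.∙-congˡ (∑-homo h h-ε h-∙ (f ∘ᶠ suc)))

-- Dual systems and spans of columns

module DualSystems (R : CommutativeRing a ℓ) where
  open CommutativeRing R
  open RingOps R using (Independent) public
  open RingProps ring
  open Sums +-commutativeMonoid public
  open SetoidReasoning setoid

  *-distribˡ-∑ : ∀ x (f : Fin n → Carrier) → x * ∑ f ≈ ∑ (λ i → x * f i)
  *-distribˡ-∑ x = ∑-homo +-commutativeMonoid +-commutativeMonoid (x *_) (zeroʳ x) (distribˡ x)

  *-distribʳ-∑ : ∀ x (f : Fin n → Carrier) → ∑ f * x ≈ ∑ (λ i → f i * x)
  *-distribʳ-∑ x = ∑-homo +-commutativeMonoid +-commutativeMonoid (_* x) (zeroˡ x) (distribʳ x)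

  ∑-neg : (f : Fin n → Carrier) → - ∑ f ≈ ∑ (λ i → - f i)
  ∑-neg = ∑-homo +-commutativeMonoid +-commutativeMonoid -_ -0#≈0# (λ x y → sym (-‿+-comm x y))

  opaque
    δ : Fin m → Fin m → Carrier
    δ j e = if does (j ≟ e) then 1# else 0#

    δ-≡ : (j : Fin m) → δ j j ≈ 1#
    δ-≡ j with j ≟ j
    ... | yes _   = refl
    ... | no j≢j = contradiction ≡.refl j≢j

    δ-≢ : {j e : Fin m} → j ≢ e → δ j e ≈ 0#
    δ-≢ {j = j} {e} j≢e with j ≟ e
    ... | yes j≡e = contradiction j≡e j≢e
    ... | no _    = refl

  δ-sym : (j e : Fin m) → δ j e ≈ δ e j
  δ-sym j e with j ≟ e
  ... | yes ≡.refl = refl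
  ... | no j≢e     = trans (δ-≢ j≢e) (sym (δ-≢ (j≢e ∘ᶠ ≡.sym)))

  ∑-δ : (j : Fin m) (f : Fin m → Carrier) → ∑ (λ e → f e * δ j e) ≈ f j
  ∑-δ j f = trans
    (∑-single j (λ e e≢j → trans (*-congˡ (δ-≢ (e≢j ∘ᶠ ≡.sym))) (zeroʳ _)))
    (trans (*-congˡ (δ-≡ j)) (*-identityʳ _))

  Supported : Subset m → (Fin m → Carrier) → Set ℓ
  Supported S c = ∀ e → e ∉ S → c e ≈ 0#

  opaque
    mask : Subset m → (Fin m → Carrier) → Fin m → Carrier
    mask S c e = if does (e ∈? S) then c e else 0#

    mask-∈ : (S : Subset m) {c : Fin m → Carrier} {e : Fin m} → e ∈ S → mask S c e ≈ c e
    mask-∈ S {e = e} e∈S with e ∈? S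
    ... | yes _   = refl
    ... | no e∉S = contradiction e∈S e∉S

    mask-∉ : (S : Subset m) {c : Fin m → Carrier} → Supported S (mask S c)
    mask-∉ S e e∉S with e ∈? S
    ... | yes e∈S = contradiction e∈S e∉S
    ... | no _    = refl

    mask-*-cong : (S : Subset m) {c : Fin m → Carrier} {e : Fin m} {x y : Carrier} →
                  (e ∈ S → x ≈ y) → mask S c e * x ≈ mask S c e * y
    mask-*-cong S {e = e} x≈y with e ∈? S
    ... | yes e∈S = *-congˡ (x≈y e∈S)
    ... | no _    = trans (zeroˡ _) (sym (zeroˡ _))

    -- Lets row entries and products with dual vectors trade places under a mask; this identifies
    -- the residual of a row with the residual of a column.
    mask-swap : (S : Subset m) {c d : Fin m → Carrier} {e : Fin m} →
                mask S c e * d e ≈ mask S d e * c e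
    mask-swap S {e = e} with e ∈? S
    ... | yes _ = *-comm _ _
    ... | no _  = trans (zeroˡ _) (sym (zeroˡ _))

  module _ (G : Matrix Carrier n m) where

    opaque
      dot : (Fin n → Carrier) → Fin m → Carrier
      dot y e = ∑ (λ i → y i * G i e)

      comb : (Fin m → Carrier) → Fin n → Carrier
      comb c i = ∑ (λ e → c e * G i e)

      dot≡∑ : ∀ y e → dot y e ≡ ∑ (λ i → y i * G i e)
      dot≡∑ y e = ≡.refl

      comb≡∑ : ∀ c i → comb c i ≡ ∑ (λ e → c e * G i e)
      comb≡∑ c i = ≡.refl

    Spans : Subset m → Fin m → Set (a ⊔ ℓ)
    Spans S e = ∃[ c ] (Supported S c × (∀ i → G i e ≈ comb c i))

    IsDual : Subset m → Fin m → (Fin n → Carrier) → Set ℓ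
    IsDual S j y = ∀ e → e ∈ S → dot y e ≈ δ j e

    -- Amounts to a left inverse of the submatrix on the columns `S`. Over a field this is another
    -- form of independence; over ℤ it is stronger, because the left inverse has to be integral.
    DualSystem : Subset m → Set (a ⊔ ℓ)
    DualSystem S = ∀ j → j ∈ S → ∃[ y ] IsDual S j y

    opaque
      unfolding dot comb

      vectors : ∀ {S} → DualSystem S → Fin m → Fin n → Carrier
      vectors {S} sys j with j ∈? S
      ... | yes j∈S = proj₁ (sys j j∈S)
      ... | no _    = λ _ → 0#

      vectors-dual : ∀ {S} (sys : DualSystem S) {j} → j ∈ S → IsDual S j (vectors sys j)
      vectors-dual {S} sys {j} j∈S with j ∈? S
      ... | yes j∈S′ = proj₂ (sys j j∈S′)
      ... | no j∉S   = contradiction j∈S j∉S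

      -- Associativity of the product y · G · c, obtained by exchanging the two summations.
      ∑-comb : ∀ y c → ∑ (λ i → y i * comb c i) ≈ ∑ (λ e → c e * dot y e)
      ∑-comb y c = begin
        ∑ (λ i → y i * comb c i)                 ≈⟨ ∑-cong (λ i → *-distribˡ-∑ (y i) _) ⟩
        ∑ (λ i → ∑ (λ e → y i * (c e * G i e))) ≈⟨ ∑-swap _ ⟩
        ∑ (λ e → ∑ (λ i → y i * (c e * G i e))) ≈⟨ ∑-cong (λ e → ∑-cong (λ i →
                                                      CommSemigroup.x∙yz≈y∙xz *-commutativeSemigroup _ _ _)) ⟩
        ∑ (λ e → ∑ (λ i → c e * (y i * G i e))) ≈⟨ ∑-cong (λ e → *-distribˡ-∑ (c e) _) ⟨
        ∑ (λ e → c e * dot y e)                  ∎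

      -- All terms except the one at `j` are killed, either by duality on `S` or by the support of
      -- `c`. Thus coefficients over `S` are unique, which later makes them integral.
      dual-coefficient : ∀ {S j y c} → IsDual S j y → Supported S c → ∑ (λ i → y i * comb c i) ≈ c j
      dual-coefficient {S} {j} {y} {c} dual supp = begin
        ∑ (λ i → y i * comb c i) ≈⟨ ∑-comb y c ⟩
        ∑ (λ e → c e * dot y e)  ≈⟨ ∑-cong pointwise ⟩
        ∑ (λ e → c e * δ j e)    ≈⟨ ∑-δ j c ⟩
        c j                       ∎
        where
        pointwise : ∀ e → c e * dot y e ≈ c e * δ j e
        pointwise e with e ∈? S
        ... | yes e∈S = *-congˡ (dual e e∈S)
        ... | no e∉S  = trans (trans (*-congʳ (supp e e∉S)) (zeroˡ _))
                              (sym (trans (*-congʳ (supp e e∉S)) (zeroˡ _)))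

      dot-spanned : ∀ {S j y e} → IsDual S j y → ((c , _) : Spans S e) → dot y e ≈ c j
      dot-spanned dual (c , supp , e≈c) =
        trans (∑-cong (λ i → *-congˡ (e≈c i))) (dual-coefficient dual supp)

      dot-mono : ∀ {S T j y} → S ⊆ T → IsDual T j y → IsDual S j y
      dot-mono S⊆T dual e e∈S = dual e (S⊆T e∈S)

      dualSystem-mono : ∀ {S T} → S ⊆ T → DualSystem T → DualSystem S
      dualSystem-mono S⊆T sys j j∈S = let y , dual = sys j (S⊆T j∈S) in y , dot-mono S⊆T dual

      dualSystem⇒independent : ∀ {S} → DualSystem S → Independent G S
      dualSystem⇒independent {S} sys c supp c≈0 e with e ∈? S
      ... | no e∉S  = supp e e∉S
      ... | yes e∈S = let y , dual = sys e e∈S in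
        trans (sym (dual-coefficient dual supp))
              (∑-ε (λ i → trans (*-congˡ (trans (reflexive (∑≡sumFin _)) (c≈0 i))) (zeroʳ _)))

      comb-cong : ∀ {c d} → (∀ e → c e ≈ d e) → ∀ i → comb c i ≈ comb d i
      comb-cong c≈d i = ∑-cong (λ e → *-congʳ (c≈d e))

      spans-mono : ∀ {S T e} → S ⊆ T → Spans S e → Spans T e
      spans-mono S⊆T (c , supp , e≈c) = c , (λ l l∉T → supp l (l∉T ∘ᶠ S⊆T)) , e≈c

      comb-δ : ∀ e i → G i e ≈ comb (δ e) i
      comb-δ e i = trans (sym (∑-δ e (G i))) (∑-cong (λ l → *-comm _ _))

      ∈⇒spans : ∀ {S e} → e ∈ S → Spans S e
      ∈⇒spans {S} {e} e∈S = δ e , (λ l l∉S → δ-≢ (λ e≡l → l∉S (≡.subst (_∈ S) e≡l e∈S))) , comb-δ e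

      comb-+ : ∀ c d i → comb (λ e → c e + d e) i ≈ comb c i + comb d i
      comb-+ c d i = trans (∑-cong (λ e → distribʳ _ _ _)) (∑-∙ _ _)

      comb-* : ∀ x c i → comb (λ e → x * c e) i ≈ x * comb c i
      comb-* x c i = trans (∑-cong (λ e → *-assoc _ _ _)) (sym (*-distribˡ-∑ x _))

      comb-neg : ∀ c i → comb (λ e → - c e) i ≈ - comb c i
      comb-neg c i = trans (∑-cong (λ e → sym (-‿distribˡ-* _ _))) (sym (∑-neg _))

      dot-+ : ∀ y z e → dot (λ i → y i + z i) e ≈ dot y e + dot z e
      dot-+ y z e = trans (∑-cong (λ i → distribʳ _ _ _)) (∑-∙ _ _)

      dot-* : ∀ x y e → dot (λ i → x * y i) e ≈ x * dot y e
      dot-* x y e = trans (∑-cong (λ i → *-assoc _ _ _)) (sym (*-distribˡ-∑ x _))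

      dot-neg : ∀ y e → dot (λ i → - y i) e ≈ - dot y e
      dot-neg y e = trans (∑-cong (λ i → sym (-‿distribˡ-* _ _))) (sym (∑-neg _))

      dot-δ : ∀ i e → dot (δ i) e ≈ G i e
      dot-δ i e = trans (∑-cong (λ k → *-comm _ _)) (∑-δ i (λ k → G k e))

      dot-∑ : ∀ (x : Fin k → Carrier) (Y : Fin k → Fin n → Carrier) e →
              dot (λ i → ∑ (λ l → x l * Y l i)) e ≈ ∑ (λ l → x l * dot (Y l) e)
      dot-∑ x Y e = begin
        ∑ (λ i → ∑ (λ l → x l * Y l i) * G i e) ≈⟨ ∑-cong (λ i → *-distribʳ-∑ (G i e) _) ⟩
        ∑ (λ i → ∑ (λ l → x l * Y l i * G i e)) ≈⟨ ∑-swap _ ⟩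
        ∑ (λ l → ∑ (λ i → x l * Y l i * G i e)) ≈⟨ ∑-cong (λ l → dot-* (x l) (Y l) e) ⟩
        ∑ (λ l → x l * dot (Y l) e)              ∎

    -- The dual vector Y j is only meaningful for j ∈ basis.
    record FlowBasis (rk : Subset m → ℕ) (B : Subset m) : Set (a ⊔ ℓ) where
      field
        basis    : Subset m
        card     : ∣ basis ∩ B ∣ ≡ rk B
        Y        : Fin m → Fin n → Carrier
        dual     : ∀ j → j ∈ basis → IsDual basis j (Y j)
        spanning : ∀ i e → G i e ≈ comb (mask basis (λ j → dot (Y j) e)) i
        vanish   : ∀ j → j ∈ basis → j ∉ B → ∀ e → e ∈ B → dot (Y j) e ≈ 0#

  opaque
    unfolding dot comb

    -- Shows that a combination of rows of `G` stays in the kernel of `D` when every row lies in it;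
    -- used with the signed cycles as rows.
    comb-dot : (D : Matrix Carrier k m) (G : Matrix Carrier n m) → ∀ y x →
               comb D (dot G y) x ≈ ∑ (λ i → y i * comb D (G i) x)
    comb-dot D G y x = begin
      ∑ (λ e → ∑ (λ i → y i * G i e) * D x e)      ≈⟨ ∑-cong (λ e → *-distribʳ-∑ (D x e) _) ⟩
      ∑ (λ e → ∑ (λ i → y i * G i e * D x e))      ≈⟨ ∑-swap _ ⟩
      ∑ (λ i → ∑ (λ e → y i * G i e * D x e))      ≈⟨ ∑-cong (λ i → comb-* D (y i) (G i) x) ⟩
      ∑ (λ i → y i * ∑ (λ e → G i e * D x e))      ∎

  -- `core` is a maximal independent subset of `B` from which `basis` is grown. It is recorded
  -- separately because expanding a column of `B` inside `B` itself is what forces dual vectors of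
  -- elements outside `B` to vanish on `B`.
  record RankBasis (G : Matrix Carrier n m) (rk : Subset m → ℕ) (B : Subset m) : Set (a ⊔ ℓ) where
    field
      basis  : Subset m
      card   : ∣ basis ∩ B ∣ ≡ rk B
      system : DualSystem G basis
      spans  : ∀ e → Spans G basis e
      core   : Subset m
      core⊆B : core ⊆ B
      core⊆basis : core ⊆ basis
      core-spans : ∀ e → e ∈ B → Spans G core e

-- Gaussian elimination over a field with decidable equality

module FieldLinearAlgebra (K : Field a ℓ) (_≈?_ : Decidable (Field._≈_ K)) where

  open Field K using (0≉1; inverse) renaming (commRing to R)
  open CommutativeRing R
  open DualSystems R
  open RingProps ring
  open SetoidReasoning setoid

  module _ (G : Matrix Carrier n m) where

    -- The dual vectors leave one candidate for the coefficients of column `e`. If it fails in some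
    -- row, that row, cleared on `S`, is nonzero at `e` and can be scaled to the missing dual
    -- vector.
    extend-by-one : ∀ {S} → DualSystem G S → ∀ e → Spans G S e ⊎ DualSystem G (S ∪ ⁅ e ⁆)
    extend-by-one {S} sys e with all? (λ i → G i e ≈? comb G (mask S (λ l → dot G (vectors G sys l) e)) i)
    ... | yes e≈c = inj₁ (_ , mask-∉ S , e≈c)
    ... | no e≉c  = inj₂ system
      where
      Y : Fin m → Fin n → Carrier
      Y = vectors G sys

      Y-dual : ∀ {l} → l ∈ S → IsDual G S l (Y l)
      Y-dual = vectors-dual G sys

      residual : ∃[ i ] ¬ (G i e ≈ comb G (mask S (λ l → dot G (Y l) e)) i)
      residual = ¬∀⟶∃¬ n _ (λ i → G i e ≈? _) e≉c

      i₀ : Fin n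
      i₀ = proj₁ residual

      -- Row `i₀` minus its values on `S` times the dual vectors. It vanishes on `S`, and its value
      -- at `e` is the error of the candidate coefficients in row `i₀`.
      z : Fin n → Carrier
      z i = δ i₀ i + - ∑ (λ l → mask S (G i₀) l * Y l i)

      dot-z : ∀ l → dot G z l ≈ G i₀ l + - ∑ (λ j → mask S (G i₀) j * dot G (Y j) l)
      dot-z l = trans (dot-+ G (δ i₀) _ l)
        (+-cong (dot-δ G i₀ l) (trans (dot-neg G _ l) (-‿cong (dot-∑ G (mask S (G i₀)) Y l))))

      z-⊥-S : ∀ l → l ∈ S → dot G z l ≈ 0#
      z-⊥-S l l∈S = begin
        dot G z l                                                        ≈⟨ dot-z l ⟩
        G i₀ l + - ∑ (λ j → mask S (G i₀) j * dot G (Y j) l)            ≈⟨ +-congˡ (-‿cong (∑-cong pointwise)) ⟩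
        G i₀ l + - ∑ (λ j → mask S (G i₀) j * δ l j)                    ≈⟨ +-congˡ (-‿cong (∑-δ l _)) ⟩
        G i₀ l + - mask S (G i₀) l                                       ≈⟨ +-congˡ (-‿cong (mask-∈ S l∈S)) ⟩
        G i₀ l + - G i₀ l                                                ≈⟨ -‿inverseʳ _ ⟩
        0#                                                               ∎
        where
        pointwise : ∀ j → mask S (G i₀) j * dot G (Y j) l ≈ mask S (G i₀) j * δ l j
        pointwise j = mask-*-cong S (λ j∈S → trans (Y-dual j∈S l l∈S) (δ-sym j l))

      z-e≉0 : ¬ (dot G z e ≈ 0#)
      z-e≉0 z≈0 = proj₂ residual (begin
        G i₀ e                                                ≈⟨ x∙y⁻¹≈ε⇒x≈y _ _ (trans (sym (dot-z e)) z≈0) ⟩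
        ∑ (λ j → mask S (G i₀) j * dot G (Y j) e)            ≈⟨ ∑-cong (λ j → mask-swap S) ⟩
        ∑ (λ j → mask S (λ l → dot G (Y l) e) j * G i₀ j)     ≡⟨ comb≡∑ G _ i₀ ⟨
        comb G (mask S (λ l → dot G (Y l) e)) i₀              ∎)

      e∉S : e ∉ S
      e∉S e∈S = z-e≉0 (z-⊥-S e e∈S)

      w : Carrier
      w = proj₁ (inverse _ z-e≉0)

      y : Fin n → Carrier
      y i = w * z i

      y-e : dot G y e ≈ 1#
      y-e = trans (dot-* G w z e) (trans (*-comm _ _) (proj₂ (inverse _ z-e≉0)))

      y-⊥-S : ∀ l → l ∈ S → dot G y l ≈ 0#
      y-⊥-S l l∈S = trans (dot-* G w z l) (trans (*-congˡ (z-⊥-S l l∈S)) (zeroʳ w))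

      ∪-cases : ∀ {l} → l ∈ S ∪ ⁅ e ⁆ → l ∈ S ⊎ l ≡ e
      ∪-cases l∈ with x∈p∪q⁻ S ⁅ e ⁆ l∈
      ... | inj₁ l∈S = inj₁ l∈S
      ... | inj₂ l∈e = inj₂ (x∈⁅y⁆⇒x≡y e l∈e)

      system : DualSystem G (S ∪ ⁅ e ⁆)
      system j j∈ with ∪-cases j∈
      ... | inj₂ ≡.refl = y , λ l l∈ → case-l l (∪-cases l∈)
        where
        case-l : ∀ l → l ∈ S ⊎ l ≡ j → dot G y l ≈ δ j l
        case-l l (inj₁ l∈S)     = trans (y-⊥-S l l∈S) (sym (δ-≢ λ { ≡.refl → e∉S l∈S }))
        case-l l (inj₂ ≡.refl)  = trans y-e (sym (δ-≡ l))
      ... | inj₁ j∈S = y′ , λ l l∈ → case-l l (∪-cases l∈)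
        where
        -- The old dual vector may be nonzero at `e`. Subtracting that multiple of `y` repairs it
        -- and changes nothing on `S`, where `y` vanishes.
        y′ : Fin n → Carrier
        y′ i = Y j i + - (dot G (Y j) e * y i)
        dot-y′ : ∀ l → dot G y′ l ≈ dot G (Y j) l + - (dot G (Y j) e * dot G y l)
        dot-y′ l = trans (dot-+ G (Y j) _ l)
          (+-congˡ (trans (dot-neg G _ l) (-‿cong (dot-* G _ y l))))
        case-l : ∀ l → l ∈ S ⊎ l ≡ e → dot G y′ l ≈ δ j l
        case-l l (inj₁ l∈S) = begin
          dot G y′ l                                          ≈⟨ dot-y′ l ⟩
          dot G (Y j) l + - (dot G (Y j) e * dot G y l)       ≈⟨ +-congˡ (-‿cong (*-congˡ (y-⊥-S l l∈S))) ⟩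
          dot G (Y j) l + - (dot G (Y j) e * 0#)              ≈⟨ +-congˡ (trans (-‿cong (zeroʳ _)) -0#≈0#) ⟩
          dot G (Y j) l + 0#                                  ≈⟨ +-identityʳ _ ⟩
          dot G (Y j) l                                       ≈⟨ Y-dual j∈S l l∈S ⟩
          δ j l                                               ∎
        case-l l (inj₂ ≡.refl) = begin
          dot G y′ l                                          ≈⟨ dot-y′ l ⟩
          dot G (Y j) l + - (dot G (Y j) l * dot G y l)       ≈⟨ +-congˡ (-‿cong (*-congˡ y-e)) ⟩
          dot G (Y j) l + - (dot G (Y j) l * 1#)              ≈⟨ +-congˡ (-‿cong (*-identityʳ _)) ⟩
          dot G (Y j) l + - dot G (Y j) l                     ≈⟨ -‿inverseʳ _ ⟩
          0#                                                  ≈⟨ δ-≢ (λ { ≡.refl → e∉S j∈S }) ⟨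
          δ j l                                               ∎

    private
      Extension : Subset m → Subset m → (Fin m → Set) → Set (a ⊔ ℓ)
      Extension S T P = ∃[ S′ ] (S ⊆ S′ × S′ ⊆ T × DualSystem G S′ × (∀ e → P e → e ∈ T → Spans G S′ e))

      -- One greedy pass suffices: a column that is spanned when it is inspected stays spanned as
      -- the set grows.
      extend-list : ∀ {S} T (es : List (Fin m)) → S ⊆ T → DualSystem G S → Extension S T (_∈ˡ es)
      extend-list {S} T []       S⊆T sys = S , id , S⊆T , sys , λ _ ()
      extend-list {S} T (e ∷ es) S⊆T sys with e ∈? T | extend-by-one sys e
      ... | no e∉T | _ =
        let S′ , S⊆S′ , S′⊆T , sys′ , sp = extend-list T es S⊆T sys in
        S′ , S⊆S′ , S′⊆T , sys′ ,
        λ { l (here ≡.refl) l∈T → contradiction l∈T e∉T ; l (there l∈) → sp l l∈ }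
      ... | yes _ | inj₁ spans =
        let S′ , S⊆S′ , S′⊆T , sys′ , sp = extend-list T es S⊆T sys in
        S′ , S⊆S′ , S′⊆T , sys′ ,
        λ { l (here ≡.refl) _ → spans-mono G S⊆S′ spans ; l (there l∈) → sp l l∈ }
      ... | yes e∈T | inj₂ sys⁺ =
        let S′ , S⁺⊆S′ , S′⊆T , sys′ , sp = extend-list T es S⁺⊆T sys⁺ in
        S′ , S⁺⊆S′ ∘ᶠ p⊆p∪q ⁅ e ⁆ , S′⊆T , sys′ ,
        λ { l (here ≡.refl) _ → ∈⇒spans G (S⁺⊆S′ (q⊆p∪q S ⁅ l ⁆ (x∈⁅x⁆ l))) ; l (there l∈) → sp l l∈ }
        where
        S⁺⊆T : S ∪ ⁅ e ⁆ ⊆ T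
        S⁺⊆T x∈ with x∈p∪q⁻ S ⁅ e ⁆ x∈
        ... | inj₁ x∈S = S⊆T x∈S
        ... | inj₂ x∈e with ≡.refl ← x∈⁅y⁆⇒x≡y e x∈e = e∈T

    extend : ∀ {S} T → S ⊆ T → DualSystem G S →
             ∃[ S′ ] (S ⊆ S′ × S′ ⊆ T × DualSystem G S′ × (∀ e → e ∈ T → Spans G S′ e))
    extend T S⊆T sys =
      let S′ , S⊆S′ , S′⊆T , sys′ , sp = extend-list T (allFin m) S⊆T sys in
      S′ , S⊆S′ , S′⊆T , sys′ , λ e → sp e (∈-allFin e)

    maximal-dualSystem : ∀ T → ∃[ S ] (S ⊆ T × DualSystem G S × (∀ e → e ∈ T → Spans G S e))
    maximal-dualSystem T =
      let S , _ , rest = extend {∅} T (λ x∈∅ → contradiction x∈∅ ∉⊥) (λ _ j∈∅ → contradiction j∈∅ ∉⊥)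
      in S , rest

    -- A maximal certified subset `S` of `I` spans `I`. An element of `I` outside `S` would give a
    -- relation inside `I` with coefficient 1 at that element, so `S` is all of `I`.
    independent⇒dualSystem : ∀ {I} → Independent G I → DualSystem G I
    independent⇒dualSystem {I} ind with maximal-dualSystem I
    ... | S , S⊆I , sys , spans = dualSystem-mono G I⊆S sys
      where
      I⊆S : I ⊆ S
      I⊆S {e} e∈I with e ∈? S
      ... | yes e∈S = e∈S
      ... | no e∉S with spans e e∈I
      ... | c , supp , e≈c = contradiction (trans (sym (ind d d-supp (λ i → trans (reflexive (≡.trans (≡.sym (∑≡sumFin _)) (≡.sym (comb≡∑ G d i)))) (d≈0 i)) e)) d-e) 0≉1
        where
        d : Fin m → Carrier
        d l = δ e l + - c l
        d-supp : Supported I d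
        d-supp l l∉I = trans (+-cong (δ-≢ λ { ≡.refl → l∉I e∈I }) (-‿cong (supp l (l∉I ∘ᶠ S⊆I))))
                             (-‿inverseʳ 0#)
        d≈0 : ∀ i → comb G d i ≈ 0#
        d≈0 i = begin
          comb G d i                     ≈⟨ comb-+ G (δ e) _ i ⟩
          comb G (δ e) i + comb G (λ l → - c l) i ≈⟨ +-cong (sym (comb-δ G e i)) (comb-neg G c i) ⟩
          G i e + - comb G c i           ≈⟨ +-congˡ (-‿cong (e≈c i)) ⟨
          G i e + - G i e                ≈⟨ -‿inverseʳ _ ⟩
          0#                             ∎
        d-e : d e ≈ 1#
        d-e = trans (+-cong (δ-≡ e) (trans (-‿cong (supp e e∉S)) -0#≈0#)) (+-identityʳ 1#)

    -- The set `I₀` attaining the rank of `B` is extended over the whole ground set. The part of the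
    -- result inside `B` is independent, so it cannot exceed `rk B`, and it contains `I₀`, so it
    -- cannot fall short.
    rankBasis : ∀ {rk} → RingOps.IsRankFunction R G rk → ∀ B → RankBasis G rk B
    rankBasis {rk} isRank B with isRank B
    ... | (I₀ , I₀⊆B , ind₀ , ∣I₀∣≡rk) , max
      with independent⇒dualSystem ind₀
    ... | sys₀ with extend {I₀} ⊤ (λ _ → ∈⊤) sys₀
    ... | I , I₀⊆I , _ , sys , spans = record
      { basis = I ; card = ℕP.≤-antisym card≤ card≥ ; system = sys ; spans = λ e → spans e ∈⊤
      ; core = I₀ ; core⊆B = I₀⊆B ; core⊆basis = I₀⊆I ; core-spans = core-spans }
      where
      card≤ : ∣ I ∩ B ∣ ≤ rk B
      card≤ = max (I ∩ B) (p∩q⊆q I B)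
        (dualSystem⇒independent G (dualSystem-mono G (p∩q⊆p I B) sys))
      card≥ : rk B ≤ ∣ I ∩ B ∣
      card≥ = ℕP.≤-trans (ℕP.≤-reflexive (≡.sym ∣I₀∣≡rk))
        (p⊆q⇒∣p∣≤∣q∣ (λ x∈ → x∈p∩q⁺ (I₀⊆I x∈ , I₀⊆B x∈)))
      -- If `e` could be added to `I₀`, a larger independent set inside `B` would contradict the
      -- maximality in the definition of rank.
      core-spans : ∀ e → e ∈ B → Spans G I₀ e
      core-spans e e∈B with e ∈? I₀
      ... | yes e∈I₀ = ∈⇒spans G e∈I₀
      ... | no e∉I₀ with extend-by-one sys₀ e
      ... | inj₁ sp   = sp
      ... | inj₂ sys⁺ = contradiction
        (ℕP.<-≤-trans
          (p⊂q⇒∣p∣<∣q∣ (p⊆p∪q ⁅ e ⁆ , e , q⊆p∪q I₀ ⁅ e ⁆ (x∈⁅x⁆ e) , e∉I₀))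
          (max (I₀ ∪ ⁅ e ⁆) ⁺⊆B (dualSystem⇒independent G sys⁺)))
        (ℕP.<-irrefl ∣I₀∣≡rk)
        where
        ⁺⊆B : I₀ ∪ ⁅ e ⁆ ⊆ B
        ⁺⊆B x∈ with x∈p∪q⁻ I₀ ⁅ e ⁆ x∈
        ... | inj₁ x∈I₀ = I₀⊆B x∈I₀
        ... | inj₂ x∈e with ≡.refl ← x∈⁅y⁆⇒x≡y e x∈e = e∈B

-- Transfer of spans and dual systems along a ring monomorphism

module Transfer (R : CommutativeRing a ℓ) (R′ : CommutativeRing a′ ℓ′)
  (φ : CommutativeRing.Carrier R → CommutativeRing.Carrier R′)
  (φ-mono : IsRingMonomorphism (CommutativeRing.rawRing R) (CommutativeRing.rawRing R′) φ) where

  private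
    module R  = CommutativeRing R
    module R′ = CommutativeRing R′
    module D  = DualSystems R
    module D′ = DualSystems R′
  open IsRingMonomorphism φ-mono
  open SetoidReasoning R′.setoid

  φ-∑ : (f : Fin n → R.Carrier) → φ (D.∑ f) R′.≈ D′.∑ (φ ∘ᶠ f)
  φ-∑ = ∑-homo R.+-commutativeMonoid R′.+-commutativeMonoid φ 0#-homo +-homo

  φ-δ : (j e : Fin m) → φ (D.δ j e) R′.≈ D′.δ j e
  φ-δ j e with j ≟ e
  ... | yes ≡.refl = R′.trans (⟦⟧-cong (D.δ-≡ j)) (R′.trans 1#-homo (R′.sym (D′.δ-≡ j)))
  ... | no j≢e   = R′.trans (⟦⟧-cong (D.δ-≢ j≢e)) (R′.trans 0#-homo (R′.sym (D′.δ-≢ j≢e)))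

  φ-mat : Matrix R.Carrier n m → Matrix R′.Carrier n m
  φ-mat G i e = φ (G i e)

  module _ (G : Matrix R.Carrier n m) where

    φ-dot : ∀ y e → φ (D.dot G y e) R′.≈ D′.dot (φ-mat G) (φ ∘ᶠ y) e
    φ-dot y e = begin
      φ (D.dot G y e)                          ≡⟨ ≡.cong φ (D.dot≡∑ G y e) ⟩
      φ (D.∑ (λ i → y i R.* G i e))            ≈⟨ φ-∑ _ ⟩
      D′.∑ (λ i → φ (y i R.* G i e))           ≈⟨ D′.∑-cong (λ i → *-homo _ _) ⟩
      D′.∑ (λ i → φ (y i) R′.* φ (G i e))      ≡⟨ D′.dot≡∑ (φ-mat G) (φ ∘ᶠ y) e ⟨
      D′.dot (φ-mat G) (φ ∘ᶠ y) e               ∎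

    φ-comb : ∀ c i → φ (D.comb G c i) R′.≈ D′.comb (φ-mat G) (φ ∘ᶠ c) i
    φ-comb c i = begin
      φ (D.comb G c i)                         ≡⟨ ≡.cong φ (D.comb≡∑ G c i) ⟩
      φ (D.∑ (λ e → c e R.* G i e))            ≈⟨ φ-∑ _ ⟩
      D′.∑ (λ e → φ (c e R.* G i e))           ≈⟨ D′.∑-cong (λ e → *-homo _ _) ⟩
      D′.∑ (λ e → φ (c e) R′.* φ (G i e))      ≡⟨ D′.comb≡∑ (φ-mat G) (φ ∘ᶠ c) i ⟨
      D′.comb (φ-mat G) (φ ∘ᶠ c) i              ∎

    φ-isDual : ∀ {S j y} → D.IsDual G S j y → D′.IsDual (φ-mat G) S j (φ ∘ᶠ y)
    φ-isDual {S} {j} {y} dual e e∈S =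
      R′.trans (R′.sym (φ-dot y e)) (R′.trans (⟦⟧-cong (dual e e∈S)) (φ-δ j e))

    -- The coefficients over the larger ring are unique, hence are the images of products formed in
    -- the smaller ring; injectivity pulls the equation back. No denominators can occur.
    spans-coefficients : ∀ {S e} (sys : D.DualSystem G S) → D′.Spans (φ-mat G) S e →
      ∀ i → G i e R.≈ D.comb G (D.mask S (λ j → D.dot G (D.vectors G sys j) e)) i
    spans-coefficients {S} {e} sys sp@(c , supp , e≈c) i = injective (begin
      φ (G i e)                    ≈⟨ e≈c i ⟩
      D′.comb (φ-mat G) c i        ≈⟨ D′.comb-cong (φ-mat G) coefficient i ⟨
      D′.comb (φ-mat G) (φ ∘ᶠ d) i  ≈⟨ φ-comb d i ⟨
      φ (D.comb G d i)             ∎)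
      where
      d : Fin _ → R.Carrier
      d = D.mask S (λ j → D.dot G (D.vectors G sys j) e)
      coefficient : ∀ l → φ (d l) R′.≈ c l
      coefficient l with l ∈? S
      ... | no l∉S  = R′.trans (⟦⟧-cong (D.mask-∉ S l l∉S)) (R′.trans 0#-homo (R′.sym (supp l l∉S)))
      ... | yes l∈S = begin
        φ (d l)                                           ≈⟨ ⟦⟧-cong (D.mask-∈ S l∈S) ⟩
        φ (D.dot G (D.vectors G sys l) e)                 ≈⟨ φ-dot _ e ⟩
        D′.dot (φ-mat G) (φ ∘ᶠ D.vectors G sys l) e        ≈⟨ D′.dot-spanned (φ-mat G) (φ-isDual (D.vectors-dual G sys l∈S)) sp ⟩
        c l                                               ∎

    reflect-spans : ∀ {S e} → D.DualSystem G S → D′.Spans (φ-mat G) S e → D.Spans G S e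
    reflect-spans {S} sys sp = _ , D.mask-∉ S , spans-coefficients sys sp

    flowBasis : ∀ {rk B} (rb : D′.RankBasis (φ-mat G) rk B) →
                D.DualSystem G (D′.RankBasis.basis rb) → D.FlowBasis G rk B
    flowBasis {rk} {B} rb sys = record
      { basis = basis ; card = card ; Y = Y ; dual = λ j → D.vectors-dual G sys
      ; spanning = λ i e → spans-coefficients sys (spans e) i
      ; vanish = vanish }
      where
      open D′.RankBasis rb
      Y : Fin _ → Fin _ → R.Carrier
      Y = D.vectors G sys
      -- Column `e` is a combination of columns of `core`, and the product with `Y j` reads off its
      -- coefficient at `j`. As `core` lies in `B` and `j` does not, that coefficient is zero.
      vanish : ∀ j → j ∈ basis → j ∉ B → ∀ e → e ∈ B → D.dot G (Y j) e R.≈ R.0#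
      vanish j j∈I j∉B e e∈B = let sp@(c , supp , _) = core-spans e e∈B in injective (begin
        φ (D.dot G (Y j) e)                  ≈⟨ φ-dot (Y j) e ⟩
        D′.dot (φ-mat G) (φ ∘ᶠ Y j) e         ≈⟨ D′.dot-spanned (φ-mat G) (D′.dot-mono (φ-mat G) core⊆basis (φ-isDual (D.vectors-dual G sys j∈I))) sp ⟩
        c j                                  ≈⟨ supp j (j∉B ∘ᶠ core⊆B) ⟩
        R′.0#                                ≈⟨ 0#-homo ⟨
        φ R.0#                               ∎)

-- The integers inside the rationals, and rounding down

opaque
  embed : ℤ → ℚ
  embed z = z ℚ./ 1

  toℚᵘ-embed : ∀ z → ℚ.toℚᵘ (embed z) ℚᵘ.≃ mkℚᵘ z 0
  toℚᵘ-embed z = ℚP.toℚᵘ-fromℚᵘ (mkℚᵘ z 0)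

  embed-0 : embed (+ 0) ≡ 0ℚ
  embed-0 = ≡.refl

  embed-1 : embed (+ 1) ≡ 1ℚ
  embed-1 = ≡.refl

  embed-+ : ∀ x y → embed (x ℤ.+ y) ≡ embed x ℚ.+ embed y
  embed-+ x y = ℚP.toℚᵘ-injective (begin
    ℚ.toℚᵘ (embed (x ℤ.+ y))                     ≈⟨ toℚᵘ-embed _ ⟩
    mkℚᵘ (x ℤ.+ y) 0                             ≈⟨ *≡* (≡.cong (ℤ._* + 1) (≡.sym (≡.cong₂ ℤ._+_ (ℤP.*-identityʳ x) (ℤP.*-identityʳ y)))) ⟩
    mkℚᵘ x 0 ℚᵘ.+ mkℚᵘ y 0                       ≈⟨ ℚᵘP.+-cong (toℚᵘ-embed x) (toℚᵘ-embed y) ⟨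
    ℚ.toℚᵘ (embed x) ℚᵘ.+ ℚ.toℚᵘ (embed y)       ≈⟨ ℚP.toℚᵘ-homo-+ (embed x) (embed y) ⟨
    ℚ.toℚᵘ (embed x ℚ.+ embed y)                 ∎)
    where open SetoidReasoning ℚᵘP.≃-setoid

  embed-* : ∀ x y → embed (x ℤ.* y) ≡ embed x ℚ.* embed y
  embed-* x y = ℚP.toℚᵘ-injective (begin
    ℚ.toℚᵘ (embed (x ℤ.* y))                     ≈⟨ toℚᵘ-embed _ ⟩
    mkℚᵘ x 0 ℚᵘ.* mkℚᵘ y 0                       ≈⟨ ℚᵘP.*-cong (toℚᵘ-embed x) (toℚᵘ-embed y) ⟨
    ℚ.toℚᵘ (embed x) ℚᵘ.* ℚ.toℚᵘ (embed y)       ≈⟨ ℚP.toℚᵘ-homo-* (embed x) (embed y) ⟨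
    ℚ.toℚᵘ (embed x ℚ.* embed y)                 ∎)
    where open SetoidReasoning ℚᵘP.≃-setoid

  embed-neg : ∀ x → embed (ℤ.- x) ≡ ℚ.- embed x
  embed-neg x = ℚP.toℚᵘ-injective (begin
    ℚ.toℚᵘ (embed (ℤ.- x))      ≈⟨ toℚᵘ-embed _ ⟩
    ℚᵘ.- mkℚᵘ x 0               ≈⟨ ℚᵘP.-‿cong (toℚᵘ-embed x) ⟨
    ℚᵘ.- ℚ.toℚᵘ (embed x)       ≈⟨ ℚP.toℚᵘ-homo‿- (embed x) ⟨
    ℚ.toℚᵘ (ℚ.- embed x)        ∎)
    where open SetoidReasoning ℚᵘP.≃-setoid

  embed-injective : Injective _≡_ _≡_ embed
  embed-injective {x} {y} eq with
    ℚᵘP.≃-trans (ℚᵘP.≃-sym (toℚᵘ-embed x)) (ℚᵘP.≃-trans (ℚP.toℚᵘ-cong eq) (toℚᵘ-embed y))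
  ... | *≡* x*1≡y*1 = ℤP.*-cancelʳ-≡ x y (+ 1) x*1≡y*1

  embed-mono : IsRingMonomorphism ℤ.+-*-rawRing ℚ.+-*-rawRing embed
  embed-mono = record
    { isRingHomomorphism = record
      { isSemiringHomomorphism = record
        { isNearSemiringHomomorphism = record
          { +-isMonoidHomomorphism = record
            { isMagmaHomomorphism = record
              { isRelHomomorphism = record { cong = ≡.cong embed } ; homo = embed-+ }
            ; ε-homo = ≡.refl }
          ; *-homo = embed-* }
        ; 1#-homo = ≡.refl }
      ; -‿homo = embed-neg }
    ; injective = embed-injective }

  embed-<-reflect : ∀ {x y} → embed x ℚ.< embed y → x ℤ.< y
  embed-<-reflect {x} {y} x<y with
    ℚᵘP.<-respˡ-≃ (toℚᵘ-embed x) (ℚᵘP.<-respʳ-≃ (toℚᵘ-embed y) (ℚP.toℚᵘ-mono-< x<y))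
  ... | ℚᵘ.*<* x*1<y*1 = ≡.subst₂ ℤ._<_ (ℤP.*-identityʳ x) (ℤP.*-identityʳ y) x*1<y*1

  floor-lower : ∀ p → embed (ℚ.floor p) ℚ.≤ p
  floor-lower p@record{} = ℚP.toℚᵘ-cancel-≤
    (ℚᵘP.≤-respˡ-≃ (ℚᵘP.≃-sym (toℚᵘ-embed (ℚ.floor p)))
      (ℚᵘ.*≤* (≡.subst (ℚ.floor p ℤ.* ℚ.↧ p ℤ.≤_) (≡.sym (ℤP.*-identityʳ (ℚ.↥ p)))
        (ℤD.[n/d]*d≤n (ℚ.↥ p) (ℚ.↧ p)))))

  floor-upper : ∀ p → p ℚ.< embed (ℤ.suc (ℚ.floor p))
  floor-upper p@record{} = ℚP.toℚᵘ-cancel-<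
    (ℚᵘP.<-respʳ-≃ (ℚᵘP.≃-sym (toℚᵘ-embed (ℤ.suc (ℚ.floor p))))
      (ℚᵘ.*<* (≡.subst₂ ℤ._<_ (≡.sym (ℤP.*-identityʳ (ℚ.↥ p)))
        (≡.cong (λ z → ℤ.suc z ℤ.* ℚ.↧ p) (≡.sym (ℤD.div-pos-is-/ℕ (ℚ.↥ p) _)))
        (ℤD.n<s[n/ℕd]*d (ℚ.↥ p) _))))

  floor-unique : ∀ {p x y} → embed x ℚ.≤ p → p ℚ.< embed (ℤ.suc x) →
                 embed y ℚ.≤ p → p ℚ.< embed (ℤ.suc y) → x ≡ y
  floor-unique x≤p p<x y≤p p<y = ℤP.≤-antisym (le x≤p p<y) (le y≤p p<x)
    where
    le : ∀ {p x y} → embed x ℚ.≤ p → p ℚ.< embed (ℤ.suc y) → x ℤ.≤ y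
    le {x = x} {y} x≤p p<y =
      ≡.subst₂ ℤ._≤_ (ℤP.pred-suc x) (ℤP.pred-suc y)
        (ℤP.pred-mono (ℤP.i<j⇒suc[i]≤j (embed-<-reflect {x} {ℤ.suc y} (ℚP.≤-<-trans x≤p p<y))))

  -- The right-hand side satisfies the two inequalities that characterise the floor of `p`. This is
  -- the only property of rounding that potentials require.
  floor-shift : ∀ {p q} z → p ≡ q ℚ.+ embed z → ℚ.floor p ≡ ℚ.floor q ℤ.+ z
  floor-shift {p} {q} z ≡.refl = floor-unique (floor-lower p) (floor-upper p)
    (≡.subst (ℚ._≤ p) (≡.sym (embed-+ (ℚ.floor q) z)) (ℚP.+-monoˡ-≤ (embed z) (floor-lower q)))
    (≡.subst (p ℚ.<_) (≡.trans (≡.sym (embed-+ (ℤ.suc (ℚ.floor q)) z)) (≡.cong embed (ℤP.+-assoc (+ 1) (ℚ.floor q) z)))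
      (ℚP.+-monoˡ-< (embed z) (floor-upper q)))

-- Integral dual systems and vertex-edge matrices

module Z = DualSystems ℤP.+-*-commutativeRing
module Q = DualSystems ℚP.+-*-commutativeRing

opaque
  ℚ-inverse : ∀ x → x ≢ 0ℚ → ∃[ y ] (x ℚ.* y ≡ 1ℚ)
  ℚ-inverse x x≢0 = ℚ.1/_ x {{ℚ.≢-nonZero x≢0}} , ℚP.*-inverseʳ x {{ℚ.≢-nonZero x≢0}}

ℚ-field : Field 0ℓ 0ℓ
ℚ-field = record { commRing = ℚP.+-*-commutativeRing ; 0≉1 = λ () ; inverse = ℚ-inverse }

module QF = FieldLinearAlgebra ℚ-field ℚ._≟_

open Transfer ℤP.+-*-commutativeRing ℚP.+-*-commutativeRing embed embed-mono
  public renaming (φ-∑ to embed-∑; φ-δ to embed-δ; φ-mat to embed-mat; φ-dot to embed-dot; φ-comb to embed-comb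
           ; φ-isDual to embed-isDual)

-- Rationally independent columns must admit an integral left inverse; equivalently, the maximal
-- minors on each independent set of columns have greatest common divisor 1.
Unimodular : Matrix ℤ n m → Set
Unimodular G = ∀ {I} → Q.DualSystem (embed-mat G) I → Z.DualSystem G I

module _ (R : CommutativeRing a ℓ) where
  open CommutativeRing R
  open DualSystems R
  open RingProps ring

  -- For an incidence matrix, row combinations are tensions: `y` is a potential on the vertices, and
  -- each edge sees the difference at its ends. A loop sees zero because its two terms cancel.
  dot-difference : (M : Matrix Carrier n m) {e : Fin m} {t h : Fin n} →
    (∀ x → M x e ≈ δ t x + - δ h x) → ∀ y → dot M y e ≈ y t + - y h
  dot-difference M {e} {t} {h} M≈ y = trans (trans (reflexive (dot≡∑ M y e))
    (∑-cong (λ x → trans (*-congˡ (M≈ x)) (trans (distribˡ _ _ _) (+-congˡ (sym (-‿distribʳ-* _ _)))))))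
    (trans (∑-∙ _ _) (+-cong (∑-δ t y) (trans (sym (∑-neg _)) (-‿cong (∑-δ h y)))))

incidence-δ : ∀ (tail head : Fin m → Fin n) x e →
              incidence tail head x e ≡ Z.δ (tail e) x ℤ.+ ℤ.- Z.δ (head e) x
incidence-δ tail head x e with x ≟ tail e | x ≟ head e
... | yes ≡.refl | yes eq = ≡.sym (≡.trans (≡.cong₂ (λ u v → u ℤ.+ ℤ.- v) (Z.δ-≡ x) (≡.trans (≡.cong (λ h → Z.δ h x) (≡.sym eq)) (Z.δ-≡ x))) ≡.refl)
... | yes ≡.refl | no x≢h = ≡.sym (≡.cong₂ (λ u v → u ℤ.+ ℤ.- v) (Z.δ-≡ x) (Z.δ-≢ (x≢h ∘ᶠ ≡.sym)))
... | no x≢t | yes ≡.refl = ≡.sym (≡.cong₂ (λ u v → u ℤ.+ ℤ.- v) (Z.δ-≢ (x≢t ∘ᶠ ≡.sym)) (Z.δ-≡ x))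
... | no x≢t | no x≢h   = ≡.sym (≡.cong₂ (λ u v → u ℤ.+ ℤ.- v) (Z.δ-≢ (x≢t ∘ᶠ ≡.sym)) (Z.δ-≢ (x≢h ∘ᶠ ≡.sym)))

-- Rounding a rational potential down keeps all its integral tensions.
module _ (D : Matrix ℤ n m) (isVE : IsVertexEdgeMatrix D) where
  private
    tail = proj₁ isVE
    head = proj₁ (proj₂ isVE)

    D-δ : ∀ e x → D x e ≡ Z.δ (tail e) x ℤ.+ ℤ.- Z.δ (head e) x
    D-δ e x = ≡.trans (proj₂ (proj₂ isVE) x e) (incidence-δ tail head x e)

    ℚ-tension : ∀ z e → Q.dot (embed-mat D) z e ≡ z (tail e) ℚ.+ ℚ.- z (head e)
    ℚ-tension z e = dot-difference ℚP.+-*-commutativeRing (embed-mat D) (λ x →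
      ≡.trans (≡.cong embed (D-δ e x)) (≡.trans (embed-+ _ (ℤ.- Z.δ (head e) x))
        (≡.cong₂ ℚ._+_ (embed-δ _ _) (≡.trans (embed-neg (Z.δ (head e) x)) (≡.cong ℚ.-_ (embed-δ _ _)))))) z

  round-potential : ∀ z e k → Q.dot (embed-mat D) z e ≡ embed k → Z.dot D (ℚ.floor ∘ᶠ z) e ≡ k
  round-potential z e k z·e≡k = begin
    Z.dot D (ℚ.floor ∘ᶠ z) e                                     ≡⟨ dot-difference ℤP.+-*-commutativeRing D (D-δ e) (ℚ.floor ∘ᶠ z) ⟩
    ℚ.floor (z (tail e)) ℤ.+ ℤ.- ℚ.floor (z (head e))           ≡⟨ ≡.cong (ℤ._+ ℤ.- ℚ.floor (z (head e))) (floor-shift {z (tail e)} {z (head e)} k tail≡head+k) ⟩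
    ℚ.floor (z (head e)) ℤ.+ k ℤ.+ ℤ.- ℚ.floor (z (head e))     ≡⟨ xyx⁻¹≈y (ℚ.floor (z (head e))) k ⟩
    k                                                           ∎
    where
    open ≡.≡-Reasoning
    open AbelianGroupProps ℤP.+-0-abelianGroup using (xyx⁻¹≈y)
    open AbelianGroupProps ℚP.+-0-abelianGroup using () renaming (xyx⁻¹≈y to ℚ-xyx⁻¹≈y)
    tail≡head+k : z (tail e) ≡ z (head e) ℚ.+ embed k
    tail≡head+k = begin
      z (tail e)                                          ≡⟨ ℚ-xyx⁻¹≈y (z (head e)) (z (tail e)) ⟨
      z (head e) ℚ.+ z (tail e) ℚ.+ ℚ.- z (head e)        ≡⟨ ℚP.+-assoc (z (head e)) _ _ ⟩
      z (head e) ℚ.+ (z (tail e) ℚ.+ ℚ.- z (head e))      ≡⟨ ≡.cong (z (head e) ℚ.+_) (ℚ-tension z e) ⟨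
      z (head e) ℚ.+ Q.dot (embed-mat D) z e              ≡⟨ ≡.cong (z (head e) ℚ.+_) z·e≡k ⟩
      z (head e) ℚ.+ embed k                              ∎

  -- On `I` the tensions of a rational dual vector are 0 or 1, so they survive rounding. Duality
  -- asks for nothing outside `I`, where tensions may change.
  vertexEdge-unimodular : Unimodular D
  vertexEdge-unimodular sys j j∈I = let y , dual = sys j j∈I in
    ℚ.floor ∘ᶠ y , λ e e∈I → round-potential y e (Z.δ j e) (≡.trans (dual e e∈I) (≡.sym (embed-δ j e)))

-- Signed cycles and cycle-edge matrices

private
  ℤ-unit : ∀ x y → x ℤ.* y ≡ + 1 → x ≡ + 1 ⊎ x ≡ ℤ.- (+ 1)
  ℤ-unit x y xy≡1 with ℕP.m*n≡1⇒m≡1 ℤ.∣ x ∣ ℤ.∣ y ∣ (≡.trans (≡.sym (ℤP.abs-* x y)) (≡.cong ℤ.∣_∣ xy≡1))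
  ... | ∣x∣≡1 with x
  ... | + k          = inj₁ (≡.cong +_ ∣x∣≡1)
  ... | ℤ.-[1+ k ]   = inj₂ (≡.cong (λ z → ℤ.- (+ z)) ∣x∣≡1)

  Unit : ℤ → Set
  Unit x = x ≡ + 0 ⊎ x ≡ + 1 ⊎ x ≡ ℤ.- (+ 1)

  neg-unit : ∀ {x} → Unit x → Unit (ℤ.- x)
  neg-unit (inj₁ ≡.refl)        = inj₁ ≡.refl
  neg-unit (inj₂ (inj₁ ≡.refl)) = inj₂ (inj₂ ≡.refl)
  neg-unit (inj₂ (inj₂ ≡.refl)) = inj₂ (inj₁ ≡.refl)

module _ {P : Fin m → Set} (P? : Decidable₁ P) where

  comprehension : Subset m
  comprehension = tabulate (λ e → does (P? e))

  comprehension⁺ : ∀ {e} → P e → e ∈ comprehension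
  comprehension⁺ {e} p = lookup⇒[]= e _ (≡.trans (lookup∘tabulate _ e) (dec-true (P? e) p))

  comprehension⁻ : ∀ {e} → e ∈ comprehension → P e
  comprehension⁻ {e} e∈ with P? e in eq
  ... | yes p = p
  ... | no _  = contradiction
    (≡.trans (≡.sym ([]=⇒lookup e∈)) (≡.trans (lookup∘tabulate _ e) (≡.cong does eq))) λ ()

comb≡kernel : ∀ (D : Matrix ℤ n m) c x → Z.comb D c x ≡ sumFin (+ 0) ℤ._+_ (λ e → D x e ℤ.* c e)
comb≡kernel D c x = ≡.trans (≡.trans (Z.comb≡∑ D c x) (Z.∑-cong (λ e → ℤP.*-comm (c e) (D x e)))) (Z.∑≡sumFin _)

-- The circuit consisting of j and the edges t of the forest T with b t ≢ 0.
module FundamentalCircuit (D : Matrix ℤ n m) (isVE : IsVertexEdgeMatrix D)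
  {T : Subset m} (sys : Z.DualSystem D T) {j : Fin m} (j∉T : j ∉ T)
  (b : Fin m → ℤ) (b-supp : Z.Supported T b) (j≡b : ∀ i → D i j ≡ Z.comb D b i) where

  -- Dividing the dual vector of t by b t exchanges t for j, and rounding shows that 1 / b t is integral.
  b-unit : ∀ t → Unit (b t)
  b-unit t with t ∈? T | b t ℤ.≟ + 0
  ... | no t∉T  | _        = inj₁ (b-supp t t∉T)
  ... | yes _   | yes bt≡0 = inj₁ bt≡0
  ... | yes t∈T | no bt≢0  = inj₂ (ℤ-unit (b t) (Z.dot D z′ t) bt*z′t≡1)
    where
    open ≡.≡-Reasoning
    y = proj₁ (sys t t∈T)
    dual : Z.IsDual D T t y
    dual = proj₂ (sys t t∈T)
    inv = ℚ-inverse (embed (b t)) (λ eq → bt≢0 (embed-injective (≡.trans eq (≡.sym embed-0))))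
    z : Fin n → ℚ
    z i = proj₁ inv ℚ.* embed (y i)
    z-dot : ∀ e → Q.dot (embed-mat D) z e ≡ proj₁ inv ℚ.* embed (Z.dot D y e)
    z-dot e = ≡.trans (Q.dot-* (embed-mat D) (proj₁ inv) (embed ∘ᶠ y) e)
                    (≡.cong (proj₁ inv ℚ.*_) (≡.sym (embed-dot D y e)))
    z′ : Fin n → ℤ
    z′ = ℚ.floor ∘ᶠ z
    z′-j : Z.dot D z′ j ≡ + 1
    z′-j = round-potential D isVE z j (+ 1) (begin
      Q.dot (embed-mat D) z j                  ≡⟨ z-dot j ⟩
      proj₁ inv ℚ.* embed (Z.dot D y j)        ≡⟨ ≡.cong (λ k → proj₁ inv ℚ.* embed k) (Z.dot-spanned D dual (b , b-supp , j≡b)) ⟩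
      proj₁ inv ℚ.* embed (b t)                ≡⟨ ℚP.*-comm (proj₁ inv) (embed (b t)) ⟩
      embed (b t) ℚ.* proj₁ inv                ≡⟨ proj₂ inv ⟩
      1ℚ                                       ≡⟨ embed-1 ⟨
      embed (+ 1)                              ∎)
    z′-T : ∀ e → e ∈ T → e ≢ t → Z.dot D z′ e ≡ + 0
    z′-T e e∈T e≢t = round-potential D isVE z e (+ 0) (begin
      Q.dot (embed-mat D) z e                  ≡⟨ z-dot e ⟩
      proj₁ inv ℚ.* embed (Z.dot D y e)        ≡⟨ ≡.cong (λ k → proj₁ inv ℚ.* embed k) (≡.trans (dual e e∈T) (Z.δ-≢ (e≢t ∘ᶠ ≡.sym))) ⟩
      proj₁ inv ℚ.* embed (+ 0)                ≡⟨ ≡.cong (proj₁ inv ℚ.*_) embed-0 ⟩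
      proj₁ inv ℚ.* 0ℚ                         ≡⟨ ℚP.*-zeroʳ (proj₁ inv) ⟩
      0ℚ                                       ≡⟨ embed-0 ⟨
      embed (+ 0)                              ∎)
    others : ∀ e → e ≢ t → b e ℤ.* Z.dot D z′ e ≡ + 0
    others e e≢t with e ∈? T
    ... | yes e∈T = ≡.trans (≡.cong (b e ℤ.*_) (z′-T e e∈T e≢t)) (ℤP.*-zeroʳ (b e))
    ... | no e∉T  = ≡.cong (ℤ._* Z.dot D z′ e) (b-supp e e∉T)
    bt*z′t≡1 : b t ℤ.* Z.dot D z′ t ≡ + 1
    bt*z′t≡1 = begin
      b t ℤ.* Z.dot D z′ t                     ≡⟨ Z.∑-single t others ⟨
      Z.∑ (λ e → b e ℤ.* Z.dot D z′ e)         ≡⟨ Z.∑-comb D z′ b ⟨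
      Z.∑ (λ i → z′ i ℤ.* Z.comb D b i)        ≡⟨ Z.∑-cong (λ i → ≡.cong (z′ i ℤ.*_) (j≡b i)) ⟨
      Z.∑ (λ i → z′ i ℤ.* D i j)               ≡⟨ Z.dot≡∑ D z′ j ⟨
      Z.dot D z′ j                             ≡⟨ z′-j ⟩
      + 1                                      ∎

  w : Fin m → ℤ
  w e = Z.δ j e ℤ.+ ℤ.- b e

  w-j : w j ≡ + 1
  w-j = ≡.cong₂ (λ p q → p ℤ.+ ℤ.- q) (Z.δ-≡ j) (b-supp j j∉T)

  w-off : ∀ e → e ≢ j → w e ≡ ℤ.- b e
  w-off e e≢j = ≡.trans (≡.cong (ℤ._+ _) (Z.δ-≢ (e≢j ∘ᶠ ≡.sym))) (ℤP.+-identityˡ _)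

  w-out : ∀ e → e ≢ j → e ∉ T → w e ≡ + 0
  w-out e e≢j e∉T = ≡.trans (w-off e e≢j) (≡.cong ℤ.-_ (b-supp e e∉T))

  w-unit : ∀ e → Unit (w e)
  w-unit e with e ≟ j
  ... | yes ≡.refl = inj₂ (inj₁ w-j)
  ... | no e≢j   = ≡.subst Unit (≡.sym (w-off e e≢j)) (neg-unit (b-unit e))

  w-comb : ∀ x → Z.comb D w x ≡ + 0
  w-comb x = begin
    Z.comb D w x                                               ≡⟨ Z.comb-+ D (Z.δ j) _ x ⟩
    Z.comb D (Z.δ j) x ℤ.+ Z.comb D (λ e → ℤ.- b e) x          ≡⟨ ≡.cong₂ ℤ._+_ (≡.sym (Z.comb-δ D j x)) (Z.comb-neg D b x) ⟩
    D x j ℤ.+ ℤ.- Z.comb D b x                                 ≡⟨ ≡.cong (λ k → D x j ℤ.+ ℤ.- k) (j≡b x) ⟨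
    D x j ℤ.+ ℤ.- D x j                                        ≡⟨ ℤP.+-inverseʳ (D x j) ⟩
    + 0                                                        ∎
    where open ≡.≡-Reasoning

  -- The difference of `c` and `c j` times `w` is a kernel vector. Its entry at `j` cancels because
  -- `w j` is 1, so it is supported on `T`, and `T` is independent.
  multiple-of-w : ∀ c → InKernel D c → (∀ e → w e ≡ + 0 → c e ≡ + 0) → ∀ e → c e ≡ c j ℤ.* w e
  multiple-of-w c c∈ker w0⇒c0 e = ℤP.i-j≡0⇒i≡j (c e) _ (Z.dualSystem⇒independent D sys d d-supp
      (λ x → ≡.trans (≡.sym (Z.∑≡sumFin _)) (≡.trans (≡.sym (Z.comb≡∑ D d x)) (d-ker x))) e)
    where
    open ≡.≡-Reasoning
    d : Fin m → ℤ
    d e = c e ℤ.+ ℤ.- (c j ℤ.* w e)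
    d-supp : Z.Supported T d
    d-supp e e∉T with e ≟ j
    ... | yes ≡.refl = ≡.trans (≡.cong (λ k → c e ℤ.+ ℤ.- (c e ℤ.* k)) w-j)
                      (≡.trans (≡.cong (λ k → c e ℤ.+ ℤ.- k) (ℤP.*-identityʳ (c e))) (ℤP.+-inverseʳ (c e)))
    ... | no e≢j   = ≡.cong₂ (λ p q → p ℤ.+ ℤ.- q) (w0⇒c0 e we≡0)
                      (≡.trans (≡.cong (c j ℤ.*_) we≡0) (ℤP.*-zeroʳ (c j)))
      where we≡0 = w-out e e≢j e∉T
    d-ker : ∀ x → Z.comb D d x ≡ + 0
    d-ker x = begin
      Z.comb D d x                                                   ≡⟨ Z.comb-+ D c _ x ⟩
      Z.comb D c x ℤ.+ Z.comb D (λ e → ℤ.- (c j ℤ.* w e)) x          ≡⟨ ≡.cong₂ ℤ._+_ (≡.trans (comb≡kernel D c x) (c∈ker x)) (Z.comb-neg D _ x) ⟩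
      + 0 ℤ.+ ℤ.- Z.comb D (λ e → c j ℤ.* w e) x                     ≡⟨ ℤP.+-identityˡ _ ⟩
      ℤ.- Z.comb D (λ e → c j ℤ.* w e) x                             ≡⟨ ≡.cong ℤ.-_ (≡.trans (Z.comb-* D (c j) w x) (≡.trans (≡.cong (c j ℤ.*_) (w-comb x)) (ℤP.*-zeroʳ (c j)))) ⟩
      + 0                                                            ∎

  -- Since `c` is `c j` times `w` and is not zero, `c j` is nonzero; as ℤ has no zero divisors, `c`
  -- and `w` have the same zeros.
  minimal : ∀ c → InKernel D c → (∀ e → w e ≡ + 0 → c e ≡ + 0) → ∃[ e ] (c e ≢ + 0) →
            ∀ e → c e ≡ + 0 → w e ≡ + 0
  minimal c c∈ker w0⇒c0 (e₀ , ce₀≢0) e ce≡0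
    with ℤP.i*j≡0⇒i≡0∨j≡0 (c j) (≡.trans (≡.sym (multiple-of-w c c∈ker w0⇒c0 e)) ce≡0)
  ... | inj₂ we≡0 = we≡0
  ... | inj₁ cj≡0 = contradiction
    (≡.trans (multiple-of-w c c∈ker w0⇒c0 e₀) (≡.cong (ℤ._* w e₀) cj≡0)) ce₀≢0

  isCycle : IsSignedCycle D w
  isCycle = w-unit , (λ x → ≡.trans (≡.sym (comb≡kernel D w x)) (w-comb x)) ,
    (j , λ wj≡0 → contradiction (≡.trans (≡.sym w-j) wj≡0) λ ()) , minimal

module _ (D : Matrix ℤ n m) (isVE : IsVertexEdgeMatrix D) where

  -- The support of a kernel vector contains a circuit through each of its elements. To find it,
  -- take a maximal independent set `T` among the other edges of the support of `u`: the column of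
  -- `j` depends on `T`, and the circuit formed by `j` and this dependence stays inside the support.
  cycle-through : ∀ (u : Fin m → ℚ) j → (∀ x → Q.comb (embed-mat D) u x ≡ 0ℚ) → u j ≢ 0ℚ →
    ∃[ w ] (IsSignedCycle D w × w j ≡ + 1 × (∀ e → e ≢ j → u e ≡ 0ℚ → w e ≡ + 0))
  cycle-through u j u∈ker u-j≢0 with QF.maximal-dualSystem (embed-mat D) S
    where S = comprehension (λ e → ¬? (e ≟ j) ×-dec ¬? (u e ℚ.≟ 0ℚ))
  ... | T , T⊆S , sys , spans = w , isCycle , w-j , λ e e≢j ue≡0 →
    w-out e e≢j (λ e∈T → proj₂ (comprehension⁻ in-S? (T⊆S e∈T)) ue≡0)
    where
    in-S? : Decidable₁ (λ e → e ≢ j × u e ≢ 0ℚ)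
    in-S? e = ¬? (e ≟ j) ×-dec ¬? (u e ℚ.≟ 0ℚ)

    j∉T : j ∉ T
    j∉T j∈T = proj₁ (comprehension⁻ in-S? (T⊆S j∈T)) ≡.refl

    -- Otherwise `j` would have a dual vector `y` that vanishes on `T`, hence on everything spanned
    -- by `T`, hence on all other edges of the support. Pairing `y` with `u` would give `u j`, yet
    -- the pairing is zero because `u` is in the kernel.
    j-spanned : Q.Spans (embed-mat D) T j
    j-spanned with QF.extend-by-one (embed-mat D) sys j
    ... | inj₁ sp   = sp
    ... | inj₂ sys⁺ = contradiction u-j≡0 u-j≢0
      where
      y = proj₁ (sys⁺ j (q⊆p∪q T ⁅ j ⁆ (x∈⁅x⁆ j)))
      dual : Q.IsDual (embed-mat D) (T ∪ ⁅ j ⁆) j y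
      dual = proj₂ (sys⁺ j (q⊆p∪q T ⁅ j ⁆ (x∈⁅x⁆ j)))
      pointwise : ∀ e → u e ℚ.* Q.dot (embed-mat D) y e ≡ u e ℚ.* Q.δ j e
      pointwise e with e ≟ j | u e ℚ.≟ 0ℚ
      ... | yes ≡.refl | _        = ≡.cong (u e ℚ.*_) (dual e (q⊆p∪q T ⁅ j ⁆ (x∈⁅x⁆ j)))
      ... | no _     | yes ue≡0 = ≡.trans (≡.cong (ℚ._* Q.dot (embed-mat D) y e) ue≡0) (≡.trans (ℚP.*-zeroˡ (Q.dot (embed-mat D) y e))
                                    (≡.sym (≡.trans (≡.cong (ℚ._* Q.δ j e) ue≡0) (ℚP.*-zeroˡ (Q.δ j e)))))
      ... | no e≢j   | no ue≢0  = ≡.cong (u e ℚ.*_)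
        (≡.trans (Q.dot-spanned (embed-mat D) (Q.dot-mono (embed-mat D) (p⊆p∪q ⁅ j ⁆) dual) sp)
               (≡.trans (proj₁ (proj₂ sp) j j∉T) (≡.sym (Q.δ-≢ (e≢j ∘ᶠ ≡.sym)))))
        where sp = spans e (comprehension⁺ in-S? (e≢j , ue≢0))
      u-j≡0 : u j ≡ 0ℚ
      u-j≡0 = begin
        u j                                                        ≡⟨ Q.∑-δ j u ⟨
        Q.∑ (λ e → u e ℚ.* Q.δ j e)                                ≡⟨ Q.∑-cong pointwise ⟨
        Q.∑ (λ e → u e ℚ.* Q.dot (embed-mat D) y e)                ≡⟨ Q.∑-comb (embed-mat D) y u ⟨
        Q.∑ (λ x → y x ℚ.* Q.comb (embed-mat D) u x)               ≡⟨ Q.∑-ε (λ x → ≡.trans (≡.cong (y x ℚ.*_) (u∈ker x)) (ℚP.*-zeroʳ (y x))) ⟩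
        0ℚ                                                         ∎
        where open ≡.≡-Reasoning

    Zsys : Z.DualSystem D T
    Zsys = vertexEdge-unimodular D isVE sys

    -- The forest `T` has integral dual vectors by the vertex-edge case, so the rational
    -- coefficients of column `j` are integers.
    Zspan : Z.Spans D T j
    Zspan = reflect-spans D Zsys j-spanned

    open FundamentalCircuit D isVE Zsys j∉T (proj₁ Zspan) (proj₁ (proj₂ Zspan)) (proj₂ (proj₂ Zspan))

-- The row combination `u` given by a rational dual vector lies in the cycle space and agrees with
-- the unit vector of `j` on `I`. A circuit through `j` inside its support, with entry 1 at `j`,
-- still has these values on `I`, and by completeness it is a row of `G` up to sign.
cycleEdge-unimodular : (G : Matrix ℤ n m) → IsCycleEdgeMatrix G → Unimodular G
cycleEdge-unimodular {n = n} {m} G (v , tail , head , rows , complete , _) {I} sys j j∈I =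
  from-cycle (cycle-through D (tail , head , λ _ _ → ≡.refl) u j u∈ker u-j≢0)
  where
  D : Matrix ℤ v m
  D = incidence tail head

  y : Fin n → ℚ
  y = proj₁ (sys j j∈I)

  u : Fin m → ℚ
  u = Q.dot (embed-mat G) y

  u-dual : Q.IsDual (embed-mat G) I j y
  u-dual = proj₂ (sys j j∈I)

  u-j≢0 : u j ≢ 0ℚ
  u-j≢0 uj≡0 = contradiction (≡.trans (≡.sym (≡.trans (u-dual j j∈I) (Q.δ-≡ j))) uj≡0) λ ()

  row-kernel : ∀ i x → Q.comb (embed-mat D) (embed ∘ᶠ G i) x ≡ 0ℚ
  row-kernel i x = begin
    Q.comb (embed-mat D) (embed ∘ᶠ G i) x                 ≡⟨ embed-comb D (G i) x ⟨
    embed (Z.comb D (G i) x)                             ≡⟨ ≡.cong embed (comb≡kernel D (G i) x) ⟩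
    embed (sumFin (+ 0) ℤ._+_ (λ e → D x e ℤ.* G i e))   ≡⟨ ≡.cong embed (proj₁ (proj₂ (rows i)) x) ⟩
    embed (+ 0)                                          ≡⟨ embed-0 ⟩
    0ℚ                                                   ∎
    where open ≡.≡-Reasoning

  u∈ker : ∀ x → Q.comb (embed-mat D) u x ≡ 0ℚ
  u∈ker x = ≡.trans (Q.comb-dot (embed-mat D) (embed-mat G) y x)
    (Q.∑-ε (λ i → ≡.trans (≡.cong (y i ℚ.*_) (row-kernel i x)) (ℚP.*-zeroʳ (y i))))

  from-cycle : ∃[ w ] (IsSignedCycle D w × w j ≡ + 1 × (∀ e → e ≢ j → u e ≡ 0ℚ → w e ≡ + 0)) →
               ∃[ y ] Z.IsDual G I j y
  from-cycle (w , isCycle , w-j , w-zero) = from-row (complete w isCycle)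
    where
    w-dual : ∀ e → e ∈ I → w e ≡ Z.δ j e
    w-dual e e∈I with e ≟ j
    ... | yes ≡.refl = ≡.trans w-j (≡.sym (Z.δ-≡ e))
    ... | no e≢j   = ≡.trans (w-zero e e≢j (≡.trans (u-dual e e∈I) (Q.δ-≢ (e≢j ∘ᶠ ≡.sym))))
                           (≡.sym (Z.δ-≢ (e≢j ∘ᶠ ≡.sym)))
    from-row : ∃[ i ] ((∀ e → G i e ≡ w e) ⊎ (∀ e → G i e ≡ ℤ.- w e)) → ∃[ y ] Z.IsDual G I j y
    from-row (i , inj₁ Gi≡w)  = Z.δ i , λ e e∈I → ≡.trans (Z.dot-δ G i e) (≡.trans (Gi≡w e) (w-dual e e∈I))
    from-row (i , inj₂ Gi≡-w) = (λ k → ℤ.- Z.δ i k) , λ e e∈I → ≡.trans (Z.dot-neg G (Z.δ i) e)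
      (≡.trans (≡.cong ℤ.-_ (≡.trans (Z.dot-δ G i e) (Gi≡-w e)))
             (≡.trans (ℤP.neg-involutive (w e)) (w-dual e e∈I)))

distinct-lookup : ∀ {A : Set a} {_∼_ : A → A → Set ℓ} → (∀ {x y} → x ∼ y → y ∼ x) →
  {xs : List A} → AllPairs (λ x y → ¬ (x ∼ y)) xs → ∀ i j → lookup xs i ∼ lookup xs j → i ≡ j
distinct-lookup ∼-sym (x∉ ∷ _)  zero    zero    _  = ≡.refl
distinct-lookup ∼-sym (x∉ ∷ _)  zero    (suc j) eq = contradiction eq (All.lookup x∉ (∈-lookup j))
distinct-lookup ∼-sym (x∉ ∷ _)  (suc i) zero    eq = contradiction (∼-sym eq) (All.lookup x∉ (∈-lookup i))
distinct-lookup ∼-sym (_ ∷ xs!) (suc i) (suc j) eq = ≡.cong suc (distinct-lookup ∼-sym xs! i j eq)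

-- Determinants, Cramer's rule and totally unimodular matrices

module Determinants where
  open ≡.≡-Reasoning

  altSign-suc : ∀ k → altSign (suc k) ≡ ℤ.- altSign k
  altSign-suc zero          = ≡.refl
  altSign-suc (suc zero)    = ≡.refl
  altSign-suc (suc (suc k)) = altSign-suc k

  -- Opaque copy of det, so that the unifier can read off the matrix.
  opaque
    Δ : Matrix ℤ k k → ℤ
    Δ = det

    Δ≡det : (M : Matrix ℤ k k) → Δ M ≡ det M
    Δ≡det M = ≡.refl

    Δ-zero : (M : Matrix ℤ 0 0) → Δ M ≡ + 1
    Δ-zero M = ≡.refl

    det-row : (M : Matrix ℤ (suc k) (suc k)) →
      Δ M ≡ Z.∑ (λ j → altSign (toℕ j) ℤ.* (M zero j ℤ.* Δ (λ a b → M (suc a) (punchIn j b))))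
    det-row M = ≡.sym (Z.∑≡sumFin _)

  det-cong : {M N : Matrix ℤ k k} → (∀ i j → M i j ≡ N i j) → Δ M ≡ Δ N
  det-cong {zero}  {M} {N} M≗N = ≡.trans (Δ-zero M) (≡.sym (Δ-zero N))
  det-cong {suc k} {M} {N} M≗N = begin
    Δ M      ≡⟨ det-row M ⟩
    Z.∑ _      ≡⟨ Z.∑-cong (λ j → ≡.cong (altSign (toℕ j) ℤ.*_)
                    (≡.cong₂ ℤ._*_ (M≗N zero j) (det-cong (λ a b → M≗N (suc a) (punchIn j b))))) ⟩
    Z.∑ _      ≡⟨ det-row N ⟨
    Δ N      ∎

  opaque
    unfolding Sums.∑

    ∑-suc : (f : Fin (suc k) → ℤ) → Z.∑ f ≡ f zero ℤ.+ Z.∑ (f ∘ᶠ suc)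
    ∑-suc f = ≡.refl

  -- Removing row 0 and column suc l, then row a and column 0, gives the same matrix as removing
  -- column 0 and row suc a, then row 0 and column l; so the two double expansions agree termwise.
  det-column : (M : Matrix ℤ (suc k) (suc k)) →
    Δ M ≡ Z.∑ (λ a → altSign (toℕ a) ℤ.* (M a zero ℤ.* Δ (λ x y → M (punchIn a x) (suc y))))
  det-column {zero}  M = ≡.trans (det-row M) (≡.trans (∑-suc _) (≡.sym (≡.trans (∑-suc _)
    (≡.cong₂ (λ d z → altSign 0 ℤ.* (M zero zero ℤ.* d) ℤ.+ z) (≡.trans (Δ-zero _) (≡.sym (Δ-zero _))) (≡.trans (Z.∑-ε (λ ())) (≡.sym (Z.∑-ε (λ ()))))))))
  det-column {suc k} M = begin
    Δ M
      ≡⟨ ≡.trans (det-row M) (∑-suc _) ⟩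
    corner ℤ.+ Z.∑ (λ l → altSign (suc (toℕ l)) ℤ.* (M zero (suc l) ℤ.* Δ (λ a b → M (suc a) (punchIn (suc l) b))))
      ≡⟨ ≡.cong (λ z → corner ℤ.+ z) (Z.∑-cong (λ l → ≡.cong (λ d → altSign (suc (toℕ l)) ℤ.* (M zero (suc l) ℤ.* d)) (det-column _))) ⟩
    corner ℤ.+ Z.∑ (λ l → altSign (suc (toℕ l)) ℤ.* (M zero (suc l) ℤ.* Z.∑ (λ a →
        altSign (toℕ a) ℤ.* (M (suc a) zero ℤ.* inner a l))))
      ≡⟨ ≡.cong (λ z → corner ℤ.+ z) (Z.∑-cong (λ l → pull (altSign (suc (toℕ l))) (M zero (suc l)) _)) ⟩
    corner ℤ.+ Z.∑ (λ l → Z.∑ (λ a → altSign (suc (toℕ l)) ℤ.* (M zero (suc l) ℤ.*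
        (altSign (toℕ a) ℤ.* (M (suc a) zero ℤ.* inner a l)))))
      ≡⟨ ≡.cong (λ z → corner ℤ.+ z) (Z.∑-swap _) ⟩
    corner ℤ.+ Z.∑ (λ a → Z.∑ (λ l → altSign (suc (toℕ l)) ℤ.* (M zero (suc l) ℤ.*
        (altSign (toℕ a) ℤ.* (M (suc a) zero ℤ.* inner a l)))))
      ≡⟨ ≡.cong (λ z → corner ℤ.+ z) (Z.∑-cong (λ a → Z.∑-cong (λ l → exchange (toℕ l) (toℕ a) (M zero (suc l)) (M (suc a) zero) (inner a l)))) ⟩
    corner ℤ.+ Z.∑ (λ a → Z.∑ (λ l → altSign (suc (toℕ a)) ℤ.* (M (suc a) zero ℤ.*
        (altSign (toℕ l) ℤ.* (M zero (suc l) ℤ.* inner a l)))))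
      ≡⟨ ≡.cong (λ z → corner ℤ.+ z) (Z.∑-cong (λ a → pull (altSign (suc (toℕ a))) (M (suc a) zero) _)) ⟨
    corner ℤ.+ Z.∑ (λ a → altSign (suc (toℕ a)) ℤ.* (M (suc a) zero ℤ.* Z.∑ (λ l →
        altSign (toℕ l) ℤ.* (M zero (suc l) ℤ.* inner a l))))
      ≡⟨ ≡.cong (λ z → corner ℤ.+ z) (Z.∑-cong (λ a → ≡.cong (λ d → altSign (suc (toℕ a)) ℤ.* (M (suc a) zero ℤ.* d)) (det-row _))) ⟨
    corner ℤ.+ Z.∑ (λ a → altSign (suc (toℕ a)) ℤ.* (M (suc a) zero ℤ.* Δ (λ x y → M (punchIn (suc a) x) (suc y))))
      ≡⟨ ∑-suc _ ⟨
    Z.∑ (λ a → altSign (toℕ a) ℤ.* (M a zero ℤ.* Δ (λ x y → M (punchIn a x) (suc y)))) ∎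
    where
    corner : ℤ
    corner = altSign 0 ℤ.* (M zero zero ℤ.* Δ (λ a b → M (suc a) (suc b)))
    inner : Fin (suc k) → Fin (suc k) → ℤ
    inner a l = Δ (λ x y → M (suc (punchIn a x)) (suc (punchIn l y)))
    pull : ∀ {n} x y (f : Fin n → ℤ) → x ℤ.* (y ℤ.* Z.∑ f) ≡ Z.∑ (λ i → x ℤ.* (y ℤ.* f i))
    pull x y f = ≡.trans (≡.cong (x ℤ.*_) (Z.*-distribˡ-∑ y f)) (Z.*-distribˡ-∑ x _)
    rearrange : ∀ s t p q d → ℤ.- s ℤ.* (p ℤ.* (t ℤ.* (q ℤ.* d))) ≡ ℤ.- t ℤ.* (q ℤ.* (s ℤ.* (p ℤ.* d)))
    rearrange = solve-∀
    exchange : ∀ l a p q d → altSign (suc l) ℤ.* (p ℤ.* (altSign a ℤ.* (q ℤ.* d))) ≡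
                             altSign (suc a) ℤ.* (q ℤ.* (altSign l ℤ.* (p ℤ.* d)))
    exchange l a p q d rewrite altSign-suc l | altSign-suc a = rearrange (altSign l) (altSign a) p q d

  -- Transposition turns the expansion along column 0 into the expansion along row 0.
  det-transpose : (M : Matrix ℤ k k) → Δ M ≡ Δ (λ i j → M j i)
  det-transpose {zero}  M = ≡.trans (Δ-zero M) (≡.sym (Δ-zero _))
  det-transpose {suc k} M = begin
    Δ M                ≡⟨ det-column M ⟩
    Z.∑ _                ≡⟨ Z.∑-cong (λ a → ≡.cong (λ d → altSign (toℕ a) ℤ.* (M a zero ℤ.* d))
                              (det-transpose (λ x y → M (punchIn a x) (suc y)))) ⟩
    Z.∑ _                ≡⟨ det-row (λ i j → M j i) ⟨
    Δ (λ i j → M j i)  ∎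

  swapRows : {A : Set} → (Fin (suc (suc k)) → A) → Fin (suc (suc k)) → A
  swapRows M zero          = M (suc zero)
  swapRows M (suc zero)    = M zero
  swapRows M (suc (suc i)) = M (suc (suc i))

  -- In the expansion along column 0 the first two terms trade places; their minors agree and their
  -- signs are opposite. Every later minor still contains both swapped rows on top, so induction
  -- applies to it.
  det-swapRows : (M : Matrix ℤ (suc (suc k)) (suc (suc k))) → Δ (swapRows M) ≡ ℤ.- Δ M
  det-swapRows {k} M = begin
    Δ (swapRows M)                                     ≡⟨ ≡.trans (det-column (swapRows M)) (≡.trans (∑-suc _) (≡.cong (λ z → term′ zero ℤ.+ z) (∑-suc _))) ⟩
    term′ zero ℤ.+ (term′ (suc zero) ℤ.+ Z.∑ (λ a → term′ (suc (suc a))))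
      ≡⟨ ≡.cong₂ ℤ._+_ first (≡.cong₂ ℤ._+_ second (≡.trans (Z.∑-cong rest) (≡.sym (Z.∑-neg _)))) ⟩
    ℤ.- term (suc zero) ℤ.+ (ℤ.- term zero ℤ.+ ℤ.- Z.∑ (λ a → term (suc (suc a))))
      ≡⟨ collect (term zero) (term (suc zero)) (Z.∑ (λ a → term (suc (suc a)))) ⟩
    ℤ.- (term zero ℤ.+ (term (suc zero) ℤ.+ Z.∑ (λ a → term (suc (suc a)))))
      ≡⟨ ≡.cong ℤ.-_ (≡.trans (det-column M) (≡.trans (∑-suc _) (≡.cong (λ z → term zero ℤ.+ z) (∑-suc _)))) ⟨
    ℤ.- Δ M                                            ∎
    where
    term term′ : Fin (suc (suc k)) → ℤ
    term a = altSign (toℕ a) ℤ.* (M a zero ℤ.* Δ (λ x y → M (punchIn a x) (suc y)))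
    term′ a = altSign (toℕ a) ℤ.* (swapRows M a zero ℤ.* Δ (λ x y → swapRows M (punchIn a x) (suc y)))
    collect : ∀ x y z → ℤ.- y ℤ.+ (ℤ.- x ℤ.+ ℤ.- z) ≡ ℤ.- (x ℤ.+ (y ℤ.+ z))
    collect = solve-∀
    flip-sign : ∀ p → + 1 ℤ.* p ≡ ℤ.- (ℤ.- (+ 1) ℤ.* p)
    flip-sign = solve-∀
    flip-sign′ : ∀ p → ℤ.- (+ 1) ℤ.* p ≡ ℤ.- (+ 1 ℤ.* p)
    flip-sign′ = solve-∀
    push-sign : ∀ s p d → s ℤ.* (p ℤ.* ℤ.- d) ≡ ℤ.- (s ℤ.* (p ℤ.* d))
    push-sign = solve-∀
    first : term′ zero ≡ ℤ.- term (suc zero)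
    first = ≡.trans (≡.cong (λ d → + 1 ℤ.* (M (suc zero) zero ℤ.* d))
        (det-cong λ { zero y → ≡.refl ; (suc x) y → ≡.refl })) (flip-sign (M (suc zero) zero ℤ.* Δ (λ x y → M (punchIn (suc zero) x) (suc y))))
    second : term′ (suc zero) ≡ ℤ.- term zero
    second = ≡.trans (≡.cong (λ d → ℤ.- (+ 1) ℤ.* (M zero zero ℤ.* d))
        (det-cong λ { zero y → ≡.refl ; (suc x) y → ≡.refl })) (flip-sign′ (M zero zero ℤ.* Δ (λ x y → M (suc x) (suc y))))
    -- An index `a` exists only if there is a third row, so the minor again has at least two rows
    -- and the recursion is on a smaller size.
    minor-swap : ∀ {k} (M : Matrix ℤ (suc (suc k)) (suc (suc k))) (a : Fin k) →
      Δ (λ x y → swapRows M (punchIn (suc (suc a)) x) (suc y)) ≡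
      ℤ.- Δ (λ x y → M (punchIn (suc (suc a)) x) (suc y))
    minor-swap {suc k} M a = ≡.trans
      (det-cong λ { zero y → ≡.refl ; (suc zero) y → ≡.refl ; (suc (suc x)) y → ≡.refl })
      (det-swapRows (λ x y → M (punchIn (suc (suc a)) x) (suc y)))
    rest : ∀ a → term′ (suc (suc a)) ≡ ℤ.- term (suc (suc a))
    rest a = ≡.trans (≡.cong (λ d → altSign (toℕ a) ℤ.* (M (suc (suc a)) zero ℤ.* d)) (minor-swap M a))
                   (push-sign (altSign (toℕ a)) (M (suc (suc a)) zero) (Δ (λ x y → M (punchIn (suc (suc a)) x) (suc y))))

  private
    self-negative : ∀ {x} → x ≡ ℤ.- x → x ≡ + 0
    self-negative {+ zero}  _ = ≡.refl
    self-negative {+ suc _} ()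
    self-negative { -[1+ _ ]} ()

  -- If rows 0 and 1 agree, swapping them shows that the determinant is its own negative. Otherwise
  -- old row 0 is moved to position 1; in the expansion along the new top row every minor begins
  -- with old row 0 and also contains its copy.
  det-equalRows : (M : Matrix ℤ (suc k) (suc k)) (a : Fin k) →
                  (∀ j → M zero j ≡ M (suc a) j) → Δ M ≡ + 0
  det-equalRows M zero M₀≗M₁ = self-negative (≡.trans (det-cong swap≗) (det-swapRows M))
    where
    swap≗ : ∀ i j → M i j ≡ swapRows M i j
    swap≗ zero          j = M₀≗M₁ j
    swap≗ (suc zero)    j = ≡.sym (M₀≗M₁ j)
    swap≗ (suc (suc i)) j = ≡.refl
  det-equalRows {suc (suc k)} M (suc a) M₀≗Mₐ = begin
    Δ M                      ≡⟨ ℤP.neg-involutive (Δ M) ⟨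
    ℤ.- (ℤ.- Δ M)            ≡⟨ ≡.cong ℤ.-_ (det-swapRows M) ⟨
    ℤ.- Δ (swapRows M)       ≡⟨ ≡.cong ℤ.-_ (≡.trans (det-row (swapRows M)) (Z.∑-ε vanishing)) ⟩
    + 0                        ∎
    where
    vanishing : ∀ l → altSign (toℕ l) ℤ.* (swapRows M zero l ℤ.* Δ (λ x y → swapRows M (suc x) (punchIn l y))) ≡ + 0
    vanishing l = ≡.trans
      (≡.cong (λ d → altSign (toℕ l) ℤ.* (M (suc zero) l ℤ.* d))
        (det-equalRows (λ x y → swapRows M (suc x) (punchIn l y)) a (λ y → M₀≗Mₐ (punchIn l y))))
      (≡.trans (≡.cong (altSign (toℕ l) ℤ.*_) (ℤP.*-zeroʳ (M (suc zero) l))) (ℤP.*-zeroʳ (altSign (toℕ l))))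

  module _ (G : Matrix ℤ n m) where

    IndependentColumns : (Fin k → Fin m) → Set
    IndependentColumns {k} κ = (c : Fin k → ℤ) → (∀ i → Z.∑ (λ l → c l ℤ.* G i (κ l)) ≡ + 0) → ∀ l → c l ≡ + 0

    -- The row-0 expansions of i ∷ ρ give column relations whose coefficients do not depend on i.
    nonzero-minor : (κ : Fin k → Fin m) → IndependentColumns κ →
      ∃[ ρ ] (Injective _≡_ _≡_ ρ × Δ (λ a b → G (ρ a) (κ b)) ≢ + 0)
    nonzero-minor {zero}  κ ind = (λ ()) , (λ { {()} }) , λ Δ≡0 → contradiction (≡.trans (≡.sym (Δ-zero _)) Δ≡0) λ ()
    nonzero-minor {suc k} κ ind = extend (nonzero-minor (κ ∘ᶠ suc) tail-independent)
      where
      tail-independent : IndependentColumns (κ ∘ᶠ suc)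
      tail-independent c c≈0 l = ind ((+ 0) ∷ᶠ c) (λ i → ≡.trans (∑-suc _)
        (≡.trans (≡.cong (λ z → + 0 ℤ.* G i (κ zero) ℤ.+ z) (c≈0 i)) (≡.trans (ℤP.+-identityʳ (+ 0 ℤ.* G i (κ zero))) (ℤP.*-zeroˡ (G i (κ zero))))))
        (suc l)

      extend : ∃[ ρ ] (Injective _≡_ _≡_ ρ × Δ (λ a b → G (ρ a) (κ (suc b))) ≢ + 0) →
               ∃[ ρ ] (Injective _≡_ _≡_ ρ × Δ (λ a b → G (ρ a) (κ b)) ≢ + 0)
      extend (ρ , ρ-inj , minor≢0) with all? (λ i → Δ (λ a b → G ((i ∷ᶠ ρ) a) (κ b)) ℤ.≟ + 0)
      ... | yes dets≡0 = contradiction (≡.trans (≡.sym (ℤP.*-identityˡ (Δ (λ a b → G (ρ a) (κ (suc b)))))) (ind c relation zero)) minor≢0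
        where
        c : Fin (suc k) → ℤ
        c l = altSign (toℕ l) ℤ.* Δ (λ a b → G (ρ a) (κ (punchIn l b)))
        regroup : ∀ s d g → s ℤ.* d ℤ.* g ≡ s ℤ.* (g ℤ.* d)
        regroup = solve-∀
        relation : ∀ i → Z.∑ (λ l → c l ℤ.* G i (κ l)) ≡ + 0
        relation i = ≡.trans (Z.∑-cong (λ l → regroup (altSign (toℕ l)) (Δ (λ a b → G (ρ a) (κ (punchIn l b)))) (G i (κ l))))
          (≡.trans (≡.sym (det-row (λ a b → G ((i ∷ᶠ ρ) a) (κ b)))) (dets≡0 i))
      ... | no dets≢0 with ¬∀⟶∃¬ n _ (λ i → Δ (λ a b → G ((i ∷ᶠ ρ) a) (κ b)) ℤ.≟ + 0) dets≢0
      ... | i , det≢0 = (i ∷ᶠ ρ) , injective , det≢0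
        where
        i∉ρ : ∀ a → i ≢ ρ a
        i∉ρ a i≡ρa = det≢0 (det-equalRows (λ a b → G ((i ∷ᶠ ρ) a) (κ b)) a (λ j → ≡.cong (λ r → G r (κ j)) i≡ρa))
        injective : Injective _≡_ _≡_ (i ∷ᶠ ρ)
        injective {zero}  {zero}  _  = ≡.refl
        injective {zero}  {suc b} eq = contradiction eq (i∉ρ b)
        injective {suc a} {zero}  eq = contradiction (≡.sym eq) (i∉ρ a)
        injective {suc a} {suc b} eq = ≡.cong suc (ρ-inj eq)

    -- The same dual vectors serve the submatrix with columns `κ`, since injectivity of `κ`
    -- preserves the unit vectors. An integral relation is then refuted over ℚ.
    dual⇒independentColumns : ∀ {I} → Q.DualSystem (embed-mat G) I →
      (κ : Fin k → Fin m) → Injective _≡_ _≡_ κ → (∀ l → κ l ∈ I) → IndependentColumns κ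
    dual⇒independentColumns {k} sys κ κ-inj κ∈I c c≈0 l = embed-injective (≡.trans
      (Q.dualSystem⇒independent (embed-mat Gκ) {⊤} κ-sys (embed ∘ᶠ c)
        (λ e e∉⊤ → contradiction ∈⊤ e∉⊤) relation l) (≡.sym embed-0))
      where
      Gκ : Matrix ℤ n k
      Gκ i l = G i (κ l)
      relation : ∀ i → sumFin 0ℚ ℚ._+_ (λ e → embed (c e) ℚ.* embed (Gκ i e)) ≡ 0ℚ
      relation i = begin
        sumFin 0ℚ ℚ._+_ (λ e → embed (c e) ℚ.* embed (Gκ i e))   ≡⟨ Q.∑≡sumFin _ ⟨
        Q.∑ (λ e → embed (c e) ℚ.* embed (Gκ i e))               ≡⟨ Q.comb≡∑ (embed-mat Gκ) (embed ∘ᶠ c) i ⟨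
        Q.comb (embed-mat Gκ) (embed ∘ᶠ c) i                      ≡⟨ embed-comb Gκ c i ⟨
        embed (Z.comb Gκ c i)                                    ≡⟨ ≡.cong embed (≡.trans (Z.comb≡∑ Gκ c i) (c≈0 i)) ⟩
        embed (+ 0)                                              ≡⟨ embed-0 ⟩
        0ℚ                                                       ∎
      κ-δ : ∀ l l′ → Q.δ (κ l) (κ l′) ≡ Q.δ l l′
      κ-δ l l′ with l ≟ l′
      ... | yes ≡.refl = ≡.trans (Q.δ-≡ (κ l)) (≡.sym (Q.δ-≡ l))
      ... | no l≢l′  = ≡.trans (Q.δ-≢ (l≢l′ ∘ᶠ κ-inj)) (≡.sym (Q.δ-≢ l≢l′))
      κ-sys : Q.DualSystem (embed-mat Gκ) ⊤
      κ-sys l _ = let y , dual = sys (κ l) (κ∈I l) in y , λ l′ _ →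
        ≡.trans (Q.dot≡∑ (embed-mat Gκ) y l′) (≡.trans (≡.sym (Q.dot≡∑ (embed-mat G) y (κ l′)))
          (≡.trans (dual (κ l′) (κ∈I l′)) (κ-δ l l′)))

    -- Cramer's rule: the dual vector is a row of cofactors.
    minor-dual : (j : Fin m) (κ : Fin k → Fin m) (ρ : Fin (suc k) → Fin n) →
      ∃[ y ] (Z.dot G y j ≡ Δ (λ a b → G (ρ a) ((j ∷ᶠ κ) b)) × (∀ l → Z.dot G y (κ l) ≡ + 0))
    minor-dual {k} j κ ρ = y ,
      ≡.trans (y-dot j) (det-transpose (λ b a → G (ρ a) ((j ∷ᶠ κ) b))) ,
      λ l → ≡.trans (y-dot (κ l)) (det-equalRows (λ b a → G (ρ a) ((κ l ∷ᶠ κ) b)) l (λ _ → ≡.refl))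
      where
      s : Fin (suc k) → ℤ
      s a = altSign (toℕ a) ℤ.* Δ (λ b x → G (ρ (punchIn a x)) (κ b))
      y : Fin n → ℤ
      y i = Z.∑ (λ a → s a ℤ.* Z.δ (ρ a) i)
      regroup : ∀ s d g → s ℤ.* d ℤ.* g ≡ s ℤ.* (g ℤ.* d)
      regroup = solve-∀
      y-dot : ∀ e → Z.dot G y e ≡ Δ (λ b a → G (ρ a) ((e ∷ᶠ κ) b))
      y-dot e = begin
        Z.dot G y e                                                ≡⟨ Z.dot-∑ G s (Z.δ ∘ᶠ ρ) e ⟩
        Z.∑ (λ a → s a ℤ.* Z.dot G (Z.δ (ρ a)) e)                  ≡⟨ Z.∑-cong (λ a → ≡.cong (s a ℤ.*_) (Z.dot-δ G (ρ a) e)) ⟩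
        Z.∑ (λ a → s a ℤ.* G (ρ a) e)                              ≡⟨ Z.∑-cong (λ a → regroup (altSign (toℕ a)) (Δ (λ b x → G (ρ (punchIn a x)) (κ b))) (G (ρ a) e)) ⟩
        Z.∑ _                                                      ≡⟨ det-row (λ b a → G (ρ a) ((e ∷ᶠ κ) b)) ⟨
        Δ (λ b a → G (ρ a) ((e ∷ᶠ κ) b))                         ∎

  -- The elements of `I` are listed with `j` first, so that cofactors along the first column give a
  -- row combination killing all of `I` except `j`.
  totallyUnimodular-unimodular : (G : Matrix ℤ n m) → TotallyUnimodular G → Unimodular G
  totallyUnimodular-unimodular {n} {m} G tu {I} sys j j∈I = from-minor
    (nonzero-minor G (j ∷ᶠ κ) (dual⇒independentColumns G sys (j ∷ᶠ κ) injective members))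
    where
    rest? = λ e → (e ∈? I) ×-dec ¬? (e ≟ j)

    others : List (Fin m)
    others = filter rest? (allFin m)

    κ : Fin (length others) → Fin m
    κ = lookup others

    κ-rest : ∀ l → κ l ∈ I × κ l ≢ j
    κ-rest l = proj₂ (∈-filter⁻ rest? {xs = allFin m} (∈-lookup l))

    members : ∀ l → (j ∷ᶠ κ) l ∈ I
    members zero    = j∈I
    members (suc l) = proj₁ (κ-rest l)

    injective : Injective _≡_ _≡_ (j ∷ᶠ κ)
    injective {zero}  {zero}  _  = ≡.refl
    injective {zero}  {suc b} eq = contradiction (≡.sym eq) (proj₂ (κ-rest b))
    injective {suc a} {zero}  eq = contradiction eq (proj₂ (κ-rest a))
    injective {suc a} {suc b} eq = ≡.cong suc (distinct-lookup ≡.sym (filter⁺ rest? (allFin⁺ m)) a b eq)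

    from-minor : ∃[ ρ ] (Injective _≡_ _≡_ ρ × Δ (λ a b → G (ρ a) ((j ∷ᶠ κ) b)) ≢ + 0) →
                 ∃[ y ] Z.IsDual G I j y
    -- The cofactor vector has product `d` with column `j`. A nonzero minor is ±1, hence its own
    -- inverse, so multiplying by `d` normalises this product to 1.
    from-minor (ρ , ρ-inj , det≢0) = (λ i → d ℤ.* y i) , dual
      where
      d : ℤ
      d = Δ (λ a b → G (ρ a) ((j ∷ᶠ κ) b))
      d*d≡1 : d ℤ.* d ≡ + 1
      d*d≡1 with tu _ ρ (j ∷ᶠ κ) ρ-inj injective
      ... | inj₁ d≡0         = contradiction (≡.trans (Δ≡det _) d≡0) det≢0
      ... | inj₂ (inj₁ d≡1)  = ≡.cong (λ x → x ℤ.* x) (≡.trans (Δ≡det _) d≡1)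
      ... | inj₂ (inj₂ d≡-1) = ≡.cong (λ x → x ℤ.* x) (≡.trans (Δ≡det _) d≡-1)
      cramer = minor-dual G j κ ρ
      y : Fin n → ℤ
      y = proj₁ cramer
      dual : Z.IsDual G I j (λ i → d ℤ.* y i)
      dual e e∈I with e ≟ j
      ... | yes ≡.refl = ≡.trans (Z.dot-* G d y j) (≡.trans (≡.cong (d ℤ.*_) (proj₁ (proj₂ cramer)))
                         (≡.trans d*d≡1 (≡.sym (Z.δ-≡ j))))
      ... | no e≢j   = ≡.trans (Z.dot-* G d y e) (≡.trans (≡.cong (d ℤ.*_) y·e≡0)
                         (≡.trans (ℤP.*-zeroʳ d) (≡.sym (Z.δ-≢ (e≢j ∘ᶠ ≡.sym)))))
        where
        e∈others = ∈-filter⁺ rest? (∈-allFin e) (e∈I , e≢j)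
        y·e≡0 : Z.dot G y e ≡ + 0
        y·e≡0 = ≡.subst (λ f → Z.dot G y f ≡ + 0) (≡.sym (lookup-index e∈others)) (proj₂ (proj₂ cramer) (index e∈others))

  totallyP-unimodular : (G : Matrix ℤ n m) → TotallyPInteger G → Unimodular G
  totallyP-unimodular G (inj₁ isVE)        = vertexEdge-unimodular G isVE
  totallyP-unimodular G (inj₂ (inj₁ isCE)) = cycleEdge-unimodular G isCE
  totallyP-unimodular G (inj₂ (inj₂ tu))   = totallyUnimodular-unimodular G tu

open Determinants using (totallyP-unimodular)

-- Enumerations by lists without repetition

module _ (S : Setoid a ℓ) where
  open Setoid S

  -- The conditions of `HasCardinality` other than the length. Cardinalities thus become lengths of
  -- lists, and two enumerations of one predicate can be compared.
  Enumerates : (Carrier → Set p) → List Carrier → Set (a ⊔ ℓ ⊔ p)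
  Enumerates P xs = All P xs × (∀ x → P x → Any (x ≈_) xs) × AllPairs (λ x y → ¬ (x ≈ y)) xs

  -- Pigeonhole: each position in `xs` goes to the position of an equal entry of `ys`, and
  -- distinctness of `xs` makes this injective.
  enumerates-length-≤ : ∀ {P : Carrier → Set p} {xs ys} → Enumerates P xs → Enumerates P ys →
                        length xs ≤ length ys
  enumerates-length-≤ {xs = xs} {ys} (Pxs , _ , xs!) (_ , complete , _) = injective⇒≤ {f = f} f-inj
    where
    position : ∀ i → Any (lookup xs i ≈_) ys
    position i = complete _ (All.lookup Pxs (∈-lookup i))
    f : Fin (length xs) → Fin (length ys)
    f i = index (position i)
    f-inj : ∀ {i j} → f i ≡ f j → i ≡ j
    f-inj {i} {j} eq = distinct-lookup sym xs! i j (trans (lookup-index (position i))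
      (trans (reflexive (≡.cong (lookup ys) eq)) (sym (lookup-index (position j)))))

  enumerates-length : ∀ {P : Carrier → Set p} {xs ys} → Enumerates P xs → Enumerates P ys →
                      length xs ≡ length ys
  enumerates-length xs-enum ys-enum = ℕP.≤-antisym
    (enumerates-length-≤ xs-enum ys-enum) (enumerates-length-≤ ys-enum xs-enum)

  enumerates-filter : ∀ {P : Carrier → Set p} {Q : Carrier → Set p′} (Q? : Decidable₁ Q) →
    (∀ {x y} → x ≈ y → Q x → Q y) → ∀ {xs} →
    Enumerates P xs → Enumerates (λ x → P x × Q x) (filter Q? xs)
  enumerates-filter Q? Q-resp {xs} (Pxs , complete , xs!) =
    All.zip (AllP.filter⁺ Q? Pxs , AllP.all-filter Q? xs) ,
    (λ x (Px , Qx) → filtered Qx (complete x Px)) , AllPairsP.filter⁺ Q? xs!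
    where
    filtered : ∀ {x xs} → _ → Any (x ≈_) xs → Any (x ≈_) (filter Q? xs)
    filtered {x} {y ∷ ys} Qx (here x≈y) with Q? y
    ... | yes _  = here x≈y
    ... | no ¬Qy = contradiction (Q-resp x≈y Qx) ¬Qy
    filtered {x} {y ∷ ys} Qx (there x∈) with Q? y
    ... | yes _ = there (filtered Qx x∈)
    ... | no _  = filtered Qx x∈

module _ (S : Setoid a ℓ) (T : Setoid a′ ℓ′) where
  private
    module S = Setoid S
    module T = Setoid T

  enumerates-map : ∀ {P : S.Carrier → Set p} {Q : T.Carrier → Set p′} (f : S.Carrier → T.Carrier) →
    (∀ {x y} → x S.≈ y → f x T.≈ f y) →
    (∀ {x} → P x → Q (f x)) → (∀ {x y} → P x → P y → f x T.≈ f y → x S.≈ y) →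
    (∀ y → Q y → ∃[ x ] (P x × y T.≈ f x)) →
    ∀ {xs} → Enumerates S P xs → Enumerates T Q (map f xs)
  enumerates-map f f-cong P⇒Q f-inj onto (Pxs , complete , xs!) =
    AllP.map⁺ (All.map P⇒Q Pxs) ,
    (λ y Qy → let x , Px , y≈fx = onto y Qy in
      AnyP.map⁺ (Any.map (λ x≈z → T.trans y≈fx (f-cong x≈z)) (complete x Px))) ,
    distinct Pxs xs!
    where
    distinct : ∀ {xs} → All _ xs → AllPairs (λ x y → ¬ (x S.≈ y)) xs →
               AllPairs (λ x y → ¬ (x T.≈ y)) (map f xs)
    distinct []         []         = []
    distinct (Px ∷ Pxs) (x∉ ∷ xs!) =
      AllP.map⁺ (All.zipWith (λ (Py , x≉y) fx≈fy → x≉y (f-inj Px Py fx≈fy)) (Pxs , x∉)) ∷ distinct Pxs xs!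

length-cartesianProductWith : ∀ {A : Set a} {B : Set a′} {C : Set p} (f : A → B → C) xs ys →
  length (cartesianProductWith f xs ys) ≡ length xs ℕ.* length ys
length-cartesianProductWith f []       ys = ≡.refl
length-cartesianProductWith f (x ∷ xs) ys = ≡.trans (length-++ (map (f x) ys))
  (≡.cong₂ ℕ._+_ (length-map (f x) ys) (length-cartesianProductWith f xs ys))

-- Free on `T` and constantly `z` elsewhere. These lists provide the coordinates of flows, all
-- functions on the ground set (for `T` = `⊤`), and the elements of a power of a field.
supportedFunctions : {A : Set a} → A → List A → Subset m → List (Fin m → A)
supportedFunctions z els []            = (λ ()) ∷ []
supportedFunctions z els (outside ∷ T) = map (z ∷ᶠ_) (supportedFunctions z els T)
supportedFunctions z els (inside ∷ T)  = cartesianProductWith _∷ᶠ_ els (supportedFunctions z els T)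

length-supportedFunctions : {A : Set a} (z : A) (els : List A) (T : Subset m) →
  length (supportedFunctions z els T) ≡ length els ^ ∣ T ∣
length-supportedFunctions z els []            = ≡.refl
length-supportedFunctions z els (outside ∷ T) = ≡.trans (length-map (z ∷ᶠ_) (supportedFunctions z els T)) (length-supportedFunctions z els T)
length-supportedFunctions z els (inside ∷ T)  = ≡.trans (length-cartesianProductWith _∷ᶠ_ els _)
  (≡.cong (length els ℕ.*_) (length-supportedFunctions z els T))

module _ (S : Setoid a ℓ) (z : Setoid.Carrier S) where
  open Setoid S
  open FunEq S using (≋-setoid)

  supportedFunctions-enumerates : ∀ {els} → Enumerates S (λ _ → ⊤₀) els → (T : Subset m) →
    Enumerates (≋-setoid m) (λ f → ∀ e → e ∉ T → f e ≈ z) (supportedFunctions z els T)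
  supportedFunctions-enumerates {m} {els} (_ , complete , els!) T = supported T , all T , distinct T
    where
    supported : (T : Subset k) → All (λ f → ∀ e → e ∉ T → f e ≈ z) (supportedFunctions z els T)
    supported []            = (λ ()) ∷ []
    supported (outside ∷ T) = AllP.map⁺ (All.map
      (λ { f-supp zero _ → refl ; f-supp (suc e) e∉ → f-supp e (drop-not-there e∉) }) (supported T))
    supported (inside ∷ T)  = AllP.cartesianProductWith⁺ (≡.setoid _) (≡.setoid _) _∷ᶠ_ els _
      λ _ f∈ → λ { zero 0∉ → contradiction here 0∉ ; (suc e) e∉ → All.lookup (supported T) f∈ e (drop-not-there e∉) }
    all : (T : Subset k) (f : Fin k → Carrier) → (∀ e → e ∉ T → f e ≈ z) →
          Any (Setoid._≈_ (≋-setoid k) f) (supportedFunctions z els T)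
    all []            f _      = here λ ()
    all {suc k} (outside ∷ T) f f-supp = AnyP.map⁺ (Any.map
      (λ { f≈g zero → f-supp zero (λ ()) ; f≈g (suc e) → f≈g e })
      (all T (f ∘ᶠ suc) (λ e e∉T → f-supp (suc e) (λ { (there e∈T) → e∉T e∈T }))))
    all {suc k} (inside ∷ T)  f f-supp = AnyP.cartesianProductWith⁺ _∷ᶠ_
      (λ { x≈ f≈ zero → x≈ ; x≈ f≈ (suc e) → f≈ e }) (complete (f zero) _)
      (all T (f ∘ᶠ suc) (λ e e∉T → f-supp (suc e) (λ { (there e∈T) → e∉T e∈T })))
    distinct : (T : Subset k) → AllPairs (λ f g → ¬ (Setoid._≈_ (≋-setoid k) f g)) (supportedFunctions z els T)
    distinct []            = [] ∷ []
    distinct {suc k} (outside ∷ T) = map⁺ (≋-setoid k) (≋-setoid (suc k)) (λ f≈g e → f≈g (suc e)) (distinct T)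
    distinct {suc k} (inside ∷ T)  = cartesianProductWith⁺ S (≋-setoid k) (≋-setoid (suc k)) _∷ᶠ_
      (λ f≈g → f≈g zero , λ e → f≈g (suc e)) els! (distinct T)

∣∩∣+∣∩∁∣ : (p q : Subset m) → ∣ p ∩ q ∣ ℕ.+ ∣ p ∩ ∁ q ∣ ≡ ∣ p ∣
∣∩∣+∣∩∁∣ []            []            = ≡.refl
∣∩∣+∣∩∁∣ (outside ∷ p) (x ∷ q)       = ∣∩∣+∣∩∁∣ p q
∣∩∣+∣∩∁∣ (inside ∷ p)  (inside ∷ q)  = ≡.cong suc (∣∩∣+∣∩∁∣ p q)
∣∩∣+∣∩∁∣ (inside ∷ p)  (outside ∷ q) = ≡.trans (ℕP.+-suc _ _) (≡.cong suc (∣∩∣+∣∩∁∣ p q))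

∁∅≡⊤ : ∀ m → ∁ {m} ∅ ≡ ⊤
∁∅≡⊤ zero    = ≡.refl
∁∅≡⊤ (suc m) = ≡.cong (inside ∷_) (∁∅≡⊤ m)

-- Counting the flows that vanish on a set

module ModuleFlows (R : CommutativeRing a ℓ) (M : LeftModule (CommutativeRing.ring R) a′ ℓ′)
  {n m} (G : Matrix (CommutativeRing.Carrier R) n m) where
  open CommutativeRing R using (0#) renaming (Carrier to Scalar)
  private module R = CommutativeRing R
  open LeftModule M
  open DualSystems R using (dot; comb; mask; mask-∈; mask-∉; δ-≡; δ-≢; FlowBasis; dot≡∑; comb≡∑)
  private
    module ∑ᴿ = DualSystems R
    module ∑ᴹ = Sums +ᴹ-commutativeMonoid
    open ∑ᴹ using (∑; ∑-cong; ∑-swap; ∑-single; ∑-ε; ∑≡sumFin)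
  open FunEq ≈ᴹ-setoid using (≋-setoid)
  open SetoidReasoning ≈ᴹ-setoid

  -- Scalars and values are kept apart: ℤ acting on an abelian group and a field acting on its d-th
  -- power are both instances.
  IsFlow : (Fin m → Carrierᴹ) → Set (a′ ⊔ ℓ′)
  IsFlow h = Σ (Fin n → Carrierᴹ) λ c → (∀ e → h e ≈ᴹ sumFin 0ᴹ _+ᴹ_ {n} (λ i → G i e *ₗ c i))

  VanishesOn : Subset m → (Fin m → Carrierᴹ) → Set ℓ′
  VanishesOn B h = ∀ e → e ∈ B → h e ≈ᴹ 0ᴹ

  private
    *ₗ-∑ : ∀ r (f : Fin k → Carrierᴹ) → r *ₗ ∑ f ≈ᴹ ∑ (λ i → r *ₗ f i)
    *ₗ-∑ r = ∑-homo +ᴹ-commutativeMonoid +ᴹ-commutativeMonoid (r *ₗ_) (*ₗ-zeroʳ r) (*ₗ-distribˡ r)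

    ∑-*ₗ : ∀ (r : Fin k → Scalar) x → ∑ᴿ.∑ r *ₗ x ≈ᴹ ∑ (λ i → r i *ₗ x)
    ∑-*ₗ r x = ∑-homo R.+-commutativeMonoid +ᴹ-commutativeMonoid (_*ₗ x) (*ₗ-zeroˡ x) (*ₗ-distribʳ x) r

  -- `B₀` is independent of `B` so that one basis serves two counts: `B₀` = `B` gives the flows
  -- vanishing on `B`, and `B₀` = `∅` gives all flows.
  module _ {rk} {B B₀ : Subset m} (basis-of : FlowBasis G rk B)
    (vanish₀ : ∀ j → j ∈ FlowBasis.basis basis-of → j ∉ B₀ → ∀ e → e ∈ B₀ →
               dot G (FlowBasis.Y basis-of j) e R.≈ 0#) where
    open FlowBasis basis-of

    private
      T : Subset m
      T = basis ∩ ∁ B₀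

      Supp : (Fin m → Carrierᴹ) → Set ℓ′
      Supp φ = ∀ e → e ∉ T → φ e ≈ᴹ 0ᴹ

      -- The flow with prescribed values `φ` on the basis: the row combinations given by the dual
      -- vectors, weighted by `φ`.
      flow : (Fin m → Carrierᴹ) → Fin m → Carrierᴹ
      flow φ e = ∑ (λ j → dot G (Y j) e *ₗ φ j)

      flow-cong : ∀ {φ ψ} → (∀ e → φ e ≈ᴹ ψ e) → ∀ e → flow φ e ≈ᴹ flow ψ e
      flow-cong φ≈ψ e = ∑-cong (λ j → *ₗ-congˡ (φ≈ψ j))

      flow-isFlow : ∀ φ → IsFlow (flow φ)
      flow-isFlow φ = (λ i → ∑ (λ j → Y j i *ₗ φ j)) , λ e → begin
        ∑ (λ j → dot G (Y j) e *ₗ φ j)                        ≈⟨ ∑-cong (λ j → *ₗ-congʳ (R.reflexive (dot≡∑ G (Y j) e))) ⟩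
        ∑ (λ j → ∑ᴿ.∑ (λ i → Y j i R.* G i e) *ₗ φ j)         ≈⟨ ∑-cong (λ j → ∑-*ₗ _ (φ j)) ⟩
        ∑ (λ j → ∑ (λ i → (Y j i R.* G i e) *ₗ φ j))          ≈⟨ ∑-swap _ ⟩
        ∑ (λ i → ∑ (λ j → (Y j i R.* G i e) *ₗ φ j))          ≈⟨ ∑-cong (λ i → ∑-cong (λ j →
                                                                  ≈ᴹ-trans (*ₗ-congʳ (R.*-comm _ _)) (*ₗ-assoc _ _ _))) ⟩
        ∑ (λ i → ∑ (λ j → G i e *ₗ (Y j i *ₗ φ j)))           ≈⟨ ∑-cong (λ i → *ₗ-∑ (G i e) _) ⟨
        ∑ (λ i → G i e *ₗ ∑ (λ j → Y j i *ₗ φ j))             ≡⟨ ∑≡sumFin _ ⟩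
        sumFin 0ᴹ _+ᴹ_ (λ i → G i e *ₗ ∑ (λ j → Y j i *ₗ φ j)) ∎

      supp-∉basis : ∀ {φ} → Supp φ → ∀ j → j ∉ basis → φ j ≈ᴹ 0ᴹ
      supp-∉basis supp j j∉I = supp j (j∉I ∘ᶠ p∩q⊆p basis (∁ B₀))

      flow-basis : ∀ {φ} → Supp φ → ∀ e → e ∈ basis → flow φ e ≈ᴹ φ e
      flow-basis {φ} supp e e∈I = begin
        flow φ e                    ≈⟨ ∑-single e others ⟩
        dot G (Y e) e *ₗ φ e        ≈⟨ *ₗ-congʳ (R.trans (dual e e∈I e e∈I) (δ-≡ e)) ⟩
        R.1# *ₗ φ e                 ≈⟨ *ₗ-identityˡ (φ e) ⟩
        φ e                         ∎
        where
        others : ∀ j → j ≢ e → dot G (Y j) e *ₗ φ j ≈ᴹ 0ᴹ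
        others j j≢e with j ∈? basis
        ... | yes j∈I = ≈ᴹ-trans (*ₗ-congʳ (R.trans (dual j j∈I e e∈I) (δ-≢ j≢e))) (*ₗ-zeroˡ (φ j))
        ... | no j∉I  = ≈ᴹ-trans (*ₗ-congˡ (supp-∉basis supp j j∉I)) (*ₗ-zeroʳ _)

      -- Each summand is zero on `B₀` for its own reason: `φ j` is zero if `j` is outside the basis
      -- or inside `B₀`, and in the remaining case the row combination of `Y j` vanishes on `B₀`.
      flow-vanishes : ∀ {φ} → Supp φ → VanishesOn B₀ (flow φ)
      flow-vanishes {φ} supp e e∈B₀ = ∑-ε pointwise
        where
        pointwise : ∀ j → dot G (Y j) e *ₗ φ j ≈ᴹ 0ᴹ
        pointwise j with j ∈? basis | j ∈? B₀
        ... | no j∉I  | _        = ≈ᴹ-trans (*ₗ-congˡ (supp-∉basis supp j j∉I)) (*ₗ-zeroʳ _)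
        ... | yes _   | yes j∈B₀ = ≈ᴹ-trans (*ₗ-congˡ (supp j (λ j∈T →
                                      x∈p⇒x∉∁p j∈B₀ (p∩q⊆q basis (∁ B₀) j∈T)))) (*ₗ-zeroʳ _)
        ... | yes j∈I | no j∉B₀  = ≈ᴹ-trans (*ₗ-congʳ (vanish₀ j j∈I j∉B₀ e e∈B₀)) (*ₗ-zeroˡ _)

      restrict : (Fin m → Carrierᴹ) → Fin m → Carrierᴹ
      restrict h j with j ∈? basis
      ... | yes _ = h j
      ... | no _  = 0ᴹ

      restrict-supp : ∀ {h} → VanishesOn B₀ h → Supp (restrict h)
      restrict-supp {h} h-van j j∉T with j ∈? basis | j ∈? B₀
      ... | no _    | _        = ≈ᴹ-refl
      ... | yes _   | yes j∈B₀ = h-van j j∈B₀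
      ... | yes j∈I | no j∉B₀  = contradiction (x∈p∩q⁺ (j∈I , x∉p⇒x∈∁p j∉B₀)) j∉T

      mask-restrict : ∀ h (c : Fin m → Scalar) j → mask basis c j *ₗ h j ≈ᴹ c j *ₗ restrict h j
      mask-restrict h c j with j ∈? basis
      ... | yes j∈I = *ₗ-congʳ (mask-∈ basis j∈I)
      ... | no j∉I  = ≈ᴹ-trans (*ₗ-congʳ (mask-∉ basis j j∉I)) (≈ᴹ-trans (*ₗ-zeroˡ _) (≈ᴹ-sym (*ₗ-zeroʳ _)))

      -- Each column expands in the basis columns with coefficients `dot G (Y j) e`. A flow obeys
      -- the same expansion, so its values on the basis determine it.
      flow-restrict : ∀ h → IsFlow h → ∀ e → h e ≈ᴹ flow (restrict h) e
      flow-restrict h (c , h≈) e = begin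
        h e                                                         ≈⟨ h≈ e ⟩
        sumFin 0ᴹ _+ᴹ_ (λ i → G i e *ₗ c i)                         ≡⟨ ∑≡sumFin _ ⟨
        ∑ (λ i → G i e *ₗ c i)                                      ≈⟨ ∑-cong (λ i → *ₗ-congʳ (R.trans (spanning i e) (R.reflexive (comb≡∑ G u i)))) ⟩
        ∑ (λ i → ∑ᴿ.∑ (λ j → u j R.* G i j) *ₗ c i)                 ≈⟨ ∑-cong (λ i → ∑-*ₗ _ (c i)) ⟩
        ∑ (λ i → ∑ (λ j → (u j R.* G i j) *ₗ c i))                  ≈⟨ ∑-swap _ ⟩
        ∑ (λ j → ∑ (λ i → (u j R.* G i j) *ₗ c i))                  ≈⟨ ∑-cong (λ j → ∑-cong (λ i → *ₗ-assoc _ _ _)) ⟩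
        ∑ (λ j → ∑ (λ i → u j *ₗ (G i j *ₗ c i)))                   ≈⟨ ∑-cong (λ j → *ₗ-∑ (u j) _) ⟨
        ∑ (λ j → u j *ₗ ∑ (λ i → G i j *ₗ c i))                     ≈⟨ ∑-cong (λ j → *ₗ-congˡ (≈ᴹ-trans (≈ᴹ-reflexive (∑≡sumFin _)) (≈ᴹ-sym (h≈ j)))) ⟩
        ∑ (λ j → u j *ₗ h j)                                        ≈⟨ ∑-cong (mask-restrict h _) ⟩
        flow (restrict h) e                                         ∎
        where
        u : Fin m → Scalar
        u = mask basis (λ j → dot G (Y j) e)

    flows-enumerated : ∀ {els} → Enumerates ≈ᴹ-setoid (λ _ → ⊤₀) els →
      ∃[ xs ] (Enumerates (≋-setoid m) (λ h → IsFlow h × VanishesOn B₀ h) xs ×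
               length xs ≡ length els ^ ∣ basis ∩ ∁ B₀ ∣)
    flows-enumerated {els} els-enum = map flow (supportedFunctions 0ᴹ els T) ,
      enumerates-map (≋-setoid m) (≋-setoid m) flow flow-cong
        (λ {φ} supp → flow-isFlow φ , flow-vanishes supp)
        (λ {φ} {ψ} φ-supp ψ-supp φ≈ψ e → injective φ-supp ψ-supp φ≈ψ e)
        (λ h (h-flow , h-van) → restrict h , restrict-supp h-van , flow-restrict h h-flow)
        (supportedFunctions-enumerates ≈ᴹ-setoid 0ᴹ els-enum T) ,
      ≡.trans (length-map flow (supportedFunctions 0ᴹ els T)) (length-supportedFunctions 0ᴹ els T)
      where
      injective : ∀ {φ ψ} → Supp φ → Supp ψ → (∀ e → flow φ e ≈ᴹ flow ψ e) → ∀ e → φ e ≈ᴹ ψ e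
      injective φ-supp ψ-supp φ≈ψ e with e ∈? basis
      ... | yes e∈I = ≈ᴹ-trans (≈ᴹ-sym (flow-basis φ-supp e e∈I)) (≈ᴹ-trans (φ≈ψ e) (flow-basis ψ-supp e e∈I))
      ... | no e∉I  = ≈ᴹ-trans (supp-∉basis φ-supp e e∉I) (≈ᴹ-sym (supp-∉basis ψ-supp e e∉I))

  -- All flow bases have the same size r, since q ^ ∣ basis ∣ counts all flows.
  flows-vanishing-count : ∀ {rk : Subset m → ℕ} {els} → Enumerates ≈ᴹ-setoid (λ _ → ⊤₀) els →
    (∀ B → FlowBasis G rk B) → (∀ B → rk B ≤ rk ⊤) → ∀ B →
    ∃[ xs ] (Enumerates (≋-setoid m) (λ h → IsFlow h × VanishesOn B h) xs ×
             length xs ≡ length els ^ (rk ⊤ ∸ rk B))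
  flows-vanishing-count {rk} {els} els-enum bases rk≤r B =
    let xs , xs-enum , xs-len = flows-enumerated {B₀ = B} (bases B) (vanish (bases B)) els-enum
    in xs , xs-enum , ≡.trans xs-len exponent
    where
    open FlowBasis
    q : ℕ
    q = length els
    instance
      q≢0 : ℕ.NonZero q
      q≢0 = ℕ.>-nonZero (nonempty (proj₁ (proj₂ els-enum) 0ᴹ _))
        where
        nonempty : ∀ {xs : List Carrierᴹ} → Any (0ᴹ ≈ᴹ_) xs → 0 ℕ.< length xs
        nonempty (here _)  = ℕ.s≤s ℕ.z≤n
        nonempty (there _) = ℕ.s≤s ℕ.z≤n
    all-flows : ∀ B → ∃[ xs ] (Enumerates (≋-setoid m) (λ h → IsFlow h × VanishesOn ∅ h) xs ×
                               length xs ≡ q ^ ∣ basis (bases B) ∩ ∁ ∅ ∣)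
    all-flows B = flows-enumerated {B₀ = ∅} (bases B) (λ _ _ _ e e∈∅ → contradiction e∈∅ ∉⊥) els-enum
    ∩∁∅ : ∀ (p : Subset m) → p ∩ ∁ ∅ ≡ p
    ∩∁∅ p = ≡.trans (≡.cong (p ∩_) (∁∅≡⊤ m)) (∩-identityʳ p)
    total : q ^ ∣ basis (bases B) ∣ ≡ q ^ rk ⊤
    total =
      let xs , xs-enum , xs-len = all-flows B
          ys , ys-enum , ys-len = all-flows ⊤
      in ≡.trans (≡.trans (≡.cong (λ p → q ^ ∣ p ∣) (≡.sym (∩∁∅ (basis (bases B))))) (≡.sym xs-len))
        (≡.trans (enumerates-length (≋-setoid m) xs-enum ys-enum)
          (≡.trans ys-len (≡.trans (≡.cong (λ p → q ^ ∣ p ∣) (≡.trans (∩∁∅ (basis (bases ⊤))) (≡.sym (∩-identityʳ (basis (bases ⊤))))))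
            (≡.cong (q ^_) (card (bases ⊤))))))
    exponent : q ^ ∣ basis (bases B) ∩ ∁ B ∣ ≡ q ^ (rk ⊤ ∸ rk B)
    exponent = ℕP.*-cancelˡ-≡ _ _ (q ^ rk B) {{ℕP.m^n≢0 q (rk B)}} (≡R.begin
      q ^ rk B ℕ.* q ^ ∣ I ∩ ∁ B ∣          ≡R.≡⟨ ≡.cong (λ k → q ^ k ℕ.* q ^ ∣ I ∩ ∁ B ∣) (≡.sym (card (bases B))) ⟩
      q ^ ∣ I ∩ B ∣ ℕ.* q ^ ∣ I ∩ ∁ B ∣     ≡R.≡⟨ ℕP.^-distribˡ-+-* q ∣ I ∩ B ∣ ∣ I ∩ ∁ B ∣ ⟨
      q ^ (∣ I ∩ B ∣ ℕ.+ ∣ I ∩ ∁ B ∣)       ≡R.≡⟨ ≡.cong (q ^_) (∣∩∣+∣∩∁∣ I B) ⟩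
      q ^ ∣ I ∣                             ≡R.≡⟨ total ⟩
      q ^ rk ⊤                              ≡R.≡⟨ ≡.cong (q ^_) (≡.sym (ℕP.m+[n∸m]≡n (rk≤r B))) ⟩
      q ^ (rk B ℕ.+ (rk ⊤ ∸ rk B))          ≡R.≡⟨ ℕP.^-distribˡ-+-* q (rk B) (rk ⊤ ∸ rk B) ⟩
      q ^ rk B ℕ.* q ^ (rk ⊤ ∸ rk B)        ≡R.∎)
      where
      module ≡R = ≡.≡-Reasoning
      I : Subset m
      I = basis (bases B)

module _ (S : Setoid a ℓ) (T : Setoid a′ ℓ′) where
  private
    module S = Setoid S
    module T = Setoid T

  enumerates-× : ∀ {P : S.Carrier → Set p} {Q : T.Carrier → Set p′} {xs ys} →
    Enumerates S P xs → Enumerates T Q ys →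
    Enumerates (×-setoid S T) (λ (x , y) → P x × Q y) (cartesianProduct xs ys)
  enumerates-× {xs = xs} {ys} (Pxs , complete , xs!) (Qys , complete′ , ys!) =
    AllP.cartesianProduct⁺ (≡.setoid _) (≡.setoid _) xs ys
      (λ x∈ y∈ → All.lookup Pxs x∈ , All.lookup Qys y∈) ,
    (λ (x , y) (Px , Qy) → AnyP.cartesianProductWith⁺ _,_ _,_ (complete x Px) (complete′ y Qy)) ,
    cartesianProduct⁺ S T xs! ys!

module _ (S : Setoid a ℓ) where
  open Setoid S

  enumerates-⇔ : ∀ {P : Carrier → Set p} {Q : Carrier → Set p′} {xs} →
    (∀ {x} → P x → Q x) → (∀ {x} → Q x → P x) → Enumerates S P xs → Enumerates S Q xs
  enumerates-⇔ P⇒Q Q⇒P (Pxs , complete , xs!) = All.map P⇒Q Pxs , (λ x Qx → complete x (Q⇒P Qx)) , xs!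

-- Sums, products and powers in the coefficient ring

module RingSums (R : CommutativeRing a ℓ) where
  open CommutativeRing R hiding (zero)
  open RingOps R
  open RingProps ring
  open SetoidReasoning setoid

  ∑ₗ : {A : Set a′} → (A → Carrier) → List A → Carrier
  ∑ₗ F []       = 0#
  ∑ₗ F (x ∷ xs) = F x + ∑ₗ F xs

  indicator : {P : Set p} → Dec P → Carrier
  indicator P? = if does P? then 1# else 0#

  indicator-yes : {P : Set p} (P? : Dec P) → P → indicator P? ≈ 1#
  indicator-yes (yes _) _ = refl
  indicator-yes (no ¬p) p = contradiction p ¬p

  indicator-no : {P : Set p} (P? : Dec P) → ¬ P → indicator P? ≈ 0#
  indicator-no (yes p) ¬p = contradiction p ¬p
  indicator-no (no _)  _  = refl

  indicator-⇔ : {P : Set p} {Q : Set p′} (P? : Dec P) (Q? : Dec Q) → (P → Q) → (Q → P) →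
                indicator P? ≈ indicator Q?
  indicator-⇔ (yes _) (yes _) _ _ = refl
  indicator-⇔ (no _)  (no _)  _ _ = refl
  indicator-⇔ (yes p) (no ¬q) f _ = contradiction (f p) ¬q
  indicator-⇔ (no ¬p) (yes q) _ g = contradiction (g q) ¬p

  indicator-× : {P : Set p} {Q : Set p′} (P? : Dec P) (Q? : Dec Q) →
                indicator (P? ×-dec Q?) ≈ indicator P? * indicator Q?
  indicator-× (yes _) (yes _) = sym (*-identityˡ _)
  indicator-× (yes _) (no _)  = sym (*-identityˡ _)
  indicator-× (no _)  (yes _) = sym (zeroˡ _)
  indicator-× (no _)  (no _)  = sym (zeroˡ _)

  ∑ₗ-cong : {A : Set a′} {F H : A → Carrier} → (∀ x → F x ≈ H x) → ∀ xs → ∑ₗ F xs ≈ ∑ₗ H xs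
  ∑ₗ-cong F≈H []       = refl
  ∑ₗ-cong F≈H (x ∷ xs) = +-cong (F≈H x) (∑ₗ-cong F≈H xs)

  ∑ₗ-+ : {A : Set a′} (F H : A → Carrier) → ∀ xs → ∑ₗ (λ x → F x + H x) xs ≈ ∑ₗ F xs + ∑ₗ H xs
  ∑ₗ-+ F H []       = sym (+-identityˡ 0#)
  ∑ₗ-+ F H (x ∷ xs) = trans (+-congˡ (∑ₗ-+ F H xs))
    (CommSemigroup.interchange +-commutativeSemigroup _ _ _ _)

  ∑ₗ-*ˡ : {A : Set a′} (r : Carrier) (F : A → Carrier) → ∀ xs → ∑ₗ (λ x → r * F x) xs ≈ r * ∑ₗ F xs
  ∑ₗ-*ˡ r F []       = sym (zeroʳ r)
  ∑ₗ-*ˡ r F (x ∷ xs) = trans (+-congˡ (∑ₗ-*ˡ r F xs)) (sym (distribˡ r _ _))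

  ∑ₗ-*ʳ : {A : Set a′} (r : Carrier) (F : A → Carrier) → ∀ xs → ∑ₗ (λ x → F x * r) xs ≈ ∑ₗ F xs * r
  ∑ₗ-*ʳ r F xs = trans (∑ₗ-cong (λ x → *-comm _ r) xs) (trans (∑ₗ-*ˡ r F xs) (*-comm r _))

  ∑ₗ-const : {A : Set a′} (r : Carrier) (xs : List A) → ∑ₗ (λ _ → r) xs ≈ ι (length xs) * r
  ∑ₗ-const r []       = sym (zeroˡ r)
  ∑ₗ-const r (x ∷ xs) = trans (+-cong (sym (*-identityˡ r)) (∑ₗ-const r xs)) (sym (distribʳ r _ _))

  ∑ₗ-++ : {A : Set a′} (F : A → Carrier) → ∀ xs ys → ∑ₗ F (xs ++ ys) ≈ ∑ₗ F xs + ∑ₗ F ys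
  ∑ₗ-++ F []       ys = sym (+-identityˡ _)
  ∑ₗ-++ F (x ∷ xs) ys = trans (+-congˡ (∑ₗ-++ F xs ys)) (sym (+-assoc _ _ _))

  ∑ₗ-map : {A : Set a′} {B : Set p} (F : B → Carrier) (f : A → B) → ∀ xs →
           ∑ₗ F (map f xs) ≈ ∑ₗ (λ x → F (f x)) xs
  ∑ₗ-map F f []       = refl
  ∑ₗ-map F f (x ∷ xs) = +-congˡ (∑ₗ-map F f xs)

  ∑ₗ-cartesianProductWith : {A : Set a′} {B : Set p} {C : Set p′} (F : C → Carrier) (f : A → B → C) → ∀ xs ys →
    ∑ₗ F (cartesianProductWith f xs ys) ≈ ∑ₗ (λ x → ∑ₗ (λ y → F (f x y)) ys) xs
  ∑ₗ-cartesianProductWith F f []       ys = refl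
  ∑ₗ-cartesianProductWith F f (x ∷ xs) ys = trans (∑ₗ-++ F (map (f x) ys) _)
    (+-cong (∑ₗ-map F (f x) ys) (∑ₗ-cartesianProductWith F f xs ys))

  ∑ₗ-indicator : {A : Set a′} {P : A → Set p} (P? : Decidable₁ P) → ∀ xs →
                 ∑ₗ (λ x → indicator (P? x)) xs ≈ ι (length (filter P? xs))
  ∑ₗ-indicator P? []       = refl
  ∑ₗ-indicator P? (x ∷ xs) with P? x
  ... | yes _ = +-congˡ (∑ₗ-indicator P? xs)
  ... | no _  = trans (+-identityˡ _) (∑ₗ-indicator P? xs)

  ∑ₛ : (Subset m → Carrier) → Carrier
  ∑ₛ = sumSubsets 0# _+_

  ∑ₛ-cong : {F H : Subset m → Carrier} → (∀ B → F B ≈ H B) → ∑ₛ F ≈ ∑ₛ H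
  ∑ₛ-cong {zero}  F≈H = F≈H []
  ∑ₛ-cong {suc m} F≈H = +-cong (∑ₛ-cong (λ B → F≈H (outside ∷ B))) (∑ₛ-cong (λ B → F≈H (inside ∷ B)))

  ∑ₛ-* : ∀ r (F : Subset m → Carrier) → r * ∑ₛ F ≈ ∑ₛ (λ B → r * F B)
  ∑ₛ-* {zero}  r F = refl
  ∑ₛ-* {suc m} r F = trans (distribˡ r _ _) (+-cong (∑ₛ-* {m} r _) (∑ₛ-* {m} r _))

  ∑ₗ-∑ₛ : {A : Set a′} (F : A → Subset m → Carrier) → ∀ xs →
          ∑ₗ (λ x → ∑ₛ (F x)) xs ≈ ∑ₛ (λ B → ∑ₗ (λ x → F x B) xs)
  ∑ₗ-∑ₛ {m = zero}  F xs = refl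
  ∑ₗ-∑ₛ {m = suc m} F xs = trans (∑ₗ-+ _ _ xs) (+-cong (∑ₗ-∑ₛ {m = m} _ xs) (∑ₗ-∑ₛ {m = m} _ xs))

  ∑< : ℕ → (ℕ → Carrier) → Carrier
  ∑< = sumℕ 0# _+_

  ∑<-cong : ∀ n {f g : ℕ → Carrier} → (∀ k → k < n → f k ≈ g k) → ∑< n f ≈ ∑< n g
  ∑<-cong zero    f≈g = refl
  ∑<-cong (suc n) f≈g = +-cong (∑<-cong n (λ k k<n → f≈g k (ℕP.m<n⇒m<1+n k<n))) (f≈g n ℕP.≤-refl)

  ∑<-zero : ∀ n {f : ℕ → Carrier} → (∀ k → k < n → f k ≈ 0#) → ∑< n f ≈ 0#
  ∑<-zero zero    f≈0 = refl
  ∑<-zero (suc n) f≈0 = trans (+-cong (∑<-zero n (λ k k<n → f≈0 k (ℕP.m<n⇒m<1+n k<n))) (f≈0 n ℕP.≤-refl))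
                              (+-identityˡ 0#)

  ∑<-+ : ∀ n (f g : ℕ → Carrier) → ∑< n (λ k → f k + g k) ≈ ∑< n f + ∑< n g
  ∑<-+ zero    f g = sym (+-identityˡ 0#)
  ∑<-+ (suc n) f g = trans (+-congʳ (∑<-+ n f g)) (CommSemigroup.interchange +-commutativeSemigroup _ _ _ _)

  ∑<-indicator : ∀ n (f : ℕ → Carrier) {s} → s < n → ∑< n (λ k → f k * indicator (s ℕ.≟ k)) ≈ f s
  ∑<-indicator (suc n) f {s} s<1+n with ℕP.m≤n⇒m<n∨m≡n (ℕ.s≤s⁻¹ s<1+n)
  ... | inj₁ s<n = trans (+-cong (∑<-indicator n f s<n) off) (+-identityʳ (f s))
    where
    off : f n * indicator (s ℕ.≟ n) ≈ 0#
    off = trans (*-congˡ (indicator-no (s ℕ.≟ n) (ℕP.<⇒≢ s<n))) (zeroʳ (f n))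
  ... | inj₂ ≡.refl = trans (+-cong (∑<-zero n off) on) (+-identityˡ (f s))
    where
    off : ∀ k → k < s → f k * indicator (s ℕ.≟ k) ≈ 0#
    off k k<s = trans (*-congˡ (indicator-no (s ℕ.≟ k) (ℕP.>⇒≢ k<s))) (zeroʳ (f k))
    on : f s * indicator (s ℕ.≟ s) ≈ f s
    on = trans (*-congˡ (indicator-yes (s ℕ.≟ s) ≡.refl)) (*-identityʳ (f s))

  ∏ : (Fin m → Carrier) → Carrier
  ∏ = sumFin 1# _*_

  ∏-cong : ∀ m {f g : Fin m → Carrier} → (∀ e → f e ≈ g e) → ∏ f ≈ ∏ g
  ∏-cong zero    f≈g = refl
  ∏-cong (suc m) f≈g = *-cong (f≈g zero) (∏-cong m (λ e → f≈g (suc e)))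

  -- Generalised distributivity: the value of `g` is chosen independently at each edge.
  ∑ₗ-functions : {A : Set a′} (z : A) (els : List A) (φ : Fin m → A → Carrier) →
    ∑ₗ (λ g → ∏ (λ e → φ e (g e))) (supportedFunctions z els ⊤) ≈ ∏ (λ e → ∑ₗ (φ e) els)
  ∑ₗ-functions {m = zero}  z els φ = +-identityʳ 1#
  ∑ₗ-functions {m = suc m} z els φ = begin
    ∑ₗ (λ g → ∏ (λ e → φ e (g e))) (cartesianProductWith _∷ᶠ_ els (supportedFunctions z els ⊤))
      ≈⟨ ∑ₗ-cartesianProductWith _ _∷ᶠ_ els _ ⟩
    ∑ₗ (λ x → ∑ₗ (λ g → φ zero x * ∏ (λ e → φ (suc e) (g e))) (supportedFunctions z els ⊤)) els
      ≈⟨ ∑ₗ-cong (λ x → trans (∑ₗ-*ˡ (φ zero x) _ (supportedFunctions {m = m} z els ⊤)) (*-congˡ (∑ₗ-functions {m = m} z els (λ e → φ (suc e))))) els ⟩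
    ∑ₗ (λ x → φ zero x * ∏ (λ e → ∑ₗ (φ (suc e)) els)) els
      ≈⟨ ∑ₗ-*ʳ _ (φ zero) els ⟩
    ∑ₗ (φ zero) els * ∏ (λ e → ∑ₗ (φ (suc e)) els) ∎

  ι-+ : ∀ i j → ι (i ℕ.+ j) ≈ ι i + ι j
  ι-+ zero    j = sym (+-identityˡ _)
  ι-+ (suc i) j = trans (+-congˡ (ι-+ i j)) (sym (+-assoc _ _ _))

  ι-* : ∀ i j → ι (i ℕ.* j) ≈ ι i * ι j
  ι-* zero    j = sym (zeroˡ _)
  ι-* (suc i) j = trans (ι-+ j (i ℕ.* j)) (trans (+-cong (sym (*-identityˡ _)) (ι-* i j)) (sym (distribʳ _ _ _)))

  ι-^ : ∀ i j → ι (i ^ j) ≈ pow (ι i) j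
  ι-^ i zero    = +-identityʳ 1#
  ι-^ i (suc j) = trans (ι-* i (i ^ j)) (*-congˡ (ι-^ i j))

  pow-cong : ∀ {x y} n → x ≈ y → pow x n ≈ pow y n
  pow-cong zero    x≈y = refl
  pow-cong (suc n) x≈y = *-cong x≈y (pow-cong n x≈y)

  pow-+ : ∀ x i j → pow x (i ℕ.+ j) ≈ pow x i * pow x j
  pow-+ x zero    j = sym (*-identityˡ _)
  pow-+ x (suc i) j = trans (*-congˡ (pow-+ x i j)) (sym (*-assoc _ _ _))

  pow-* : ∀ x y n → pow (x * y) n ≈ pow x n * pow y n
  pow-* x y zero    = sym (*-identityˡ 1#)
  pow-* x y (suc n) = trans (*-congˡ (pow-* x y n)) (CommSemigroup.interchange *-commutativeSemigroup _ _ _ _)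

  pow-multiple : ∀ {x} n i → pow x n ≈ 1# → pow x (i ℕ.* n) ≈ 1#
  pow-multiple n zero    eq = refl
  pow-multiple n (suc i) eq = trans (pow-+ _ n (i ℕ.* n))
    (trans (*-cong eq (pow-multiple n i eq)) (*-identityˡ 1#))

  pow-mod : ∀ {x} σ k → pow x σ ≈ 1# → pow x (k mod σ) ≈ pow x k
  pow-mod zero    k eq = refl
  pow-mod {x} (suc σ) k eq = sym (begin
    pow x k                                                           ≡⟨ ≡.cong (pow x) (m≡m%n+[m/n]*n k (suc σ)) ⟩
    pow x (k % suc σ ℕ.+ (k / suc σ) ℕ.* suc σ)                       ≈⟨ pow-+ x (k % suc σ) _ ⟩
    pow x (k % suc σ) * pow x ((k / suc σ) ℕ.* suc σ)                 ≈⟨ *-congˡ (pow-multiple (suc σ) (k / suc σ) eq) ⟩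
    pow x (k % suc σ) * 1#                                            ≈⟨ *-identityʳ _ ⟩
    pow x (k % suc σ)                                                 ∎)

  -- Each side counts an element y with residue s y < σ with weight f (s y).
  ∑<-by-residue : {A : Set a′} (σ : ℕ) (f : ℕ → Carrier) (s : A → ℕ) → (∀ y → s y < σ) → ∀ ys →
    ∑< σ (λ k → f k * ι (length (filter (λ y → s y ℕ.≟ k) ys))) ≈ ∑ₗ (λ y → f (s y)) ys
  ∑<-by-residue σ f s s<σ []       = ∑<-zero σ (λ k _ → zeroʳ (f k))
  ∑<-by-residue σ f s s<σ (y ∷ ys) = begin
    ∑< σ (λ k → f k * ι (length (filter (λ y → s y ℕ.≟ k) (y ∷ ys))))
      ≈⟨ ∑<-cong σ (λ k _ → trans (*-congˡ (count-∷ k)) (distribˡ (f k) _ _)) ⟩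
    ∑< σ (λ k → f k * indicator (s y ℕ.≟ k) + f k * ι (length (filter (λ y → s y ℕ.≟ k) ys)))
      ≈⟨ ∑<-+ σ _ _ ⟩
    ∑< σ (λ k → f k * indicator (s y ℕ.≟ k)) + ∑< σ (λ k → f k * ι (length (filter (λ y → s y ℕ.≟ k) ys)))
      ≈⟨ +-cong (∑<-indicator σ f (s<σ y)) (∑<-by-residue σ f s s<σ ys) ⟩
    f (s y) + ∑ₗ (λ y → f (s y)) ys ∎
    where
    count-∷ : ∀ k → ι (length (filter (λ y → s y ℕ.≟ k) (y ∷ ys))) ≈
                    indicator (s y ℕ.≟ k) + ι (length (filter (λ y → s y ℕ.≟ k) ys))
    count-∷ k = trans (sym (∑ₗ-indicator (λ y → s y ℕ.≟ k) (y ∷ ys)))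
      (+-congˡ (∑ₗ-indicator (λ y → s y ℕ.≟ k) ys))

-- Edge weights and the expansion of the root-of-unity sum

boolOp : SetOp → Bool → Bool → Bool
boolOp union        = _∨_
boolOp intersection = _∧_
boolOp symdiff      = _xor_
boolOp sheffer      = λ x y → not (x ∨ y)
boolOp implication  = λ x y → not x ∨ y

applyOp-∷ : ∀ op x y (A B : Subset m) → applyOp op (x ∷ A) (y ∷ B) ≡ boolOp op x y ∷ applyOp op A B
applyOp-∷ union        x y A B = ≡.refl
applyOp-∷ intersection x y A B = ≡.refl
applyOp-∷ symdiff      x y A B = ≡.refl
applyOp-∷ sheffer      x y A B = ≡.refl
applyOp-∷ implication  x y A B = ≡.refl

applyOp-[] : ∀ op → applyOp op [] [] ≡ []
applyOp-[] union        = ≡.refl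
applyOp-[] intersection = ≡.refl
applyOp-[] symdiff      = ≡.refl
applyOp-[] sheffer      = ≡.refl
applyOp-[] implication  = ≡.refl

module Weights (R : CommutativeRing r ℓ) (ω : CommutativeRing.Carrier R) where
  open CommutativeRing R using (Carrier; 1#)

  weight : SetOp → Bool → Bool → Carrier
  weight op x y = if boolOp op x y then ω else 1#

-- A `FlowData` has only a zero and a subtraction, so the group structure and its agreement with
-- that subtraction are supplied as parameters; both cases of the setting then share the expansion.
module Expansion (R : CommutativeRing r ℓ) (FD : FlowData a ℓ′ m)
  (_∙_ : Setoid.Carrier (FlowData.𝔸setoid FD) → Setoid.Carrier (FlowData.𝔸setoid FD) → Setoid.Carrier (FlowData.𝔸setoid FD))
  (inv : Setoid.Carrier (FlowData.𝔸setoid FD) → Setoid.Carrier (FlowData.𝔸setoid FD))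
  (isAbelianGroup : IsAbelianGroup (Setoid._≈_ (FlowData.𝔸setoid FD)) _∙_ (FlowData.0𝔸 FD) inv)
  (−𝔸≡ : ∀ x y → FlowData._−𝔸_ FD x y ≡ x ∙ inv y)
  (IsFlow-resp : ∀ {f h} → (∀ e → Setoid._≈_ (FlowData.𝔸setoid FD) (f e) (h e)) →
                 FlowData.IsFlow FD f → FlowData.IsFlow FD h)
  {els : List (Setoid.Carrier (FlowData.𝔸setoid FD))} (els-enum : Enumerates (FlowData.𝔸setoid FD) (λ _ → ⊤₀) els)
  where

  open FlowData FD
  open CommutativeRing R hiding (zero)
  open RingOps R
  open RingProps ring using (+-cancelʳ)
  open RingSums R
  open Weights R
  open SetoidReasoning setoid

  private
    module A = IsAbelianGroup isAbelianGroup
    open Setoid 𝔸setoid using () renaming (Carrier to 𝔸; _≈_ to _≈ᴬ_)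
    group : AbelianGroup a ℓ′
    group = record { isAbelianGroup = isAbelianGroup }
    module G = GroupProps (AbelianGroup.group group)
    open FunEq 𝔸setoid using (≋-setoid)

    q : Carrier
    q = ι (length els)

  nonzero : 𝔸 → Bool
  nonzero x = not (does (isZero? x))

  ζ : 𝔸 → Carrier
  ζ x = indicator (isZero? x)

  VanishesOn : (Fin k → 𝔸) → Subset k → Set ℓ′
  VanishesOn h B = ∀ e → e ∈ B → h e ≈ᴬ 0𝔸

  vanishesOn? : (h : Fin k → 𝔸) (B : Subset k) → Dec (VanishesOn h B)
  vanishesOn? h B = all? (λ e → (e ∈? B) →-dec isZero? (h e))

  private
    ∑ₗ-unique : {P : 𝔸 → Set p} (P? : Decidable₁ P) → (∀ {x y} → x ≈ᴬ y → P x → P y) →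
                ∀ y → P y → (∀ x → P x → x ≈ᴬ y) → ∑ₗ (λ x → indicator (P? x)) els ≈ 1#
    ∑ₗ-unique P? P-resp y Py uniq = begin
      ∑ₗ (λ x → indicator (P? x)) els       ≈⟨ ∑ₗ-indicator P? els ⟩
      ι (length (filter P? els))            ≡⟨ ≡.cong ι (enumerates-length 𝔸setoid
        (enumerates-filter 𝔸setoid P? P-resp els-enum)
        (((_ , Py) ∷ []) , (λ x (_ , Px) → here (uniq x Px)) , [] ∷ [])) ⟩
      1# + 0#                               ≈⟨ +-identityʳ 1# ⟩
      1#                                    ∎

    ∑ζ : ∑ₗ ζ els ≈ 1#
    ∑ζ = ∑ₗ-unique isZero? (λ x≈y x≈0 → A.trans (A.sym x≈y) x≈0) 0𝔸 A.refl (λ x x≈0 → x≈0)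

    ∑ζ-shift : ∀ y → ∑ₗ (λ x → ζ (y ∙ x)) els ≈ 1#
    ∑ζ-shift y = ∑ₗ-unique (λ x → isZero? (y ∙ x)) (λ x≈z yx≈0 → A.trans (A.∙-congˡ (A.sym x≈z)) yx≈0)
      (inv y) (A.inverseʳ y) (G.inverseʳ-unique y)

  -- Write w₁₀ for `w true false`, and so on. At an edge with difference 0, one value of g gives w₀₀
  -- and q - 1 values give w₁₁. At any other edge one value each gives w₁₀ and w₀₁, and q - 2 give
  -- w₁₁. Hence D = (q - 2)w₁₁ + w₁₀ + w₀₁ and d = w₀₀ + w₁₁ - w₁₀ - w₀₁. Copies of w₁₁ are moved
  -- across to avoid subtraction.
  module _ (w : Bool → Bool → Carrier) (D d : Carrier)
    (zero-edge : q * w true true + w false false ≈ D + d + w true true)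
    (nonzero-edge : q * w true true + w true false + w false true ≈ D + w true true + w true true) where

    private
      w₁₁ = w true true

    edge-sum : ∀ y → ∑ₗ (λ x → w (nonzero (y ∙ x)) (nonzero x)) els ≈ D + ζ y * d
    edge-sum y with isZero? y
    ... | yes y≈0 = trans (+-cancelʳ w₁₁ _ _ (begin
      ∑ₗ W els + w₁₁
        ≈⟨ +-congˡ (trans (∑ₗ-*ʳ w₁₁ ζ els) (trans (*-congʳ ∑ζ) (*-identityˡ w₁₁))) ⟨
      ∑ₗ W els + ∑ₗ (λ x → ζ x * w₁₁) els
        ≈⟨ ∑ₗ-+ W _ els ⟨
      ∑ₗ (λ x → W x + ζ x * w₁₁) els
        ≈⟨ ∑ₗ-cong pointwise els ⟩
      ∑ₗ (λ x → w₁₁ + ζ x * w false false) els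
        ≈⟨ ∑ₗ-+ _ _ els ⟩
      ∑ₗ (λ _ → w₁₁) els + ∑ₗ (λ x → ζ x * w false false) els
        ≈⟨ +-cong (∑ₗ-const w₁₁ els) (trans (∑ₗ-*ʳ _ ζ els) (trans (*-congʳ ∑ζ) (*-identityˡ _))) ⟩
      q * w₁₁ + w false false
        ≈⟨ zero-edge ⟩
      D + d + w₁₁ ∎)) (+-congˡ (sym (*-identityˡ d)))
      where
      W : 𝔸 → Carrier
      W x = w (nonzero (y ∙ x)) (nonzero x)
      yx≈x : ∀ x → y ∙ x ≈ᴬ x
      yx≈x x = A.trans (A.∙-congʳ y≈0) (A.identityˡ x)
      -- Every `x` is counted with `w₁₁`, and the exceptional one is corrected through its
      -- indicator.
      pointwise : ∀ x → W x + ζ x * w₁₁ ≈ w₁₁ + ζ x * w false false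
      pointwise x with isZero? (y ∙ x) | isZero? x
      ... | yes _    | yes _   = trans (+-comm _ _) (+-cong (*-identityˡ _) (sym (*-identityˡ _)))
      ... | no _     | no _    = +-congˡ (trans (zeroˡ _) (sym (zeroˡ _)))
      ... | yes yx≈0 | no x≉0  = contradiction (A.trans (A.sym (yx≈x x)) yx≈0) x≉0
      ... | no yx≉0  | yes x≈0 = contradiction (A.trans (yx≈x x) x≈0) yx≉0
    ... | no y≉0 = trans (+-cancelʳ w₁₁ _ _ (+-cancelʳ w₁₁ _ _ (begin
      ∑ₗ W els + w₁₁ + w₁₁
        ≈⟨ +-cong (+-congˡ (trans (∑ₗ-*ʳ w₁₁ ζ els) (trans (*-congʳ ∑ζ) (*-identityˡ w₁₁))))
                  (trans (∑ₗ-*ʳ w₁₁ ζ′ els) (trans (*-congʳ (∑ζ-shift y)) (*-identityˡ w₁₁))) ⟨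
      ∑ₗ W els + ∑ₗ (λ x → ζ x * w₁₁) els + ∑ₗ (λ x → ζ′ x * w₁₁) els
        ≈⟨ trans (∑ₗ-+ _ _ els) (+-congʳ (∑ₗ-+ W _ els)) ⟨
      ∑ₗ (λ x → W x + ζ x * w₁₁ + ζ′ x * w₁₁) els
        ≈⟨ ∑ₗ-cong pointwise els ⟩
      ∑ₗ (λ x → w₁₁ + ζ x * w true false + ζ′ x * w false true) els
        ≈⟨ trans (∑ₗ-+ _ _ els) (+-congʳ (∑ₗ-+ _ _ els)) ⟩
      ∑ₗ (λ _ → w₁₁) els + ∑ₗ (λ x → ζ x * w true false) els + ∑ₗ (λ x → ζ′ x * w false true) els
        ≈⟨ +-cong (+-cong (∑ₗ-const w₁₁ els) (trans (∑ₗ-*ʳ _ ζ els) (trans (*-congʳ ∑ζ) (*-identityˡ _))))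
                  (trans (∑ₗ-*ʳ _ ζ′ els) (trans (*-congʳ (∑ζ-shift y)) (*-identityˡ _))) ⟩
      q * w₁₁ + w true false + w false true
        ≈⟨ nonzero-edge ⟩
      D + w₁₁ + w₁₁ ∎))) (trans (sym (+-identityʳ D)) (+-congˡ (sym (zeroˡ d))))
      where
      W ζ′ : 𝔸 → Carrier
      W x = w (nonzero (y ∙ x)) (nonzero x)
      ζ′ x = ζ (y ∙ x)
      pointwise : ∀ x → W x + ζ x * w₁₁ + ζ′ x * w₁₁ ≈ w₁₁ + ζ x * w true false + ζ′ x * w false true
      pointwise x with isZero? (y ∙ x) | isZero? x
      -- The two exceptional values, 0 and the inverse of `y`, are different because `y` is nonzero.
      ... | yes yx≈0 | yes x≈0 = contradiction (A.trans (A.sym (A.trans (A.∙-congˡ x≈0) (A.identityʳ y))) yx≈0) y≉0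
      ... | yes _    | no _    = begin
        w false true + 0# * w₁₁ + 1# * w₁₁                ≈⟨ +-cong (trans (+-congˡ (zeroˡ _)) (+-identityʳ _)) (*-identityˡ _) ⟩
        w false true + w₁₁                                ≈⟨ +-comm _ _ ⟩
        w₁₁ + w false true                                ≈⟨ +-cong (trans (+-congˡ (zeroˡ _)) (+-identityʳ _)) (*-identityˡ _) ⟨
        w₁₁ + 0# * w true false + 1# * w false true       ∎
      ... | no _     | yes _   = +-cong (trans (+-comm _ _) (+-cong (*-identityˡ _) (sym (*-identityˡ _))))
                                        (trans (zeroˡ _) (sym (zeroˡ _)))
      ... | no _     | no _    = +-cong (+-congˡ (trans (zeroˡ _) (sym (zeroˡ _)))) (trans (zeroˡ _) (sym (zeroˡ _)))

  module _ (D d : Carrier) where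

    -- `B` is the set of edges at which the summand with `d` is chosen; the product of their
    -- indicators says that `h` vanishes on `B`.
    ∏-expand : ∀ {k} (h : Fin k → 𝔸) →
      ∏ (λ e → D + ζ (h e) * d) ≈ ∑ₛ (λ B → pow d ∣ B ∣ * pow D (k ∸ ∣ B ∣) * indicator (vanishesOn? h B))
    ∏-expand {zero}  h = sym (trans (*-cong (*-identityˡ 1#) (indicator-yes (vanishesOn? h []) (λ _ ()))) (*-identityˡ 1#))
    ∏-expand {suc k} h = begin
      (D + ζ (h zero) * d) * ∏ (λ e → D + ζ (h (suc e)) * d)
        ≈⟨ *-congˡ (∏-expand (λ e → h (suc e))) ⟩
      (D + ζ (h zero) * d) * ∑ₛ F
        ≈⟨ distribʳ _ _ _ ⟩
      D * ∑ₛ F + ζ (h zero) * d * ∑ₛ F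
        ≈⟨ +-cong (∑ₛ-* D F) (∑ₛ-* (ζ (h zero) * d) F) ⟩
      ∑ₛ (λ B → D * F B) + ∑ₛ (λ B → ζ (h zero) * d * F B)
        ≈⟨ +-cong (∑ₛ-cong without) (∑ₛ-cong with-edge) ⟩
      ∑ₛ (λ B → F⁺ (outside ∷ B)) + ∑ₛ (λ B → F⁺ (inside ∷ B)) ∎
      where
      F : Subset k → Carrier
      F B = pow d ∣ B ∣ * pow D (k ∸ ∣ B ∣) * indicator (vanishesOn? (λ e → h (suc e)) B)
      F⁺ : Subset (suc k) → Carrier
      F⁺ B = pow d ∣ B ∣ * pow D (suc k ∸ ∣ B ∣) * indicator (vanishesOn? h B)
      without : ∀ B → D * F B ≈ F⁺ (outside ∷ B)
      without B = begin
        D * (pow d ∣ B ∣ * pow D (k ∸ ∣ B ∣) * v)        ≈⟨ *-assoc D _ v ⟨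
        D * (pow d ∣ B ∣ * pow D (k ∸ ∣ B ∣)) * v        ≈⟨ *-congʳ (CommSemigroup.x∙yz≈y∙xz *-commutativeSemigroup D _ _) ⟩
        pow d ∣ B ∣ * pow D (suc (k ∸ ∣ B ∣)) * v        ≡⟨ ≡.cong (λ j → pow d ∣ B ∣ * pow D j * v) (ℕP.+-∸-assoc 1 (∣p∣≤n B)) ⟨
        pow d ∣ B ∣ * pow D (suc k ∸ ∣ B ∣) * v          ≈⟨ *-congˡ (indicator-⇔ (vanishesOn? (λ e → h (suc e)) B) (vanishesOn? h (outside ∷ B))
          (λ { van (suc e) (there e∈B) → van e e∈B }) (λ van e e∈B → van (suc e) (there e∈B))) ⟩
        F⁺ (outside ∷ B)                                  ∎
        where v = indicator (vanishesOn? (λ e → h (suc e)) B)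
      with-edge : ∀ B → ζ (h zero) * d * F B ≈ F⁺ (inside ∷ B)
      with-edge B = begin
        ζ (h zero) * d * (pow d ∣ B ∣ * pow D (k ∸ ∣ B ∣) * v)
          ≈⟨ *-congʳ (*-comm _ d) ⟩
        d * ζ (h zero) * (pow d ∣ B ∣ * pow D (k ∸ ∣ B ∣) * v)
          ≈⟨ CommSemigroup.interchange *-commutativeSemigroup d _ _ v ⟩
        d * (pow d ∣ B ∣ * pow D (k ∸ ∣ B ∣)) * (ζ (h zero) * v)
          ≈⟨ *-cong (sym (*-assoc d _ _)) (sym (indicator-× (isZero? (h zero)) (vanishesOn? (λ e → h (suc e)) B))) ⟩
        pow d (suc ∣ B ∣) * pow D (k ∸ ∣ B ∣) * indicator (isZero? (h zero) ×-dec vanishesOn? (λ e → h (suc e)) B)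
          ≈⟨ *-congˡ (indicator-⇔ (isZero? (h zero) ×-dec vanishesOn? (λ e → h (suc e)) B) (vanishesOn? h (inside ∷ B))
               (λ { (h0 , van) zero _ → h0 ; (h0 , van) (suc e) (there e∈B) → van e e∈B })
               (λ van → van zero here , λ e e∈B → van (suc e) (there e∈B))) ⟩
        F⁺ (inside ∷ B) ∎
        where v = indicator (vanishesOn? (λ e → h (suc e)) B)

  private
    pow-∣∷∣ : ∀ ω x (A : Subset k) → pow ω ∣ x ∷ A ∣ ≈ (if x then ω else 1#) * pow ω ∣ A ∣
    pow-∣∷∣ ω true  A = refl
    pow-∣∷∣ ω false A = sym (*-identityˡ _)

  pow-∣applyOp∣ : ∀ ω op k (f g : Fin k → Bool) →
    pow ω ∣ applyOp op (tabulate f) (tabulate g) ∣ ≈ ∏ (λ e → weight ω op (f e) (g e))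
  pow-∣applyOp∣ ω op zero    f g = reflexive (≡.cong (λ A → pow ω ∣ A ∣) (applyOp-[] op))
  pow-∣applyOp∣ ω op (suc k) f g = begin
    pow ω ∣ applyOp op (tabulate f) (tabulate g) ∣
      ≡⟨ ≡.cong (λ A → pow ω ∣ A ∣) (applyOp-∷ op (f zero) (g zero) _ _) ⟩
    pow ω ∣ boolOp op (f zero) (g zero) ∷ applyOp op (tabulate (λ e → f (suc e))) (tabulate (λ e → g (suc e))) ∣
      ≈⟨ pow-∣∷∣ ω (boolOp op (f zero) (g zero)) (applyOp op (tabulate (λ e → f (suc e))) (tabulate (λ e → g (suc e)))) ⟩
    weight ω op (f zero) (g zero) * pow ω ∣ applyOp op (tabulate (λ e → f (suc e))) (tabulate (λ e → g (suc e))) ∣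
      ≈⟨ *-congˡ (pow-∣applyOp∣ ω op k (λ e → f (suc e)) (λ e → g (suc e))) ⟩
    ∏ (λ e → weight ω op (f e) (g e)) ∎

  private
    pairs-setoid : Setoid a ℓ′
    pairs-setoid = ×-setoid (≋-setoid m) (≋-setoid m)

    -- Decouples the pair: (f, g) with f - g a flow corresponds to a flow h and an arbitrary g,
    -- which can then be summed freely.
    shift : Pair FD → Pair FD
    shift (h , g) = (λ e → h e ∙ g e) , g

    size : SetOp → Pair FD → ℕ
    size op (f , g) = ∣ applyOp op (supp FD f) (supp FD g) ∣

    nonzero-cong : ∀ {x y} → x ≈ᴬ y → nonzero x ≡ nonzero y
    nonzero-cong {x} {y} x≈y with isZero? x | isZero? y
    ... | yes _   | yes _   = ≡.refl
    ... | no _    | no _    = ≡.refl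
    ... | yes x≈0 | no y≉0  = contradiction (A.trans (A.sym x≈y) x≈0) y≉0
    ... | no x≉0  | yes y≈0 = contradiction (A.trans x≈y y≈0) x≉0

    size-cong : ∀ op {p p′ : Pair FD} → Setoid._≈_ pairs-setoid p p′ → size op p ≡ size op p′
    size-cong op (f≈ , g≈) = ≡.cong₂ (λ A B → ∣ applyOp op A B ∣)
      (tabulate-cong (λ e → nonzero-cong (f≈ e))) (tabulate-cong (λ e → nonzero-cong (g≈ e)))

    x∙y−y : ∀ x y → ((x ∙ y) −𝔸 y) ≈ᴬ x
    x∙y−y x y = A.trans (A.reflexive (−𝔸≡ (x ∙ y) y))
      (A.trans (A.assoc x y (inv y)) (A.trans (A.∙-congˡ (A.inverseʳ y)) (A.identityʳ x)))

    x−y∙y : ∀ x y → ((x −𝔸 y) ∙ y) ≈ᴬ x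
    x−y∙y x y = A.trans (A.∙-congʳ (A.reflexive (−𝔸≡ x y)))
      (A.trans (A.assoc x (inv y) y) (A.trans (A.∙-congˡ (A.inverseˡ y)) (A.identityʳ x)))

  module _ {rk : Subset m → ℕ}
    (flows : ∀ B → ∃[ hs ] (Enumerates (≋-setoid m) (λ h → IsFlow h × VanishesOn h B) hs ×
                            length hs ≡ length els ^ (rk ⊤ ∸ rk B))) where

    private
      Φ Γ : List (Fin m → 𝔸)
      -- Vanishing on the empty set is no condition, so this list contains all flows.
      Φ = proj₁ (flows ∅)
      Γ = supportedFunctions 0𝔸 els ⊤

      IsFlowPair : Pair FD → Set _
      IsFlowPair (f , g) = IsFlow (λ e → f e −𝔸 g e)

      pairs-enum : Enumerates pairs-setoid IsFlowPair (map shift (cartesianProduct Φ Γ))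
      pairs-enum = enumerates-map pairs-setoid pairs-setoid shift
        (λ (h≈ , g≈) → (λ e → A.∙-cong (h≈ e) (g≈ e)) , g≈)
        (λ {(h , g)} ((h-flow , _) , _) → IsFlow-resp (λ e → A.sym (x∙y−y (h e) (g e))) h-flow)
        (λ { {h , g} {h′ , g′} _ _ (hg≈ , g≈) → (λ e →
          G.∙-cancelʳ (g e) (h e) (h′ e) (A.trans (hg≈ e) (A.∙-congˡ (A.sym (g≈ e))))) , g≈ })
        (λ (f , g) f−g-flow → ((λ e → f e −𝔸 g e) , g) ,
          ((f−g-flow , λ e e∈∅ → contradiction e∈∅ ∉⊥) , λ e e∉⊤ → contradiction ∈⊤ e∉⊤) ,
          (λ e → A.sym (x−y∙y (f e) (g e))) , λ e → A.refl)
        (enumerates-× (≋-setoid m) (≋-setoid m) (proj₁ (proj₂ (flows ∅)))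
          (supportedFunctions-enumerates 𝔸setoid 0𝔸 els-enum ⊤))

      -- Selecting from the fixed list of all flows and the list supplied for `B` enumerate the same
      -- flows, so the lengths agree.
      vanishing-count : ∀ B → length (filter (λ h → vanishesOn? h B) Φ) ≡ length els ^ (rk ⊤ ∸ rk B)
      vanishing-count B = ≡.trans (enumerates-length (≋-setoid m)
        (enumerates-⇔ (≋-setoid m)
          (λ ((h-flow , _) , van) → h-flow , van)
          (λ (h-flow , van) → (h-flow , λ e e∈∅ → contradiction e∈∅ ∉⊥) , van)
          (enumerates-filter (≋-setoid m) (λ h → vanishesOn? h B)
            (λ h≈h′ van e e∈B → A.trans (A.sym (h≈h′ e)) (van e e∈B)) (proj₁ (proj₂ (flows ∅)))))
        (proj₁ (proj₂ (flows B)))) (proj₂ (proj₂ (flows B)))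

    module _ {σ : ℕ} (0<σ : 0 < σ) {ω : Carrier} (ω^σ≈1 : pow ω σ ≈ 1#) (op : SetOp) {N : ℕ → ℕ}
      (N-card : ∀ k → k < σ → HasCardinality FD (InM FD op σ k) (N k)) where

      private
        residue : Pair FD → ℕ
        residue p = size op p mod σ

        residue<σ : ∀ p → residue p < σ
        residue<σ p = mod< 0<σ (size op p)
          where
          mod< : ∀ {σ} → 0 < σ → ∀ k → k mod σ < σ
          mod< {suc σ} _ k = m%n<n k (suc σ)

        N≡ : ∀ k → k < σ → N k ≡ length (filter (λ p → residue p ℕ.≟ k) (map shift (cartesianProduct Φ Γ)))
        N≡ k k<σ = let xs , xs-len , xs-enum = N-card k k<σ in
          ≡.trans (≡.sym xs-len) (enumerates-length pairs-setoid xs-enum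
            (enumerates-filter pairs-setoid (λ p → residue p ℕ.≟ k)
              (λ {p} {p′} p≈p′ eq → ≡.trans (≡.cong (_mod σ) (≡.sym (size-cong op {p} {p′} p≈p′))) eq) pairs-enum))

      root-sum : ∀ D d →
        q * weight ω op true true + weight ω op false false ≈ D + d + weight ω op true true →
        q * weight ω op true true + weight ω op true false + weight ω op false true ≈
          D + weight ω op true true + weight ω op true true →
        ∑< σ (λ k → pow ω k * ι (N k)) ≈
        ∑ₛ (λ B → pow d ∣ B ∣ * pow D (m ∸ ∣ B ∣) * pow q (rk ⊤ ∸ rk B))
      root-sum D d zero-edge nonzero-edge = begin
        ∑< σ (λ k → pow ω k * ι (N k))
          ≈⟨ ∑<-cong σ (λ k k<σ → *-congˡ (reflexive (≡.cong ι (N≡ k k<σ)))) ⟩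
        ∑< σ (λ k → pow ω k * ι (length (filter (λ p → residue p ℕ.≟ k) (map shift (cartesianProduct Φ Γ)))))
          ≈⟨ ∑<-by-residue σ (pow ω) residue residue<σ (map shift (cartesianProduct Φ Γ)) ⟩
        ∑ₗ (λ p → pow ω (residue p)) (map shift (cartesianProduct Φ Γ))
          ≈⟨ ∑ₗ-cong (λ p → pow-mod σ (size op p) ω^σ≈1) (map shift (cartesianProduct Φ Γ)) ⟩
        ∑ₗ (λ p → pow ω (size op p)) (map shift (cartesianProduct Φ Γ))
          ≈⟨ trans (∑ₗ-map _ shift (cartesianProduct Φ Γ)) (∑ₗ-cartesianProductWith _ _,_ Φ Γ) ⟩
        ∑ₗ (λ h → ∑ₗ (λ g → pow ω (size op ((λ e → h e ∙ g e) , g))) Γ) Φ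
          ≈⟨ ∑ₗ-cong (λ h → ∑ₗ-cong (λ g → pow-∣applyOp∣ ω op m _ _) Γ) Φ ⟩
        ∑ₗ (λ h → ∑ₗ (λ g → ∏ (λ e → w (nonzero (h e ∙ g e)) (nonzero (g e)))) Γ) Φ
          ≈⟨ ∑ₗ-cong (λ h → ∑ₗ-functions {m = m} 0𝔸 els (λ e x → w (nonzero (h e ∙ x)) (nonzero x))) Φ ⟩
        ∑ₗ (λ h → ∏ (λ e → ∑ₗ (λ x → w (nonzero (h e ∙ x)) (nonzero x)) els)) Φ
          ≈⟨ ∑ₗ-cong (λ h → ∏-cong m (λ e → edge-sum w D d zero-edge nonzero-edge (h e))) Φ ⟩
        ∑ₗ (λ h → ∏ (λ e → D + ζ (h e) * d)) Φ
          ≈⟨ ∑ₗ-cong (λ h → ∏-expand D d h) Φ ⟩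
        ∑ₗ (λ h → ∑ₛ (λ B → pow d ∣ B ∣ * pow D (m ∸ ∣ B ∣) * indicator (vanishesOn? h B))) Φ
          -- With `B` outermost, the indicators summed over all flows count those vanishing on `B`.
          ≈⟨ ∑ₗ-∑ₛ {m = m} (λ h B → pow d ∣ B ∣ * pow D (m ∸ ∣ B ∣) * indicator (vanishesOn? h B)) Φ ⟩
        ∑ₛ (λ B → ∑ₗ (λ h → pow d ∣ B ∣ * pow D (m ∸ ∣ B ∣) * indicator (vanishesOn? h B)) Φ)
          ≈⟨ ∑ₛ-cong {m = m} (λ B → trans (∑ₗ-*ˡ _ (λ h → indicator (vanishesOn? h B)) Φ) (*-congˡ (count B))) ⟩
        ∑ₛ (λ B → pow d ∣ B ∣ * pow D (m ∸ ∣ B ∣) * pow q (rk ⊤ ∸ rk B)) ∎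
        where
        w = weight ω op
        count : ∀ B → ∑ₗ (λ h → indicator (vanishesOn? h B)) Φ ≈ pow q (rk ⊤ ∸ rk B)
        count B = trans (∑ₗ-indicator (λ h → vanishesOn? h B) Φ)
          (trans (reflexive (≡.cong ι (vanishing-count B))) (ι-^ (length els) (rk ⊤ ∸ rk B)))

-- From the subset expansion to the rank polynomial

module RankPolynomial (R : CommutativeRing r ℓ) where
  open CommutativeRing R hiding (zero)
  open RingOps R
  open RingSums R
  open SetoidReasoning setoid

  -- With i = r - rk B and j = |B| - rk B, each term is rewritten by d^j = x^j D^j and q^i D^i =
  -- λ′^i d^i. The leftover powers d^(rk B + i) and D^(m - r) no longer depend on `B`. The product
  -- equations replace division by `d` and `D`.
  rescale : (rk : Subset m → ℕ) → (∀ B → rk B ≤ rk ⊤) → (∀ B → rk B ≤ ∣ B ∣) →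
    ∀ {q D d λ′ x} → λ′ * d ≈ q * D → x * D ≈ d →
    ∑ₛ (λ B → pow d ∣ B ∣ * pow D (m ∸ ∣ B ∣) * pow q (rk ⊤ ∸ rk B)) ≈
    pow d (rk ⊤) * pow D (m ∸ rk ⊤) * ∑ₛ (λ B → pow λ′ (rk ⊤ ∸ rk B) * pow x (∣ B ∣ ∸ rk B))
  rescale {m} rk rk≤r rk≤∣B∣ {q} {D} {d} {λ′} {x} λ′d≈qD xD≈d =
    trans (∑ₛ-cong {m = m} term) (sym (∑ₛ-* {m} _ _))
    where
    interchange = CommSemigroup.interchange *-commutativeSemigroup
    term : ∀ B → pow d ∣ B ∣ * pow D (m ∸ ∣ B ∣) * pow q (rk ⊤ ∸ rk B) ≈
                 pow d (rk ⊤) * pow D (m ∸ rk ⊤) * (pow λ′ (rk ⊤ ∸ rk B) * pow x (∣ B ∣ ∸ rk B))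
    term B = begin
      pow d ∣ B ∣ * pow D (m ∸ ∣ B ∣) * pow q i
        ≈⟨ *-congʳ (*-congʳ (trans (reflexive (≡.cong (pow d) ∣B∣≡)) (pow-+ d s j))) ⟩
      pow d s * pow d j * pow D (m ∸ ∣ B ∣) * pow q i
        ≈⟨ *-congʳ (*-congʳ (*-congˡ (trans (pow-cong j (sym xD≈d)) (pow-* x D j)))) ⟩
      pow d s * (pow x j * pow D j) * pow D (m ∸ ∣ B ∣) * pow q i
        ≈⟨ *-congʳ (trans (*-congʳ (sym (*-assoc _ _ _))) (*-assoc _ _ _)) ⟩
      pow d s * pow x j * (pow D j * pow D (m ∸ ∣ B ∣)) * pow q i
        ≈⟨ *-congʳ (*-congˡ (trans (sym (pow-+ D j (m ∸ ∣ B ∣))) (trans (reflexive (≡.cong (pow D) exponent)) (pow-+ D i (m ∸ rk ⊤))))) ⟩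
      pow d s * pow x j * (pow D i * pow D (m ∸ rk ⊤)) * pow q i
        ≈⟨ *-comm _ _ ⟩
      pow q i * (pow d s * pow x j * (pow D i * pow D (m ∸ rk ⊤)))
        ≈⟨ *-congˡ (trans (*-comm _ _) (*-assoc _ _ _)) ⟩
      pow q i * (pow D i * (pow D (m ∸ rk ⊤) * (pow d s * pow x j)))
        ≈⟨ *-assoc _ _ _ ⟨
      pow q i * pow D i * (pow D (m ∸ rk ⊤) * (pow d s * pow x j))
        ≈⟨ *-congʳ (trans (sym (pow-* q D i)) (trans (pow-cong i (sym λ′d≈qD)) (pow-* λ′ d i))) ⟩
      pow λ′ i * pow d i * (pow D (m ∸ rk ⊤) * (pow d s * pow x j))
        ≈⟨ *-congˡ (trans (sym (*-assoc _ _ _)) (*-congʳ (*-comm _ _))) ⟩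
      pow λ′ i * pow d i * (pow d s * pow D (m ∸ rk ⊤) * pow x j)
        ≈⟨ trans (*-congʳ (*-comm _ _)) (interchange _ _ _ _) ⟩
      pow d i * (pow d s * pow D (m ∸ rk ⊤)) * (pow λ′ i * pow x j)
        ≈⟨ *-congʳ (trans (sym (*-assoc _ _ _)) (*-congʳ (trans (sym (pow-+ d i s)) (reflexive (≡.cong (pow d) (ℕP.m∸n+n≡m (rk≤r B))))))) ⟩
      pow d (rk ⊤) * pow D (m ∸ rk ⊤) * (pow λ′ i * pow x j) ∎
      where
      i j s : ℕ
      i = rk ⊤ ∸ rk B
      j = ∣ B ∣ ∸ rk B
      s = rk B
      ∣B∣≡ : ∣ B ∣ ≡ s ℕ.+ j
      ∣B∣≡ = ≡.sym (ℕP.m+[n∸m]≡n (rk≤∣B∣ B))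
      r≤m : rk ⊤ ≤ m
      r≤m = ℕP.≤-trans (rk≤∣B∣ ⊤) (∣p∣≤n {m} ⊤)
      -- Both sides equal m - rk B, reached through |B| on the left and through r on the right.
      exponent : j ℕ.+ (m ∸ ∣ B ∣) ≡ i ℕ.+ (m ∸ rk ⊤)
      exponent = ≡.trans (ℕP.+-comm j _) (≡.trans (between (∣p∣≤n B) (rk≤∣B∣ B))
        (≡.trans (≡.sym (between r≤m (rk≤r B))) (ℕP.+-comm (m ∸ rk ⊤) i)))
        where
        between : ∀ {x y z} → y ≤ z → x ≤ y → (z ∸ y) ℕ.+ (y ∸ x) ≡ z ∸ x
        between {x} {y} {z} y≤z x≤y = ≡.trans (≡.sym (ℕP.+-∸-assoc (z ∸ y) x≤y)) (≡.cong (_∸ x) (ℕP.m∸n+n≡m y≤z))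

-- Rank bounds and the two module structures

module RankBounds (R : CommutativeRing a ℓ) (G : Matrix (CommutativeRing.Carrier R) n m) {rk : Subset m → ℕ}
  (isRank : RingOps.IsRankFunction R G rk) where

  rank≤total : ∀ B → rk B ≤ rk ⊤
  rank≤total B = let (I , _ , ind , ∣I∣≡) , _ = isRank B in
    ≡.subst (_≤ rk ⊤) ∣I∣≡ (proj₂ (isRank ⊤) I (λ _ → ∈⊤) ind)

  rank≤∣∣ : ∀ B → rk B ≤ ∣ B ∣
  rank≤∣∣ B = let (I , I⊆B , _ , ∣I∣≡) , _ = isRank B in ≡.subst (_≤ ∣ B ∣) ∣I∣≡ (p⊆q⇒∣p∣≤∣q∣ I⊆B)

module IntegerModule (𝔸 : AbelianGroup a ℓ) where
  open AbelianGroup 𝔸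
  open AbelianGroupProps 𝔸 using (ε⁻¹≈ε; ⁻¹-∙-comm; ⁻¹-involutive)
  open Mult commutativeMonoid using (×-homo-+; ×-distrib-+) renaming (_×_ to _·_)
  open SetoidReasoning setoid

  private
    natMul≡× : ∀ n x → natMul 𝔸 n x ≡ n · x
    natMul≡× zero    x = ≡.refl
    natMul≡× (suc n) x = ≡.cong (x ∙_) (natMul≡× n x)

    natMul-cong : ∀ n {x y} → x ≈ y → natMul 𝔸 n x ≈ natMul 𝔸 n y
    natMul-cong zero    x≈y = refl
    natMul-cong (suc n) x≈y = ∙-cong x≈y (natMul-cong n x≈y)

    natMul-+ : ∀ i j x → natMul 𝔸 (i ℕ.+ j) x ≈ natMul 𝔸 i x ∙ natMul 𝔸 j x
    natMul-+ i j x rewrite natMul≡× (i ℕ.+ j) x | natMul≡× i x | natMul≡× j x = ×-homo-+ x i j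

    natMul-∙ : ∀ n x y → natMul 𝔸 n (x ∙ y) ≈ natMul 𝔸 n x ∙ natMul 𝔸 n y
    natMul-∙ n x y rewrite natMul≡× n (x ∙ y) | natMul≡× n x | natMul≡× n y = ×-distrib-+ x y n

    natMul-ε : ∀ n → natMul 𝔸 n ε ≈ ε
    natMul-ε zero    = refl
    natMul-ε (suc n) = trans (identityˡ _) (natMul-ε n)

    cancel : ∀ x y z → (x ∙ y) ∙ (x ∙ z) ⁻¹ ≈ y ∙ z ⁻¹
    cancel x y z = begin
      (x ∙ y) ∙ (x ∙ z) ⁻¹          ≈⟨ ∙-congˡ (⁻¹-∙-comm x z) ⟨
      (x ∙ y) ∙ (x ⁻¹ ∙ z ⁻¹)       ≈⟨ CommSemigroup.interchange (AbelianGroup.commutativeSemigroup 𝔸) x y (x ⁻¹) (z ⁻¹) ⟩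
      (x ∙ x ⁻¹) ∙ (y ∙ z ⁻¹)       ≈⟨ ∙-congʳ (inverseʳ x) ⟩
      ε ∙ (y ∙ z ⁻¹)                ≈⟨ identityˡ _ ⟩
      y ∙ z ⁻¹                      ∎

    -- A sum of integers of opposite signs computes to `⊖`, so this is the mixed-sign case of
    -- additivity.
    intMul-⊖ : ∀ i j x → intMul 𝔸 (i ℤ.⊖ j) x ≈ natMul 𝔸 i x ∙ natMul 𝔸 j x ⁻¹
    intMul-⊖ i       zero    x = sym (trans (∙-congˡ ε⁻¹≈ε) (identityʳ _))
    intMul-⊖ zero    (suc j) x = sym (identityˡ _)
    intMul-⊖ (suc i) (suc j) x rewrite ℤP.[1+m]⊖[1+n]≡m⊖n i j =
      trans (intMul-⊖ i j x) (sym (cancel x (natMul 𝔸 i x) (natMul 𝔸 j x)))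

    intMul-cong : ∀ z {x y} → x ≈ y → intMul 𝔸 z x ≈ intMul 𝔸 z y
    intMul-cong (+ n)    x≈y = natMul-cong n x≈y
    intMul-cong -[1+ n ] x≈y = ⁻¹-cong (natMul-cong (suc n) x≈y)

    intMul-+ : ∀ x i j → intMul 𝔸 (i ℤ.+ j) x ≈ intMul 𝔸 i x ∙ intMul 𝔸 j x
    intMul-+ x (+ i)    (+ j)    = natMul-+ i j x
    intMul-+ x (+ i)    -[1+ j ] = intMul-⊖ i (suc j) x
    intMul-+ x -[1+ i ] (+ j)    = trans (intMul-⊖ j (suc i) x) (comm _ _)
    intMul-+ x -[1+ i ] -[1+ j ] = begin
      natMul 𝔸 (suc (suc (i ℕ.+ j))) x ⁻¹                     ≡⟨ ≡.cong (λ k → natMul 𝔸 k x ⁻¹) (≡.cong suc (ℕP.+-suc i j)) ⟨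
      natMul 𝔸 (suc i ℕ.+ suc j) x ⁻¹                         ≈⟨ ⁻¹-cong (natMul-+ (suc i) (suc j) x) ⟩
      (natMul 𝔸 (suc i) x ∙ natMul 𝔸 (suc j) x) ⁻¹            ≈⟨ ⁻¹-∙-comm _ _ ⟨
      natMul 𝔸 (suc i) x ⁻¹ ∙ natMul 𝔸 (suc j) x ⁻¹           ∎

    intMul-neg : ∀ i x → intMul 𝔸 (ℤ.- i) x ≈ intMul 𝔸 i x ⁻¹
    intMul-neg (+ zero)    x = sym ε⁻¹≈ε
    intMul-neg (+ suc n)   x = refl
    intMul-neg -[1+ n ]    x = sym (⁻¹-involutive _)

    intMul-∙ : ∀ i x y → intMul 𝔸 i (x ∙ y) ≈ intMul 𝔸 i x ∙ intMul 𝔸 i y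
    intMul-∙ (+ n)    x y = natMul-∙ n x y
    intMul-∙ -[1+ n ] x y = trans (⁻¹-cong (natMul-∙ (suc n) x y)) (sym (⁻¹-∙-comm _ _))

    intMul-ε : ∀ i → intMul 𝔸 i ε ≈ ε
    intMul-ε (+ n)    = natMul-ε n
    intMul-ε -[1+ n ] = trans (⁻¹-cong (natMul-ε (suc n))) ε⁻¹≈ε

    intMul-*⁺ : ∀ i j x → intMul 𝔸 (+ i ℤ.* j) x ≈ natMul 𝔸 i (intMul 𝔸 j x)
    intMul-*⁺ zero    j x = reflexive (≡.cong (λ z → intMul 𝔸 z x) (ℤP.*-zeroˡ j))
    intMul-*⁺ (suc i) j x = begin
      intMul 𝔸 (+ suc i ℤ.* j) x                  ≡⟨ ≡.cong (λ z → intMul 𝔸 z x) (ℤP.suc-* (+ i) j) ⟩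
      intMul 𝔸 (j ℤ.+ + i ℤ.* j) x                ≈⟨ intMul-+ x j (+ i ℤ.* j) ⟩
      intMul 𝔸 j x ∙ intMul 𝔸 (+ i ℤ.* j) x       ≈⟨ ∙-congˡ (intMul-*⁺ i j x) ⟩
      natMul 𝔸 (suc i) (intMul 𝔸 j x)             ∎

    intMul-* : ∀ i j x → intMul 𝔸 (i ℤ.* j) x ≈ intMul 𝔸 i (intMul 𝔸 j x)
    intMul-* (+ i)    j x = intMul-*⁺ i j x
    intMul-* -[1+ i ] j x = begin
      intMul 𝔸 (-[1+ i ] ℤ.* j) x                 ≡⟨ ≡.cong (λ z → intMul 𝔸 z x) (ℤP.neg-distribˡ-* (+ suc i) j) ⟨
      intMul 𝔸 (ℤ.- (+ suc i ℤ.* j)) x            ≈⟨ intMul-neg (+ suc i ℤ.* j) x ⟩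
      intMul 𝔸 (+ suc i ℤ.* j) x ⁻¹               ≈⟨ ⁻¹-cong (intMul-*⁺ (suc i) j x) ⟩
      natMul 𝔸 (suc i) (intMul 𝔸 j x) ⁻¹          ∎

  ℤ-module : LeftModule ℤP.+-*-ring a ℓ
  ℤ-module = record
    { _≈ᴹ_ = _≈_ ; _+ᴹ_ = _∙_ ; _*ₗ_ = intMul 𝔸 ; 0ᴹ = ε ; -ᴹ_ = _⁻¹
    ; isLeftModule = record
      { isLeftSemimodule = record
        { +ᴹ-isCommutativeMonoid = isCommutativeMonoid
        ; isPreleftSemimodule = record
          { *ₗ-cong = λ { {i} ≡.refl x≈y → intMul-cong i x≈y }
          ; *ₗ-zeroˡ = λ x → refl
          ; *ₗ-distribʳ = λ x i j → intMul-+ x i j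
          ; *ₗ-identityˡ = identityʳ
          ; *ₗ-assoc = intMul-*
          ; *ₗ-zeroʳ = intMul-ε
          ; *ₗ-distribˡ = intMul-∙ } }
      ; -ᴹ‿cong = ⁻¹-cong
      ; -ᴹ‿inverse = inverse } }

module PowerModule (R : CommutativeRing a ℓ) (d : ℕ) where
  open CommutativeRing R hiding (zero)

  power-module : LeftModule ring a ℓ
  power-module = record
    { Carrierᴹ = Fin d → Carrier
    ; _≈ᴹ_ = λ x y → ∀ j → x j ≈ y j ; _+ᴹ_ = λ x y j → x j + y j ; _*ₗ_ = λ r x j → r * x j
    ; 0ᴹ = λ _ → 0# ; -ᴹ_ = λ x j → - x j
    ; isLeftModule = record
      { isLeftSemimodule = record
        { +ᴹ-isCommutativeMonoid = record
          { isMonoid = record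
            { isSemigroup = record
              { isMagma = record
                { isEquivalence = Setoid.isEquivalence (FunEq.≋-setoid setoid d)
                ; ∙-cong = λ x≈y z≈w j → +-cong (x≈y j) (z≈w j) }
              ; assoc = λ x y z j → +-assoc _ _ _ }
            ; identity = (λ x j → +-identityˡ _) , (λ x j → +-identityʳ _) }
          ; comm = λ x y j → +-comm _ _ }
        ; isPreleftSemimodule = record
          { *ₗ-cong = λ r≈s x≈y j → *-cong r≈s (x≈y j)
          ; *ₗ-zeroˡ = λ x j → zeroˡ _
          ; *ₗ-distribʳ = λ x r s j → distribʳ _ _ _
          ; *ₗ-identityˡ = λ x j → *-identityˡ _
          ; *ₗ-assoc = λ r s x j → *-assoc _ _ _
          ; *ₗ-zeroʳ = λ r j → zeroʳ r
          ; *ₗ-distribˡ = λ r x y j → distribˡ _ _ _ } }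
      ; -ᴹ‿cong = λ x≈y j → -‿cong (x≈y j)
      ; -ᴹ‿inverse = (λ x j → -‿inverseˡ _) , (λ x j → -‿inverseʳ _) } }

  -- Flows are given coordinate by coordinate in the setting but as sums of whole vectors in the
  -- module; this reconciles the two.
  sumFin-pointwise : ∀ {k} (f : Fin k → Fin d → Carrier) j →
    sumFin (λ _ → 0#) (λ x y j → x j + y j) f j ≡ sumFin 0# _+_ (λ i → f i j)
  sumFin-pointwise {zero}  f j = ≡.refl
  sumFin-pointwise {suc k} f j = ≡.cong (λ x → f zero j + x) (sumFin-pointwise (λ i → f (suc i)) j)

opaque
  unfolding embed

  -- The hypothesis on the rank uses the fractions G i e / 1, which coincide with the opaque `embed`
  -- only where it is unfolded.
  embedded-rank : (G : Matrix ℤ n m) {rk : Subset m → ℕ} →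
    RingOps.IsRankFunction ℚP.+-*-commutativeRing (λ i e → G i e ℚ./ 1) rk →
    RingOps.IsRankFunction ℚP.+-*-commutativeRing (embed-mat G) rk
  embedded-rank G isRank = isRank

-- The expansion in both cases of the setting

module _ {n m q : ℕ} {rk : Subset m → ℕ} where

  -- They guarantee that the truncated differences in the exponents are true differences.
  RankInequalities : Set
  RankInequalities = (∀ B → rk B ≤ rk ⊤) × (∀ B → rk B ≤ ∣ B ∣)

  rank-inequalities : (S : Setting a ℓ n m q) → IsRank S rk → RankInequalities
  rank-inequalities (caseI G _ _ _ _) isRank = rank≤total , rank≤∣∣
    where open RankBounds ℚP.+-*-commutativeRing (λ i e → G i e ℚ./ 1) (lower isRank)
  rank-inequalities (caseII F d _ G) isRank = rank≤total , rank≤∣∣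
    where open RankBounds (FiniteField.commRing F) G isRank

module _ (R : CommutativeRing r ℓ) {σ : ℕ} (0<σ : 0 < σ) {ω : CommutativeRing.Carrier R}
  (ω^σ≈1 : CommutativeRing._≈_ R (RingOps.pow R ω σ) (CommutativeRing.1# R)) where

  open CommutativeRing R hiding (zero)
  open RingOps R
  open RingSums R
  open Weights R ω

  -- Abstracted over `q` because in case (ii) the length of the list of elements of the module is
  -- only provably, not definitionally, equal to the stated order.
  EdgeExpansion : (m q : ℕ) (rk : Subset m → ℕ) → SetOp → Carrier → Set _
  EdgeExpansion m q rk op lhs = ∀ D d →
    ι q * weight op true true + weight op false false ≈ D + d + weight op true true →
    ι q * weight op true true + weight op true false + weight op false true ≈
      D + weight op true true + weight op true true →
    lhs ≈ ∑ₛ (λ B → pow d ∣ B ∣ * pow D (m ∸ ∣ B ∣) * pow (ι q) (rk ⊤ ∸ rk B))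

  setting-expansion : ∀ {n m q} (S : Setting a ℓ′ n m q) {rk : Subset m → ℕ} → IsRank S rk →
    ∀ op {N : ℕ → ℕ} → (∀ k → k < σ → CardM S op σ k (N k)) →
    EdgeExpansion m q rk op (∑< σ (λ k → pow ω k * ι (N k)))
  setting-expansion (caseI G totallyP 𝔸 _≟_ (els , ≡.refl , complete , distinct)) {rk} isRank op N-card =
    Expansion.root-sum R (flowData (caseI G totallyP 𝔸 _≟_ (els , ≡.refl , complete , distinct)))
      _∙_ _⁻¹ isAbelianGroup (λ _ _ → ≡.refl)
      (λ f≈h (coef , f≈) → coef , λ e → trans′ (sym′ (f≈h e)) (f≈ e))
      els-enum {rk} (ModuleFlows.flows-vanishing-count ℤP.+-*-commutativeRing (IntegerModule.ℤ-module 𝔸) G {rk}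
        els-enum bases (proj₁ (rank-inequalities (caseI G totallyP 𝔸 _≟_ (els , ≡.refl , complete , distinct)) isRank)))
      0<σ ω^σ≈1 op N-card
    where
    open AbelianGroup 𝔸 using (_∙_; _⁻¹; isAbelianGroup) renaming (setoid to 𝔸-setoid; sym to sym′; trans to trans′)
    els-enum : Enumerates 𝔸-setoid (λ _ → ⊤₀) els
    els-enum = All.universal _ els , (λ x _ → complete x) , distinct
    -- The basis is found over ℚ, where the rank is defined; unimodularity then replaces its dual
    -- vectors by integral ones.
    bases : ∀ B → Z.FlowBasis G rk B
    bases B = flowBasis G rb (totallyP-unimodular G totallyP (Q.RankBasis.system rb))
      where rb = QF.rankBasis (embed-mat G) (embedded-rank G (lower isRank)) B
  setting-expansion {m = m} (caseII F d ≡.refl G) {rk} isRank op {N} N-card =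
    ≡.subst (λ q → EdgeExpansion m q rk op (∑< σ (λ k → pow ω k * ι (N k)))) ∣els∣≡q
      (Expansion.root-sum R (flowData (caseII F d ≡.refl G))
        _+ᴹ_ -ᴹ_ +ᴹ-isAbelianGroup (λ _ _ → ≡.refl)
        (λ f≈h (coef , f≈) → coef , λ e j → F.trans (F.sym (f≈h e j)) (f≈ e j))
        els-enum {rk} flows 0<σ ω^σ≈1 op N-card)
    where
    module F = CommutativeRing (FiniteField.commRing F)
    open FiniteField F using (elements; enumerates; distinct; order) renaming (_≟_ to _≈?_)
    open PowerModule (FiniteField.commRing F) d
    open LeftModule power-module using (_+ᴹ_; -ᴹ_; +ᴹ-isAbelianGroup; ≈ᴹ-setoid)
    module Flows = ModuleFlows (FiniteField.commRing F) power-module G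
    elements-enum : Enumerates F.setoid (λ _ → ⊤₀) elements
    elements-enum = All.universal _ elements , (λ x _ → enumerates x) , distinct
    els : List (Fin d → F.Carrier)
    els = supportedFunctions F.0# elements (⊤ {d})
    els-enum : Enumerates ≈ᴹ-setoid (λ _ → ⊤₀) els
    els-enum = enumerates-⇔ ≈ᴹ-setoid (λ _ → _) (λ _ e e∉⊤ → contradiction ∈⊤ e∉⊤)
      (supportedFunctions-enumerates F.setoid F.0# elements-enum (⊤ {d}))
    ∣els∣≡q : length els ≡ (FiniteField.p F ^ FiniteField.s F) ^ d
    ∣els∣≡q = ≡.trans (length-supportedFunctions F.0# elements (⊤ {d})) (≡.cong₂ (λ x y → x ^ y) order (∣⊤∣≡n d))
    module LA = FieldLinearAlgebra (FiniteField.field′ F) _≈?_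
    -- Here the dual vectors already lie in the right ring, so the transfer is along the identity
    -- and just repackages the basis.
    module Id = Transfer (FiniteField.commRing F) (FiniteField.commRing F) (λ x → x)
      (Identity.isRingMonomorphism F.rawRing F.refl)
    bases : ∀ B → DualSystems.FlowBasis (FiniteField.commRing F) G rk B
    bases B = Id.flowBasis G rb (DualSystems.RankBasis.system rb)
      where rb = LA.rankBasis G isRank B
    flows : ∀ B → _
    flows B =
      let hs , hs-enum , hs-len = Flows.flows-vanishing-count {rk} els-enum bases
            (proj₁ (rank-inequalities (caseII F d ≡.refl G) isRank)) B
      in hs , enumerates-⇔ (FunEq.≋-setoid ≈ᴹ-setoid m)
        (λ ((coef , h≈) , van) → (coef , λ e j → F.trans (h≈ e j) (F.reflexive (sumFin-pointwise (λ i j → G i e F.* coef i j) j))) , van)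
        (λ ((coef , h≈) , van) → (coef , λ e j → F.trans (h≈ e j) (F.reflexive (≡.sym (sumFin-pointwise (λ i j → G i e F.* coef i j) j)))) , van)
        hs-enum , hs-len

-- The constants D and d of the five operations

module EdgeWeights (R : CommutativeRing r ℓ) (q ω : CommutativeRing.Carrier R) where
  open CommutativeRing R hiding (zero)
  open RingOps R
  open RingProps ring using (+-cancelʳ)
  open NatSolver commutativeSemiring
  open SetoidReasoning setoid

  private
    cancel : ∀ x y → (x − y) + y ≈ x
    cancel x y = trans (+-assoc x (- y) y) (trans (+-congˡ (-‿inverseˡ y)) (+-identityʳ x))

    two : ∀ {k} → Polynomial k
    two = con 1 :+ (con 1 :+ con 0)

  -- Here w₁₁ = w₁₀ = w₀₁ = ω and w₀₀ = 1. In the later identities the weight ω sits at 11 for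
  -- intersection, at 10 and 01 for symmetric difference, at 00 for the Sheffer stroke, and
  -- everywhere but 10 for implication; all other weights are 1.
  union-zero : q * ω + 1# ≈ ω * q + (1# − ω) + ω
  union-zero = trans (+-cong (*-comm q ω) (sym (cancel 1# ω))) (sym (+-assoc _ _ _))

  union-nonzero : q * ω + ω + ω ≈ ω * q + ω + ω
  union-nonzero = +-congʳ (+-congʳ (*-comm q ω))

  intersection-zero : q * ω + 1# ≈ (ι 2 + ω * (q − ι 2)) + (ω − 1#) + ω
  intersection-zero = begin
    -- Writing q as (q - 2) + 2, with the difference as an atom, makes the remaining identity one of
    -- commutative semirings.
    q * ω + 1#                                       ≈⟨ +-congʳ (*-congʳ (cancel q (ι 2))) ⟨
    ((q − ι 2) + ι 2) * ω + 1#                       ≈⟨ solve 2 (λ s w → (s :+ two) :* w :+ con 1 := w :+ (con 1 :+ w :* s :+ w)) refl (q − ι 2) ω ⟩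
    ω + (1# + ω * (q − ι 2) + ω)                     ≈⟨ +-congʳ (cancel ω 1#) ⟨
    ((ω − 1#) + 1#) + (1# + ω * (q − ι 2) + ω)       ≈⟨ solve 3 (λ s w p → (p :+ con 1) :+ (con 1 :+ w :* s :+ w) := (two :+ w :* s) :+ p :+ w) refl (q − ι 2) ω (ω − 1#) ⟩
    (ι 2 + ω * (q − ι 2)) + (ω − 1#) + ω             ∎

  intersection-nonzero : q * ω + 1# + 1# ≈ (ι 2 + ω * (q − ι 2)) + ω + ω
  intersection-nonzero = begin
    q * ω + 1# + 1#                                  ≈⟨ +-congʳ (+-congʳ (*-congʳ (cancel q (ι 2)))) ⟨
    ((q − ι 2) + ι 2) * ω + 1# + 1#                  ≈⟨ solve 2 (λ s w → (s :+ two) :* w :+ con 1 :+ con 1 := (two :+ w :* s) :+ w :+ w) refl (q − ι 2) ω ⟩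
    (ι 2 + ω * (q − ι 2)) + ω + ω                    ∎

  symdiff-zero : q * 1# + 1# ≈ (ι 2 * ω + q − ι 2) + (ι 2 − ι 2 * ω) + 1#
  -- Adding 2 + 2ω clears the subtractions in D and in d at once.
  symdiff-zero = +-cancelʳ (ι 2 + ι 2 * ω) _ _ (begin
    (q * 1# + 1#) + (ι 2 + ι 2 * ω)                  ≈⟨ solve 2 (λ q w → (q :* con 1 :+ con 1) :+ (two :+ two :* w) := (two :* w :+ q) :+ two :+ con 1) refl q ω ⟩
    (ι 2 * ω + q) + ι 2 + 1#                         ≈⟨ +-congʳ (+-cong (cancel (ι 2 * ω + q) (ι 2)) (cancel (ι 2) (ι 2 * ω))) ⟨
    ((ι 2 * ω + q − ι 2) + ι 2) + ((ι 2 − ι 2 * ω) + ι 2 * ω) + 1#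
      ≈⟨ solve 3 (λ x y w → (x :+ two) :+ (y :+ two :* w) :+ con 1 := (x :+ y :+ con 1) :+ (two :+ two :* w)) refl (ι 2 * ω + q − ι 2) (ι 2 − ι 2 * ω) ω ⟩
    ((ι 2 * ω + q − ι 2) + (ι 2 − ι 2 * ω) + 1#) + (ι 2 + ι 2 * ω) ∎)

  symdiff-nonzero : q * 1# + ω + ω ≈ (ι 2 * ω + q − ι 2) + 1# + 1#
  symdiff-nonzero = begin
    q * 1# + ω + ω                                   ≈⟨ solve 2 (λ q w → q :* con 1 :+ w :+ w := two :* w :+ q) refl q ω ⟩
    ι 2 * ω + q                                      ≈⟨ cancel (ι 2 * ω + q) (ι 2) ⟨
    (ι 2 * ω + q − ι 2) + ι 2                        ≈⟨ solve 1 (λ x → x :+ two := x :+ con 1 :+ con 1) refl (ι 2 * ω + q − ι 2) ⟩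
    (ι 2 * ω + q − ι 2) + 1# + 1#                    ∎

  sheffer-zero : q * 1# + ω ≈ q + (ω − 1#) + 1#
  sheffer-zero = trans (+-cong (*-identityʳ q) (sym (cancel ω 1#))) (sym (+-assoc _ _ _))

  sheffer-nonzero : q * 1# + 1# + 1# ≈ q + 1# + 1#
  sheffer-nonzero = +-congʳ (+-congʳ (*-identityʳ q))

  implication-zero : q * ω + ω ≈ (1# + ω * (q − 1#)) + (ω − 1#) + ω
  implication-zero = begin
    q * ω + ω                                        ≈⟨ +-congʳ (*-congʳ (cancel q 1#)) ⟨
    ((q − 1#) + 1#) * ω + ω                          ≈⟨ solve 2 (λ s w → (s :+ con 1) :* w :+ w := w :+ (w :* s :+ w)) refl (q − 1#) ω ⟩
    ω + (ω * (q − 1#) + ω)                           ≈⟨ +-congʳ (cancel ω 1#) ⟨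
    ((ω − 1#) + 1#) + (ω * (q − 1#) + ω)             ≈⟨ solve 3 (λ s w p → (p :+ con 1) :+ (w :* s :+ w) := (con 1 :+ w :* s) :+ p :+ w) refl (q − 1#) ω (ω − 1#) ⟩
    (1# + ω * (q − 1#)) + (ω − 1#) + ω               ∎

  implication-nonzero : q * ω + 1# + ω ≈ (1# + ω * (q − 1#)) + ω + ω
  implication-nonzero = begin
    q * ω + 1# + ω                                   ≈⟨ +-congʳ (+-congʳ (*-congʳ (cancel q 1#))) ⟨
    ((q − 1#) + 1#) * ω + 1# + ω                     ≈⟨ solve 2 (λ s w → (s :+ con 1) :* w :+ con 1 :+ w := (con 1 :+ w :* s) :+ w :+ w) refl (q − 1#) ω ⟩
    (1# + ω * (q − 1#)) + ω + ω                      ∎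

theorem4p16 : ∀ {c ℓ a ℓa : Level}
    (K : Field c ℓ) → CharacteristicZero K →
    (σ : ℕ) → 1 < σ →
    (ω : Field.Carrier K) → PrimitiveRoot K σ ω →
    ∀ {n m q : ℕ} (S : Setting a ℓa n m q) →
    (rk : Subset m → ℕ) → IsRank S rk →
    (N : SetOp → ℕ → ℕ) → (∀ ∘ k → k < σ → CardM S ∘ σ k (N ∘ k)) →
    let open Identities K σ ω m q rk N in
    PartA × PartB × PartC × PartD × PartE
theorem4p16 K _ σ 1<σ ω (ω^σ≈1 , _) {m = m} {q} S rk isRank N N-card =
  (λ λ′ x λ′-eq x-eq →
    trans (expand union (ω * ι q) (1# − ω) union-zero union-nonzero)
          -- The given numerator ωq² is regrouped as q times D, with D = ωq.
          (rescaled (trans λ′-eq (trans (*-congʳ (*-comm ω _)) (*-assoc _ ω _))) x-eq)) ,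
  (λ _ λ′ x λ′-eq x-eq →
    trans (expand intersection _ _ intersection-zero intersection-nonzero) (rescaled λ′-eq x-eq)) ,
  (λ _ λ′ x λ′-eq x-eq →
    trans (expand symdiff _ _ symdiff-zero symdiff-nonzero) (rescaled λ′-eq x-eq)) ,
  (λ λ′ x λ′-eq x-eq →
    trans (expand sheffer _ _ sheffer-zero sheffer-nonzero) (rescaled λ′-eq x-eq)) ,
  (λ _ λ′ x λ′-eq x-eq →
    trans (expand implication _ _ implication-zero implication-nonzero) (rescaled λ′-eq x-eq))
  where
  open Field K using (commRing)
  open CommutativeRing commRing using (_*_; 1#; trans; *-congʳ; *-comm; *-assoc; sym)
  open RingOps commRing using (ι; _−_)
  open EdgeWeights commRing (ι q) ω

  expand = λ op → setting-expansion commRing (ℕP.<-trans (ℕ.s≤s ℕ.z≤n) 1<σ) ω^σ≈1 S {rk} isRank op (N-card op)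

  rescaled = λ {D} {d} {λ′} {x} → RankPolynomial.rescale commRing rk
    (proj₁ (rank-inequalities S isRank)) (proj₂ (rank-inequalities S isRank)) {ι q} {D} {d} {λ′} {x}
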